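{- Let $p\notin\{2,11\}$ be a prime such that all roots of $X^3-X^2-X-1$ lie in $\mathbb Q_p$ and $3\nmid N_p$. Assume that every $\ell\in\{0,1,\dots,N_p-1\}$ with $p\mid T(\ell)$ satisfies both $T(\ell+N_p)\not\equiv T(\ell)\pmod{p^2}$ and $\ell\equiv a\pmod{N_p}$ for some $a\in\{0,-1,-4,-17,1/3,-5/3\}$. Then $\mathrm{MLR}(p)$ holds.
   Context: $T$ is the Tribonacci sequence ($T(0)=0,T(1)=T(2)=1$, $T(n+3)=T(n+2)+T(n+1)+T(n)$, $n\in\mathbb Z$); $\nu_p$ is the $p$-adic valuation on $\mathbb Q$, $\nu_p(0)=\infty$. $N_p$ is the order of the subgroup of $(\mathcal O/p\mathcal O)^\times$ generated by the images of the roots of $X^3-X^2-X-1$, where $\mathcal O$ is the ring of integers of the splitting field of this polynomial over $\mathbb Q_p$ (here $\mathcal O=\mathbb Z_p$). Congruences of rationals modulo $M$: $x\equiv y\pmod M$ means $mx\equiv my\pmod M$ for some $m\in\mathbb Z$ coprime to $M$ with $mx,my\in\mathbb Z$. $\mathrm{MLR}(p)$: there exists a positive integer $Q$ such that for every $i\in\{0,\dots,Q-1\}$ either (C) there is $\kappa_i\in\mathbb Z_{\ge0}$ with $\nu_p(T(n))=\kappa_i$ for all but finitely many $n\in\mathbb Z$, $n\equiv i\pmod Q$, or (L) there exist $a_i\in\mathbb Q$, $\kappa_i\in\mathbb Z$, $\mu_i\in\mathbb Z_{>0}$ with $\nu_p(a_i-i)\ge\nu_p(Q)$ and $\nu_p(T(n))=\kappa_i+\mu_i\nu_p(n-a_i)$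 for all but finitely many $n\in\mathbb Z$, $n\equiv i\pmod Q$. -}

module Defs where

open import Algebra.Bundles using (CommutativeRing; Group)
open import Data.Fin.Base using (Fin)
open import Data.Integer.Base as ℤ using (ℤ; +_; -[1+_]; 0ℤ; 1ℤ; -1ℤ)
import Data.Integer.Coprimality as ℤ using (Coprime)
open import Data.Integer.Divisibility.Signed as ℤ using (divides)
import Data.Integer.Properties as ℤ
open import Data.Integer.Tactic.RingSolver using (solve-∀)
open import Data.List.Base using (List; []; _∷_; map; foldr)
open import Data.List.Membership.Propositional using (_∉_)
import Data.Maybe.Base as Maybe
open import Data.Nat.Base as ℕ using (ℕ; zero; suc)
import Data.Nat.Divisibility as ℕ using (_∣?_)
import Data.Nat.Properties as ℕ
open import Data.Product.Base using (Σ; ∃; ∃-syntax; _×_; _,_; proj₁; proj₂)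
open import Data.Rational.Base as ℚ using (ℚ; ↥_; ↧ₙ_)
open import Data.Sum.Base using (_⊎_)
open import Function.Bundles using (Bijection)
open import Level using (Level; 0ℓ; _⊔_)
open import Relation.Binary.Bundles using (Setoid)
import Relation.Binary.Construct.Add.Supremum.NonStrict as Supremum
open import Relation.Binary.PropositionalEquality as ≡ using (_≡_; refl)
open import Relation.Binary.Structures using (IsEquivalence)
open import Relation.Nullary.Construct.Add.Supremum using (_⁺; ⊤⁺; [_])
open import Relation.Nullary.Decidable using (yes; no)
open import Relation.Unary using (Pred)

private
  variable
    a b c ℓ : Level

------------------------------------------------------------------------
-- The Tribonacci sequence on ℤ

T⁺ : ℕ → ℤ
T⁺ 0 = 0ℤ
T⁺ 1 = 1ℤ
T⁺ 2 = 1ℤ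
T⁺ (suc (suc (suc n))) = T⁺ (suc (suc n)) ℤ.+ T⁺ (suc n) ℤ.+ T⁺ n

-- T⁻ n = T (- n), obtained by running the recurrence backwards:
-- T (- 1) = T 2 - T 1 - T 0 and T (- 2) = T 1 - T 0 - T (- 1).
T⁻ : ℕ → ℤ
T⁻ 0 = 0ℤ
T⁻ 1 = 0ℤ
T⁻ 2 = 1ℤ
T⁻ (suc (suc (suc n))) = T⁻ n ℤ.- T⁻ (suc n) ℤ.- T⁻ (suc (suc n))

T : ℤ → ℤ
T (+ n)      = T⁺ n
T (-[1+ n ]) = T⁻ (suc n)

T-recurrence : ∀ n → T (n ℤ.+ + 3) ≡ T (n ℤ.+ + 2) ℤ.+ T (n ℤ.+ + 1) ℤ.+ T n
T-recurrence (+ n)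
  rewrite ℕ.+-comm n 3 | ℕ.+-comm n 2 | ℕ.+-comm n 1 = refl
T-recurrence -[1+ 0 ] = refl
T-recurrence -[1+ 1 ] = refl
T-recurrence -[1+ 2 ] = refl
T-recurrence -[1+ suc (suc (suc n)) ] = lemma (T⁻ (suc n)) (T⁻ (suc (suc n))) _
  where
  lemma : ∀ x y z → x ≡ y ℤ.+ z ℤ.+ (x ℤ.- y ℤ.- z)
  lemma = solve-∀

------------------------------------------------------------------------
-- Congruences

infix 4 _≡ℤ_[mod_] _≡ℚ_[mod_]

record _≡ℤ_[mod_] (x y : ℤ) (M : ℕ) : Set where
  constructor modulo
  field
    divides-difference : (+ M) ℤ.∣ (x ℤ.- y)

fromℤ : ℤ → ℚ
fromℤ n = n ℚ./ 1

_≡ℚ_[mod_] : ℚ → ℚ → ℕ → Set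
x ≡ℚ y [mod M ] =
  Σ ℤ λ m → ℤ.Coprime m (+ M) × Σ ℤ λ u → Σ ℤ λ v →
    fromℤ m ℚ.* x ≡ fromℤ u × fromℤ m ℚ.* y ≡ fromℤ v × u ≡ℤ v [mod M ]

------------------------------------------------------------------------
-- The p-adic valuation on ℚ

ℤ∞ : Set
ℤ∞ = ℤ ⁺

open Supremum ℤ._≤_ public using () renaming (_≤⁺_ to _≤∞_)

-- The largest k ≤ bound with p ^ k ∣ n.
largestExponent : (p n bound : ℕ) → ℕ
largestExponent p n zero    = zero
largestExponent p n (suc k) with (p ℕ.^ suc k) ℕ.∣? n
... | yes _ = suc k
... | no  _ = largestExponent p n k

-- For p ≥ 2 and n > 0, p ^ k ∣ n forces k < p ^ k ≤ n, so the bound n is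
-- harmless.
νℕ : ℕ → ℕ → ℕ
νℕ p n = largestExponent p n n

ν : ℕ → ℚ → ℤ∞
ν p x with ↥ x ℤ.≟ 0ℤ
... | yes _ = ⊤⁺
... | no  _ = [ + νℕ p ℤ.∣ ↥ x ∣ ℤ.- + νℕ p (↧ₙ x) ]

-- κ + μ v, with κ + μ ∞ = ∞ (used for μ > 0 only).
affine : ℤ → ℕ → ℤ∞ → ℤ∞
affine κ μ = Maybe.map (λ v → κ ℤ.+ + μ ℤ.* v)

------------------------------------------------------------------------
-- The property MLR

ForAlmostAll : Pred ℤ a → Pred ℤ b → Set (a ⊔ b)
ForAlmostAll A P = Σ (List ℤ) λ exceptions → ∀ n → A n → n ∉ exceptions → P n

ConstantOn : (p Q i : ℕ) → Set
ConstantOn p Q i = Σ ℕ λ κ → ForAlmostAll (λ n → n ≡ℤ + i [mod Q ])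
  (λ n → ν p (fromℤ (T n)) ≡ [ + κ ])

LinearOn : (p Q i : ℕ) → Set
LinearOn p Q i = Σ ℚ λ r → Σ ℤ λ κ → Σ ℕ λ μ → 0 ℕ.< μ ×
  ν p (fromℤ (+ Q)) ≤∞ ν p (r ℚ.- fromℤ (+ i)) ×
  ForAlmostAll (λ n → n ≡ℤ + i [mod Q ])
    (λ n → ν p (fromℤ (T n)) ≡ affine κ μ (ν p (fromℤ n ℚ.- r)))

MLR : ℕ → Set
MLR p = Σ ℕ λ Q → 0 ℕ.< Q × (∀ i → i ℕ.< Q → ConstantOn p Q i ⊎ LinearOn p Q i)

------------------------------------------------------------------------
-- Univariate polynomials, as lists of coefficients, constant term first

module Polynomial (R : CommutativeRing c ℓ) where
  open CommutativeRing R

  Poly : Set c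
  Poly = List Carrier

  coeff : Poly → ℕ → Carrier
  coeff []      _       = 0#
  coeff (x ∷ _) zero    = x
  coeff (_ ∷ f) (suc n) = coeff f n

  infix 4 _≈ₚ_
  _≈ₚ_ : Poly → Poly → Set ℓ
  f ≈ₚ g = ∀ n → coeff f n ≈ coeff g n

  infixl 6 _+ₚ_
  _+ₚ_ : Poly → Poly → Poly
  []      +ₚ g       = g
  (x ∷ f) +ₚ []      = x ∷ f
  (x ∷ f) +ₚ (y ∷ g) = x + y ∷ (f +ₚ g)

  infixl 7 _*ₚ_
  _*ₚ_ : Poly → Poly → Poly
  []      *ₚ g = []
  (x ∷ f) *ₚ g = map (x *_) g +ₚ (0# ∷ (f *ₚ g))

  1ₚ : Poly
  1ₚ = 1# ∷ []

  X-_ : Carrier → Poly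
  X- r = - r ∷ 1# ∷ []

  eval : Poly → Carrier → Carrier
  eval f x = foldr (λ y z → y + x * z) 0# f

  IsRoot : Poly → Pred Carrier ℓ
  IsRoot f x = eval f x ≈ 0#

  -- For monic f: all roots of f, counted with multiplicity, lie in R.
  SplitsMonic : Poly → Set (c ⊔ ℓ)
  SplitsMonic f = Σ (List Carrier) λ rs →
    f ≈ₚ foldr (λ r g → (X- r) *ₚ g) 1ₚ rs

  -- X³ - X² - X - 1
  tribonacciPolynomial : Poly
  tribonacciPolynomial = - 1# ∷ - 1# ∷ - 1# ∷ 1# ∷ []

------------------------------------------------------------------------
-- The quotient ring R / sR

module _ (R : CommutativeRing c ℓ) (s : CommutativeRing.Carrier R) where
  open CommutativeRing R
    hiding (isEquivalence; isCommutativeRing) renaming (refl to ≈-refl)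
  open import Algebra.Solver.Ring.NaturalCoefficients.Default commutativeSemiring
    using (solve; _:+_; _:*_; _:=_)
  open import Algebra.Properties.Ring ring using (-‿distribʳ-*; -‿+-comm)
  open import Relation.Binary.Reasoning.Setoid setoid

  infix 4 _≈/s_
  record _≈/s_ (x y : Carrier) : Set (c ⊔ ℓ) where
    constructor quot-eq
    field
      {quotient} : Carrier
      equation   : x ≈ y + s * quotient

  private
    ≈⇒≈/s : ∀ {x y} → x ≈ y → x ≈/s y
    ≈⇒≈/s {x} {y} x≈y = quot-eq {quotient = 0#} (begin
      x           ≈⟨ x≈y ⟩
      y           ≈⟨ +-identityʳ y ⟨
      y + 0#      ≈⟨ +-congˡ (zeroʳ s) ⟨
      y + s * 0#  ∎)

    ≈/s-isEquivalence : IsEquivalence _≈/s_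
    ≈/s-isEquivalence = record
      { refl  = ≈⇒≈/s ≈-refl
      ; sym   = λ { {x} {y} (quot-eq {z} eq) → quot-eq {quotient = - z} (begin
          y                      ≈⟨ +-identityʳ y ⟨
          y + 0#                 ≈⟨ +-congˡ (-‿inverseʳ (s * z)) ⟨
          y + (s * z - s * z)    ≈⟨ +-assoc y (s * z) (- (s * z)) ⟨
          y + s * z - s * z      ≈⟨ +-cong (sym eq) (-‿distribʳ-* s z) ⟩
          x + s * - z            ∎) }
      ; trans = λ { {x} {y} {z} (quot-eq {u} eq₁) (quot-eq {v} eq₂) →
          quot-eq {quotient = v + u} (begin
          x                      ≈⟨ eq₁ ⟩
          y + s * u              ≈⟨ +-congʳ eq₂ ⟩
          z + s * v + s * u      ≈⟨ +-assoc z (s * v) (s * u) ⟩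
          z + (s * v + s * u)    ≈⟨ +-congˡ (distribˡ s v u) ⟨
          z + s * (v + u)        ∎) }
      }

    ≈/s-+-cong : ∀ {x y z w} → x ≈/s y → z ≈/s w → x + z ≈/s y + w
    ≈/s-+-cong {x} {y} {z} {w} (quot-eq {u} eq₁) (quot-eq {v} eq₂) =
      quot-eq {quotient = u + v} (begin
      x + z                      ≈⟨ +-cong eq₁ eq₂ ⟩
      (y + s * u) + (w + s * v)
        ≈⟨ solve 5 (λ y s u w v →
             ((y :+ (s :* u)) :+ (w :+ (s :* v))) := ((y :+ w) :+ (s :* (u :+ v))))
             ≈-refl y s u w v ⟩
      (y + w) + s * (u + v)      ∎)

    ≈/s-*-cong : ∀ {x y z w} → x ≈/s y → z ≈/s w → x * z ≈/s y * w
    ≈/s-*-cong {x} {y} {z} {w} (quot-eq {u} eq₁) (quot-eq {v} eq₂) =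
      quot-eq {quotient = u * w + (y * v + s * u * v)} (begin
      x * z                      ≈⟨ *-cong eq₁ eq₂ ⟩
      (y + s * u) * (w + s * v)
        ≈⟨ solve 5 (λ y s u w v →
             ((y :+ (s :* u)) :* (w :+ (s :* v)))
             := ((y :* w) :+ (s :* ((u :* w) :+ ((y :* v) :+ ((s :* u) :* v))))))
             ≈-refl y s u w v ⟩
      y * w + s * (u * w + (y * v + s * u * v)) ∎)

    ≈/s-neg-cong : ∀ {x y} → x ≈/s y → - x ≈/s - y
    ≈/s-neg-cong {x} {y} (quot-eq {u} eq) = quot-eq {quotient = - u} (begin
      - x                ≈⟨ -‿cong eq ⟩
      - (y + s * u)      ≈⟨ -‿+-comm y (s * u) ⟨
      - y - s * u        ≈⟨ +-congˡ (-‿distribʳ-* s u) ⟩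
      - y + s * - u      ∎)

  Quotient : CommutativeRing c (c ⊔ ℓ)
  Quotient = record
    { Carrier = Carrier
    ; _≈_     = _≈/s_
    ; _+_     = _+_
    ; _*_     = _*_
    ; -_      = -_
    ; 0#      = 0#
    ; 1#      = 1#
    ; isCommutativeRing = record
      { isRing = record
        { +-isAbelianGroup = record
          { isGroup = record
            { isMonoid = record
              { isSemigroup = record
                { isMagma = record
                  { isEquivalence = ≈/s-isEquivalence
                  ; ∙-cong = ≈/s-+-cong
                  }
                ; assoc = λ x y z → ≈⇒≈/s (+-assoc x y z)
                }
              ; identity = (λ x → ≈⇒≈/s (+-identityˡ x)) , (λ x → ≈⇒≈/s (+-identityʳ x))
              }
            ; inverse = (λ x → ≈⇒≈/s (-‿inverseˡ x)) , (λ x → ≈⇒≈/s (-‿inverseʳ x))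
            ; ⁻¹-cong = ≈/s-neg-cong
            }
          ; comm = λ x y → ≈⇒≈/s (+-comm x y)
          }
        ; *-cong = ≈/s-*-cong
        ; *-assoc = λ x y z → ≈⇒≈/s (*-assoc x y z)
        ; *-identity = (λ x → ≈⇒≈/s (*-identityˡ x)) , (λ x → ≈⇒≈/s (*-identityʳ x))
        ; distrib = (λ x y z → ≈⇒≈/s (distribˡ x y z)) , (λ x y z → ≈⇒≈/s (distribʳ x y z))
        }
      ; *-comm = λ x y → ≈⇒≈/s (*-comm x y)
      }
    }

------------------------------------------------------------------------
-- The localization R[1/s]

module _ (R : CommutativeRing c ℓ) (s : CommutativeRing.Carrier R) where
  open CommutativeRing R
    hiding (isEquivalence; isCommutativeRing) renaming (refl to ≈-refl)
  open import Algebra.Properties.Semiring.Exp semiring using (_^_; ^-homo-*)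
  open import Algebra.Solver.Ring.NaturalCoefficients.Default commutativeSemiring
    using (solve; _:+_; _:*_; _:=_)
  open import Algebra.Properties.Ring ring using (-‿distribˡ-*; -‿distribʳ-*)
  open import Relation.Binary.Reasoning.Setoid setoid

  infix 8 _/s^_
  record Fraction : Set c where
    constructor _/s^_
    field
      num : Carrier
      exp : ℕ

  open Fraction

  infix 4 _≈ᶠ_
  record _≈ᶠ_ (x y : Fraction) : Set ℓ where
    constructor frac-eq
    field
      factor   : ℕ
      equation : s ^ factor * (num x * s ^ exp y) ≈ s ^ factor * (num y * s ^ exp x)

  private
    by-≈ : ∀ {x y k l} → x ≈ y → k ≡ l → (x /s^ k) ≈ᶠ (y /s^ l)
    by-≈ x≈y refl = frac-eq 0 (*-congˡ (*-congʳ x≈y))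

    h : ∀ k l → s ^ (k ℕ.+ l) ≈ s ^ k * s ^ l
    h = ^-homo-* s

    ≈ᶠ-isEquivalence : IsEquivalence _≈ᶠ_
    ≈ᶠ-isEquivalence = record
      { refl  = by-≈ ≈-refl refl
      ; sym   = λ { (frac-eq m eq) → frac-eq m (sym eq) }
      ; trans = λ { {x /s^ i} {y /s^ j} {z /s^ k} (frac-eq m eq₁) (frac-eq n eq₂) →
          frac-eq (m ℕ.+ n ℕ.+ j) (begin
          s ^ (m ℕ.+ n ℕ.+ j) * (x * s ^ k)
            ≈⟨ *-congʳ (trans (h (m ℕ.+ n) j) (*-congʳ (h m n))) ⟩
          s ^ m * s ^ n * s ^ j * (x * s ^ k)
            ≈⟨ solve 5 (λ m n j x k →
                 (((m :* n) :* j) :* (x :* k)) := ((n :* k) :* (m :* (x :* j))))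
                 ≈-refl (s ^ m) (s ^ n) (s ^ j) x (s ^ k) ⟩
          s ^ n * s ^ k * (s ^ m * (x * s ^ j))
            ≈⟨ *-congˡ eq₁ ⟩
          s ^ n * s ^ k * (s ^ m * (y * s ^ i))
            ≈⟨ solve 5 (λ m n k y i →
                 ((n :* k) :* (m :* (y :* i))) := ((m :* i) :* (n :* (y :* k))))
                 ≈-refl (s ^ m) (s ^ n) (s ^ k) y (s ^ i) ⟩
          s ^ m * s ^ i * (s ^ n * (y * s ^ k))
            ≈⟨ *-congˡ eq₂ ⟩
          s ^ m * s ^ i * (s ^ n * (z * s ^ j))
            ≈⟨ solve 5 (λ m n j z i →
                 ((m :* i) :* (n :* (z :* j))) := (((m :* n) :* j) :* (z :* i)))
                 ≈-refl (s ^ m) (s ^ n) (s ^ j) z (s ^ i) ⟩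
          s ^ m * s ^ n * s ^ j * (z * s ^ i)
            ≈⟨ *-congʳ (trans (h (m ℕ.+ n) j) (*-congʳ (h m n))) ⟨
          s ^ (m ℕ.+ n ℕ.+ j) * (z * s ^ i) ∎) }
      }

    infixl 6 _+ᶠ_
    infixl 7 _*ᶠ_

    _+ᶠ_ _*ᶠ_ : Fraction → Fraction → Fraction
    (x /s^ k) +ᶠ (y /s^ l) = (x * s ^ l + y * s ^ k) /s^ (k ℕ.+ l)
    (x /s^ k) *ᶠ (y /s^ l) = (x * y) /s^ (k ℕ.+ l)

    -ᶠ_ : Fraction → Fraction
    -ᶠ (x /s^ k) = (- x) /s^ k

    +ᶠ-comm : ∀ x y → (x +ᶠ y) ≈ᶠ (y +ᶠ x)
    +ᶠ-comm (x /s^ k) (y /s^ l) = by-≈ (+-comm _ _) (ℕ.+-comm k l)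

    *ᶠ-comm : ∀ x y → (x *ᶠ y) ≈ᶠ (y *ᶠ x)
    *ᶠ-comm (x /s^ k) (y /s^ l) = by-≈ (*-comm _ _) (ℕ.+-comm k l)

    +ᶠ-congʳ : ∀ {x y} z → x ≈ᶠ y → (x +ᶠ z) ≈ᶠ (y +ᶠ z)
    +ᶠ-congʳ {x /s^ i} {y /s^ j} (z /s^ k) (frac-eq m eq) = frac-eq m (begin
      s ^ m * ((x * s ^ k + z * s ^ i) * s ^ (j ℕ.+ k))
        ≈⟨ *-congˡ (*-congˡ (h j k)) ⟩
      s ^ m * ((x * s ^ k + z * s ^ i) * (s ^ j * s ^ k))
        ≈⟨ solve 6 (λ m x k z i j →
             (m :* (((x :* k) :+ (z :* i)) :* (j :* k)))
             := (((m :* (x :* j)) :* (k :* k)) :+ (m :* (z :* (i :* (j :* k))))))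
             ≈-refl (s ^ m) x (s ^ k) z (s ^ i) (s ^ j) ⟩
      s ^ m * (x * s ^ j) * (s ^ k * s ^ k) + s ^ m * (z * (s ^ i * (s ^ j * s ^ k)))
        ≈⟨ +-congʳ (*-congʳ eq) ⟩
      s ^ m * (y * s ^ i) * (s ^ k * s ^ k) + s ^ m * (z * (s ^ i * (s ^ j * s ^ k)))
        ≈⟨ solve 6 (λ m y k z i j →
             (((m :* (y :* i)) :* (k :* k)) :+ (m :* (z :* (i :* (j :* k)))))
             := (m :* (((y :* k) :+ (z :* j)) :* (i :* k))))
             ≈-refl (s ^ m) y (s ^ k) z (s ^ i) (s ^ j) ⟩
      s ^ m * ((y * s ^ k + z * s ^ j) * (s ^ i * s ^ k))
        ≈⟨ *-congˡ (*-congˡ (h i k)) ⟨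
      s ^ m * ((y * s ^ k + z * s ^ j) * s ^ (i ℕ.+ k)) ∎)

    *ᶠ-congʳ : ∀ {x y} z → x ≈ᶠ y → (x *ᶠ z) ≈ᶠ (y *ᶠ z)
    *ᶠ-congʳ {x /s^ i} {y /s^ j} (z /s^ k) (frac-eq m eq) = frac-eq m (begin
      s ^ m * ((x * z) * s ^ (j ℕ.+ k))      ≈⟨ *-congˡ (*-congˡ (h j k)) ⟩
      s ^ m * ((x * z) * (s ^ j * s ^ k))
        ≈⟨ solve 5 (λ m x z j k →
             (m :* ((x :* z) :* (j :* k))) := ((m :* (x :* j)) :* (z :* k)))
             ≈-refl (s ^ m) x z (s ^ j) (s ^ k) ⟩
      s ^ m * (x * s ^ j) * (z * s ^ k)      ≈⟨ *-congʳ eq ⟩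
      s ^ m * (y * s ^ i) * (z * s ^ k)
        ≈⟨ solve 5 (λ m x z j k →
             ((m :* (x :* j)) :* (z :* k)) := (m :* ((x :* z) :* (j :* k))))
             ≈-refl (s ^ m) y z (s ^ i) (s ^ k) ⟩
      s ^ m * ((y * z) * (s ^ i * s ^ k))    ≈⟨ *-congˡ (*-congˡ (h i k)) ⟨
      s ^ m * ((y * z) * s ^ (i ℕ.+ k))      ∎)

    -ᶠ-cong : ∀ {x y} → x ≈ᶠ y → (-ᶠ x) ≈ᶠ (-ᶠ y)
    -ᶠ-cong {x /s^ i} {y /s^ j} (frac-eq m eq) = frac-eq m (begin
      s ^ m * (- x * s ^ j)
        ≈⟨ trans (-‿distribʳ-* _ _) (*-congˡ (-‿distribˡ-* x _)) ⟨
      - (s ^ m * (x * s ^ j))  ≈⟨ -‿cong eq ⟩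
      - (s ^ m * (y * s ^ i))
        ≈⟨ trans (-‿distribʳ-* _ _) (*-congˡ (-‿distribˡ-* y _)) ⟩
      s ^ m * (- y * s ^ i)    ∎)

    +ᶠ-assoc : ∀ x y z → (x +ᶠ y +ᶠ z) ≈ᶠ (x +ᶠ (y +ᶠ z))
    +ᶠ-assoc (x /s^ i) (y /s^ j) (z /s^ k) = by-≈ (begin
      (x * s ^ j + y * s ^ i) * s ^ k + z * s ^ (i ℕ.+ j)
        ≈⟨ +-congˡ (*-congˡ (h i j)) ⟩
      (x * s ^ j + y * s ^ i) * s ^ k + z * (s ^ i * s ^ j)
        ≈⟨ solve 6 (λ x y z i j k →
             ((((x :* j) :+ (y :* i)) :* k) :+ (z :* (i :* j)))
             := ((x :* (j :* k)) :+ (((y :* k) :+ (z :* j)) :* i)))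
             ≈-refl x y z (s ^ i) (s ^ j) (s ^ k) ⟩
      x * (s ^ j * s ^ k) + (y * s ^ k + z * s ^ j) * s ^ i
        ≈⟨ +-congʳ (*-congˡ (h j k)) ⟨
      x * s ^ (j ℕ.+ k) + (y * s ^ k + z * s ^ j) * s ^ i ∎) (ℕ.+-assoc i j k)

    +ᶠ-identityʳ : ∀ x → (x +ᶠ (0# /s^ 0)) ≈ᶠ x
    +ᶠ-identityʳ (x /s^ k) = by-≈ (begin
      x * 1# + 0# * s ^ k  ≈⟨ +-cong (*-identityʳ x) (zeroˡ _) ⟩
      x + 0#               ≈⟨ +-identityʳ x ⟩
      x                    ∎) (ℕ.+-identityʳ k)

    -ᶠ-inverseʳ : ∀ x → (x +ᶠ (-ᶠ x)) ≈ᶠ (0# /s^ 0)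
    -ᶠ-inverseʳ (x /s^ k) = frac-eq 0 (*-congˡ (begin
      (x * s ^ k + - x * s ^ k) * 1#  ≈⟨ *-identityʳ _ ⟩
      x * s ^ k + - x * s ^ k         ≈⟨ distribʳ (s ^ k) x (- x) ⟨
      (x + - x) * s ^ k               ≈⟨ *-congʳ (-‿inverseʳ x) ⟩
      0# * s ^ k                      ≈⟨ zeroˡ _ ⟩
      0#                              ≈⟨ zeroˡ _ ⟨
      0# * s ^ (k ℕ.+ k)              ∎))

    *ᶠ-identityʳ : ∀ x → (x *ᶠ (1# /s^ 0)) ≈ᶠ x
    *ᶠ-identityʳ (x /s^ k) = by-≈ (*-identityʳ x) (ℕ.+-identityʳ k)

    distribʳᶠ : ∀ x y z → ((y +ᶠ z) *ᶠ x) ≈ᶠ ((y *ᶠ x) +ᶠ (z *ᶠ x))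
    distribʳᶠ (x /s^ i) (y /s^ j) (z /s^ k) = frac-eq 0 (*-congˡ (begin
      (y * s ^ k + z * s ^ j) * x * s ^ (j ℕ.+ i ℕ.+ (k ℕ.+ i))
        ≈⟨ *-congˡ (trans (h (j ℕ.+ i) (k ℕ.+ i)) (*-cong (h j i) (h k i))) ⟩
      (y * s ^ k + z * s ^ j) * x * (s ^ j * s ^ i * (s ^ k * s ^ i))
        ≈⟨ solve 6 (λ x y z i j k →
             ((((y :* k) :+ (z :* j)) :* x) :* ((j :* i) :* (k :* i)))
             := ((((y :* x) :* (k :* i)) :+ ((z :* x) :* (j :* i))) :* ((j :* k) :* i)))
             ≈-refl x y z (s ^ i) (s ^ j) (s ^ k) ⟩
      (y * x * (s ^ k * s ^ i) + z * x * (s ^ j * s ^ i)) * (s ^ j * s ^ k * s ^ i)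
        ≈⟨ *-cong (+-cong (*-congˡ (h k i)) (*-congˡ (h j i)))
                  (trans (h (j ℕ.+ k) i) (*-congʳ (h j k))) ⟨
      (y * x * s ^ (k ℕ.+ i) + z * x * s ^ (j ℕ.+ i)) * s ^ (j ℕ.+ k ℕ.+ i) ∎))

  open IsEquivalence ≈ᶠ-isEquivalence using () renaming (trans to ≈ᶠ-trans)

  Localization : CommutativeRing c ℓ
  Localization = record
    { Carrier = Fraction
    ; _≈_     = _≈ᶠ_
    ; _+_     = _+ᶠ_
    ; _*_     = _*ᶠ_
    ; -_      = -ᶠ_
    ; 0#      = 0# /s^ 0
    ; 1#      = 1# /s^ 0
    ; isCommutativeRing = record
      { isRing = record
        { +-isAbelianGroup = record
          { isGroup = record
            { isMonoid = record
              { isSemigroup = record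
                { isMagma = record
                  { isEquivalence = ≈ᶠ-isEquivalence
                  ; ∙-cong = λ {x} {y} {u} {v} p q →
                      ≈ᶠ-trans (+ᶠ-congʳ u p) (≈ᶠ-trans (+ᶠ-comm y u)
                        (≈ᶠ-trans (+ᶠ-congʳ y q) (+ᶠ-comm v y)))
                  }
                ; assoc = +ᶠ-assoc
                }
              ; identity = (λ x → ≈ᶠ-trans (+ᶠ-comm _ x) (+ᶠ-identityʳ x)) , +ᶠ-identityʳ
              }
            ; inverse = (λ x → ≈ᶠ-trans (+ᶠ-comm _ x) (-ᶠ-inverseʳ x)) , -ᶠ-inverseʳ
            ; ⁻¹-cong = -ᶠ-cong
            }
          ; comm = +ᶠ-comm
          }
        ; *-cong = λ {x} {y} {u} {v} p q →
            ≈ᶠ-trans (*ᶠ-congʳ u p) (≈ᶠ-trans (*ᶠ-comm y u)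
              (≈ᶠ-trans (*ᶠ-congʳ y q) (*ᶠ-comm v y)))
        ; *-assoc = λ x y z → by-≈ (*-assoc _ _ _) (ℕ.+-assoc (exp x) _ _)
        ; *-identity = (λ x → ≈ᶠ-trans (*ᶠ-comm _ x) (*ᶠ-identityʳ x)) , *ᶠ-identityʳ
        ; distrib = (λ x y z → ≈ᶠ-trans (*ᶠ-comm x (y +ᶠ z)) (≈ᶠ-trans (distribʳᶠ x y z)
                      (≈ᶠ-trans (+ᶠ-congʳ (z *ᶠ x) (*ᶠ-comm y x))
                      (≈ᶠ-trans (+ᶠ-comm (x *ᶠ y) (z *ᶠ x))
                      (≈ᶠ-trans (+ᶠ-congʳ (x *ᶠ y) (*ᶠ-comm z x))
                               (+ᶠ-comm (x *ᶠ z) (x *ᶠ y)))))))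
                  , distribʳᶠ
        }
      ; *-comm = *ᶠ-comm
      }
    }

------------------------------------------------------------------------
-- The unit group of a commutative ring

module _ (R : CommutativeRing c ℓ) where
  open CommutativeRing R renaming (refl to ≈-refl)
  open import Algebra.Solver.Ring.NaturalCoefficients.Default commutativeSemiring
    using (solve; _:+_; _:*_; _:=_)
  open import Relation.Binary.Reasoning.Setoid setoid

  record Unit : Set (c ⊔ ℓ) where
    field
      value     : Carrier
      inverse   : Carrier
      value*inv : value * inverse ≈ 1#

  open Unit

  unitGroup : Group (c ⊔ ℓ) ℓ
  unitGroup = record
    { Carrier = Unit
    ; _≈_     = λ u v → value u ≈ value v
    ; _∙_     = λ u v → record
      { value     = value u * value v
      ; inverse   = inverse u * inverse v
      ; value*inv = begin
          value u * value v * (inverse u * inverse v)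
            ≈⟨ solve 4 (λ a b c d → ((a :* b) :* (c :* d)) := ((a :* c) :* (b :* d))) ≈-refl
                 (value u) (value v) (inverse u) (inverse v) ⟩
          value u * inverse u * (value v * inverse v)
            ≈⟨ *-cong (value*inv u) (value*inv v) ⟩
          1# * 1#
            ≈⟨ *-identityˡ 1# ⟩
          1# ∎
      }
    ; ε       = record { value = 1# ; inverse = 1# ; value*inv = *-identityˡ 1# }
    ; _⁻¹     = λ u → record
      { value     = inverse u
      ; inverse   = value u
      ; value*inv = trans (*-comm _ _) (value*inv u)
      }
    ; isGroup = record
      { isMonoid = record
        { isSemigroup = record
          { isMagma = record
            { isEquivalence = record { refl = ≈-refl ; sym = sym ; trans = trans }
            ; ∙-cong        = *-cong
            }
          ; assoc = λ u v w → *-assoc (value u) (value v) (value w)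
          }
        ; identity = (λ u → *-identityˡ (value u)) , (λ u → *-identityʳ (value u))
        }
      ; inverse = (λ u → trans (*-comm _ _) (value*inv u)) , value*inv
      ; ⁻¹-cong = λ {u} {v} u≈v → begin
          inverse u                            ≈⟨ *-identityʳ _ ⟨
          inverse u * 1#                       ≈⟨ *-congˡ (value*inv v) ⟨
          inverse u * (value v * inverse v)    ≈⟨ *-congˡ (*-congʳ u≈v) ⟨
          inverse u * (value u * inverse v)    ≈⟨ *-assoc _ _ _ ⟨
          inverse u * value u * inverse v      ≈⟨ *-congʳ (trans (*-comm _ _) (value*inv u)) ⟩
          1# * inverse v                       ≈⟨ *-identityˡ _ ⟩
          inverse v                            ∎
      }
    }

------------------------------------------------------------------------
-- Generated subgroups and their orders

module _ (G : Group c ℓ) where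
  open Group G

  data Generated (S : Pred Carrier a) : Pred Carrier (c ⊔ ℓ ⊔ a) where
    generator : ∀ {x} → S x → Generated S x
    resp      : ∀ {x y} → x ≈ y → Generated S x → Generated S y
    unit      : Generated S ε
    product   : ∀ {x y} → Generated S x → Generated S y → Generated S (x ∙ y)
    inverted  : ∀ {x} → Generated S x → Generated S (x ⁻¹)

  generatedSubgroup : Pred Carrier a → Setoid (c ⊔ ℓ ⊔ a) ℓ
  generatedSubgroup S = record
    { Carrier       = ∃ (Generated S)
    ; _≈_           = λ x y → proj₁ x ≈ proj₁ y
    ; isEquivalence = record
      { refl = Group.refl G ; sym = sym ; trans = trans }
    }

HasOrder : Setoid a ℓ → ℕ → Set (a ⊔ ℓ)
HasOrder A n = Bijection (≡.setoid (Fin n)) A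

------------------------------------------------------------------------
-- p-adic numbers

-- ℤₚ is the inverse limit of the rings ℤ / pⁿ: a p-adic integer is given by
-- integer representatives of its residues modulo pⁿ.
record PadicInteger (p : ℕ) : Set where
  field
    residue  : ℕ → ℤ
    coherent : ∀ n → residue (suc n) ≡ℤ residue n [mod p ℕ.^ n ]

open PadicInteger

infix 4 _≈ᵖ_
record _≈ᵖ_ {p : ℕ} (x y : PadicInteger p) : Set where
  constructor padic-eq
  field
    residues : ∀ n → residue x n ≡ℤ residue y n [mod p ℕ.^ n ]

open _≈ᵖ_

module _ (p : ℕ) where

  private
    cong-refl : ∀ {M x y} → x ≡ y → x ≡ℤ y [mod M ]
    cong-refl {M} {x} refl =
      modulo (≡.subst (+ M ℤ.∣_) (≡.sym (ℤ.+-inverseʳ x)) (divides 0ℤ refl))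

    cong-sym : ∀ {M x y} → x ≡ℤ y [mod M ] → y ≡ℤ x [mod M ]
    cong-sym {M} {x} {y} (modulo d) =
      modulo (≡.subst (+ M ℤ.∣_) (lemma x y) (ℤ.∣m⇒∣-m d))
      where
      lemma : ∀ x y → ℤ.- (x ℤ.- y) ≡ y ℤ.- x
      lemma = solve-∀

    cong-trans : ∀ {M x y z} → x ≡ℤ y [mod M ] → y ≡ℤ z [mod M ] → x ≡ℤ z [mod M ]
    cong-trans {M} {x} {y} {z} (modulo d) (modulo e) =
      modulo (≡.subst (+ M ℤ.∣_) (lemma x y z) (ℤ.∣m∣n⇒∣m+n d e))
      where
      lemma : ∀ x y z → (x ℤ.- y) ℤ.+ (y ℤ.- z) ≡ x ℤ.- z
      lemma = solve-∀

    cong-+ : ∀ {M x y u v} → x ≡ℤ y [mod M ] → u ≡ℤ v [mod M ] →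
             x ℤ.+ u ≡ℤ y ℤ.+ v [mod M ]
    cong-+ {M} {x} {y} {u} {v} (modulo d) (modulo e) =
      modulo (≡.subst (+ M ℤ.∣_) (lemma x y u v) (ℤ.∣m∣n⇒∣m+n d e))
      where
      lemma : ∀ x y u v → (x ℤ.- y) ℤ.+ (u ℤ.- v) ≡ (x ℤ.+ u) ℤ.- (y ℤ.+ v)
      lemma = solve-∀

    cong-* : ∀ {M x y u v} → x ≡ℤ y [mod M ] → u ≡ℤ v [mod M ] →
             x ℤ.* u ≡ℤ y ℤ.* v [mod M ]
    cong-* {M} {x} {y} {u} {v} (modulo d) (modulo e) =
      modulo (≡.subst (+ M ℤ.∣_) (lemma x y u v)
        (ℤ.∣m∣n⇒∣m+n (ℤ.∣m⇒∣m*n u d) (ℤ.∣n⇒∣m*n y e)))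
      where
      lemma : ∀ x y u v → (x ℤ.- y) ℤ.* u ℤ.+ y ℤ.* (u ℤ.- v) ≡ x ℤ.* u ℤ.- y ℤ.* v
      lemma = solve-∀

    cong-neg : ∀ {M x y} → x ≡ℤ y [mod M ] → ℤ.- x ≡ℤ ℤ.- y [mod M ]
    cong-neg {M} {x} {y} (modulo d) =
      modulo (≡.subst (+ M ℤ.∣_) (lemma x y) (ℤ.∣m⇒∣-m d))
      where
      lemma : ∀ x y → ℤ.- (x ℤ.- y) ≡ ℤ.- x ℤ.- ℤ.- y
      lemma = solve-∀

  constant : ℤ → PadicInteger p
  constant z .residue  _ = z
  constant z .coherent _ = cong-refl refl

  ℤₚ : CommutativeRing 0ℓ 0ℓ
  ℤₚ = record
    { Carrier = PadicInteger p
    ; _≈_     = _≈ᵖ_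
    ; _+_     = λ x y → record
      { residue  = λ n → residue x n ℤ.+ residue y n
      ; coherent = λ n → cong-+ (coherent x n) (coherent y n)
      }
    ; _*_     = λ x y → record
      { residue  = λ n → residue x n ℤ.* residue y n
      ; coherent = λ n → cong-* (coherent x n) (coherent y n)
      }
    ; -_      = λ x → record
      { residue  = λ n → ℤ.- residue x n
      ; coherent = λ n → cong-neg (coherent x n)
      }
    ; 0#      = constant 0ℤ
    ; 1#      = constant 1ℤ
    ; isCommutativeRing = record
      { isRing = record
        { +-isAbelianGroup = record
          { isGroup = record
            { isMonoid = record
              { isSemigroup = record
                { isMagma = record
                  { isEquivalence = record
                    { refl  = padic-eq λ _ → cong-refl refl
                    ; sym   = λ x≈y → padic-eq λ n → cong-sym (residues x≈y n)
                    ; trans = λ x≈y y≈z → padic-eq λ n → cong-trans (residues x≈y n) (residues y≈z n)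
                    }
                  ; ∙-cong = λ x≈y u≈v → padic-eq λ n →
                      cong-+ (residues x≈y n) (residues u≈v n)
                  }
                ; assoc = λ x y z → padic-eq λ n →
                    cong-refl (ℤ.+-assoc (residue x n) (residue y n) (residue z n))
                }
              ; identity = (λ x → padic-eq λ n → cong-refl (ℤ.+-identityˡ (residue x n)))
                         , (λ x → padic-eq λ n → cong-refl (ℤ.+-identityʳ (residue x n)))
              }
            ; inverse = (λ x → padic-eq λ n → cong-refl (ℤ.+-inverseˡ (residue x n)))
                      , (λ x → padic-eq λ n → cong-refl (ℤ.+-inverseʳ (residue x n)))
            ; ⁻¹-cong = λ x≈y → padic-eq λ n → cong-neg (residues x≈y n)
            }
          ; comm = λ x y → padic-eq λ n → cong-refl (ℤ.+-comm (residue x n) (residue y n))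
          }
        ; *-cong = λ x≈y u≈v → padic-eq λ n →
                      cong-* (residues x≈y n) (residues u≈v n)
        ; *-assoc = λ x y z → padic-eq λ n →
            cong-refl (ℤ.*-assoc (residue x n) (residue y n) (residue z n))
        ; *-identity = (λ x → padic-eq λ n → cong-refl (ℤ.*-identityˡ (residue x n)))
                     , (λ x → padic-eq λ n → cong-refl (ℤ.*-identityʳ (residue x n)))
        ; distrib =
              (λ x y z → padic-eq λ n → cong-refl
                (ℤ.*-distribˡ-+ (residue x n) (residue y n) (residue z n)))
            , (λ x y z → padic-eq λ n → cong-refl
                (ℤ.*-distribʳ-+ (residue x n) (residue y n) (residue z n)))
        }
      ; *-comm = λ x y → padic-eq λ n → cong-refl (ℤ.*-comm (residue x n) (residue y n))
      }
    }

  -- For p prime, inverting p in ℤₚ gives its field of fractions.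
  ℚₚ : CommutativeRing 0ℓ 0ℓ
  ℚₚ = Localization ℤₚ (constant (+ p))

  AllRootsInℚₚ : Set
  AllRootsInℚₚ = SplitsMonic tribonacciPolynomial
    where open Polynomial ℚₚ

  ℤₚ/p : CommutativeRing 0ℓ 0ℓ
  ℤₚ/p = Quotient ℤₚ (constant (+ p))

  -- The roots, being integral, lie in ℤₚ as soon as they lie in ℚₚ. As ℤₚ and
  -- ℤₚ/p share their carrier, x below also denotes its image in ℤₚ/p.
  IsRootImage : Pred (Unit ℤₚ/p) 0ℓ
  IsRootImage u = ∃[ x ] IsRoot tribonacciPolynomial x × Unit.value u ≈ x
    where
    open Polynomial ℤₚ
    open CommutativeRing ℤₚ/p using (_≈_)

  -- N = N_p, provided that all roots of the Tribonacci polynomial lie in ℚₚ (so that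
  -- the ring of integers of its splitting field is ℤₚ).
  IsRootOrder : ℕ → Set
  IsRootOrder = HasOrder (generatedSubgroup (unitGroup ℤₚ/p) IsRootImage)

------------------------------------------------------------------------
-- The rationals 0, -1, -4, -17, 1/3, -5/3

specialRationals : List ℚ
specialRationals =
  fromℤ 0ℤ ∷ fromℤ -1ℤ ∷ fromℤ (ℤ.- + 4) ∷ fromℤ (ℤ.- + 17) ∷
  (+ 1 ℚ./ 3) ∷ (ℤ.- + 5 ℚ./ 3) ∷ []

{-# OPTIONS --safe #-}
module Submission where

-- Write y = α^N = 1 + p u for each root α of X³ - X² - X - 1. As p is odd,
-- y^m ≡ 1 + m (y - 1) mod p^(j+2) whenever p^j ∣ m, so by Binet's formula
--   T(n + N m) ≡ T(n) + m (T(n + N) - T(n))  mod p^(j+2).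
-- If T(ℓ + N) - T(ℓ) is divisible by p exactly once, a p-adic zero a of T on the class
-- of ℓ therefore gives ν(T(n)) = 1 + ν(n - a), and Q = N works.
-- At 0, -1, -4 and -17 the sequence T vanishes. A zero 1/3 or -5/3 is reached through
-- integers e with 3 e ≡ 1 or -5 mod N p^k: then x = α^e (or α^(e+2)), y and z, built from
-- the three roots, are cube roots of them mod p^k with product 1. Up to the unit Vandermonde
-- factors, T(e) is a Schur polynomial in x, y, z, and with s = e₁ e₂ the equations for
-- x³, y³, z³ become (s - 2) (s² - 7 s + 4) ≡ 0. As p ∣ T(e) forces s ≡ 2 mod p, the second
-- factor is ≡ -6, a unit; so s ≡ 2 mod p^k, which makes T(e) vanish mod p^k.

open import Defs
open import Algebra.Bundles using (CommutativeMonoid; CommutativeRing; Group)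
open import Algebra.Definitions using (Commutative)
import Algebra.Properties.CommutativeMonoid.Sum as Summation
import Algebra.Properties.Group as GroupProperties
import Algebra.Properties.Monoid.Mult as Mult
import Algebra.Properties.Ring as RingProperties
open import Data.Fin.Base as Fin using (Fin)
open import Data.Fin.Permutation using (Permutation; permutation)
import Data.Fin.Properties as Fin
open import Data.Integer.Base as ℤ using (ℤ; +_; -[1+_]; 0ℤ; 1ℤ; -1ℤ)
import Data.Integer.Coprimality as ℤ
import Data.Integer.DivMod as ℤ
open import Data.Integer.Divisibility.Signed as ℤ using (divides; ∣ᵤ⇒∣; ∣⇒∣ᵤ)
  renaming (_∣_ to _∣ℤ_)
import Data.Integer.Properties as ℤ
open import Data.Integer.Tactic.RingSolver using (solve-∀)
open import Data.List.Base using (List; []; _∷_; foldr; length; map)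
open import Data.List.Membership.Propositional using (_∈_)
open import Data.List.Relation.Unary.Any using (here; there)
open import Data.Nat.Base as ℕ using (ℕ; zero; suc; z≤n; s≤s; z<s; s<s; NonZero)
import Data.Nat.Coprimality as Coprimality
open import Data.Nat.DivMod using (_%_; _/_; m≡m%n+[m/n]*n; m%n<n)
import Data.Nat.Divisibility as ℕ
open import Data.Nat.Induction using (<-wellFounded; Acc; acc)
open import Data.Nat.Primality
  using (Prime; euclidsLemma; prime?; prime[2]; prime⇒irreducible; prime⇒nonTrivial; prime⇒nonZero)
import Data.Nat.Properties as ℕ
import Data.Nat.Tactic.RingSolver as ℕ-solver
open import Data.Product.Base using (Σ; ∃; ∃-syntax; _×_; _,_; proj₁; proj₂)
open import Data.Rational.Base as ℚ using (ℚ; mkℚ; ↥_; ↧_; ↧ₙ_)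
import Data.Rational.Properties as ℚ
import Data.Rational.Unnormalised.Base as ℚᵘ
import Data.Rational.Unnormalised.Properties as ℚᵘ
open import Data.Sum.Base as Sum using (_⊎_; inj₁; inj₂; [_,_]′)
open import Function.Base using (_∘_)
open import Function.Bundles using (Bijection; Inverse)
open import Function.Definitions using (Injective)
open import Function.Properties.Bijection using (Bijection⇒Inverse)
open import Level using (Level; _⊔_)
import Relation.Binary.Construct.Add.Supremum.NonStrict ℤ._≤_ as ≤∞
open import Relation.Binary.PropositionalEquality as ≡
  using (_≡_; _≢_; refl; sym; trans; cong; cong₂; subst)
open import Relation.Nullary.Construct.Add.Supremum using (⊤⁺; [_])
open import Relation.Nullary.Decidable using (Dec; yes; no; from-no; from-yes)
open import Relation.Nullary.Negation.Core using (¬_; contradiction)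
open import Relation.Unary using (Pred)

open PadicInteger
open _≈ᵖ_

-- Subgroup orders and roots in localizations

-- No p-adic interpolation of T is constructed. A zero a = b / D is replaced by integers e that
-- approach it p-adically inside the class of ℓ modulo N, and the precision p^(k+2), with k = ν(D n
-- - b), is chosen once n is known. So the argument consists of congruences between integers
-- representing the roots modulo powers of p. In them n - e is a multiple q N, and p ∤ N because the
-- subgroup embeds in the nonzero residues modulo p; hence q carries the valuation of n - a. At 1/3
-- and -5/3 the obstacle is that the equations for the cubes fix x, y, z only up to cube roots of
-- unity, and not every choice makes T vanish. The condition p ∣ T(ℓ) selects s ≡ 2 modulo p; since
-- this is a simple root of the cubic in s, as in Hensel's lemma it determines s modulo every p^k.
-- The condition 3 ∤ N allows inverting 3 modulo N p^k, and p = 3 cannot occur because the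
-- polynomial has no zero modulo 3.

module _ {g₁ g₂ g₃ : Level} (G : Group g₁ g₂) (comm : Commutative (Group._≈_ G) (Group._∙_ G))
  (S : Pred (Group.Carrier G) g₃) (N : ℕ) (order : HasOrder (generatedSubgroup G S) N) where

  open Group G hiding (inverseʳ; refl; sym; trans)
  open Inverse (Bijection⇒Inverse order) using (to; from; inverseʳ; strictlyInverseˡ)

  private
    commutativeMonoid : CommutativeMonoid g₁ g₂
    commutativeMonoid = record
      { isCommutativeMonoid = record { isMonoid = isMonoid ; comm = comm } }

  open Summation commutativeMonoid using (sum; sum-permute; sum-cong-≋; ∑-distrib-+; sum-replicate)
  open Mult monoid using () renaming (_×_ to _·_)

  -- Multiplication by x permutes the subgroup, so x^N fixes the product of its elements.
  order-annihilates : ∀ {x} → Generated G S x → N · x ≈ ε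
  order-annihilates {x} x∈ = GroupProperties.identityˡ-unique G (N · x) (sum element) (begin
    N · x ∙ sum element                 ≈⟨ ∙-congʳ (sum-replicate N) ⟨
    sum {N} (λ _ → x) ∙ sum element     ≈⟨ ∑-distrib-+ (λ _ → x) element ⟨
    sum (λ i → x ∙ element i)           ≈⟨ sum-cong-≋ (λ i → strictlyInverseˡ (translate x∈ i)) ⟨
    sum (λ i → element (shift x∈ i))    ≈⟨ sum-permute element translation ⟨
    sum element                         ∎)
    where
    open import Relation.Binary.Reasoning.Setoid setoid

    element : Fin N → Carrier
    element i = proj₁ (to i)

    translate : ∀ {y} → Generated G S y → Fin N → ∃ (Generated G S)
    translate {y} y∈ i = y ∙ element i , product y∈ (proj₂ (to i))

    shift : ∀ {y} → Generated G S y → Fin N → Fin N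
    shift y∈ i = from (translate y∈ i)

    shift-inverse : ∀ {y z} (y∈ : Generated G S y) (z∈ : Generated G S z) → y ∙ z ≈ ε →
                    ∀ i → shift y∈ (shift z∈ i) ≡ i
    shift-inverse {y} {z} y∈ z∈ yz≈ε i = inverseʳ (begin
      y ∙ element (shift z∈ i)    ≈⟨ ∙-congˡ (strictlyInverseˡ (translate z∈ i)) ⟩
      y ∙ (z ∙ element i)         ≈⟨ assoc y z (element i) ⟨
      y ∙ z ∙ element i           ≈⟨ ∙-congʳ yz≈ε ⟩
      ε ∙ element i               ≈⟨ identityˡ (element i) ⟩
      element i                   ∎)

    translation : Permutation N N
    translation = permutation (shift x∈) (shift (inverted x∈))
      (shift-inverse x∈ (inverted x∈) (Group.inverseʳ G x))
      (shift-inverse (inverted x∈) x∈ (Group.inverseˡ G x))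

module _ {r₁ r₂ : Level} (R : CommutativeRing r₁ r₂) where
  open CommutativeRing R using (Carrier; _*_; 1#)

  pow : ℕ → Carrier → Carrier
  pow zero    x = 1#
  pow (suc n) x = x * pow n x

module _ {r₁ r₂ r₃ : Level} (R : CommutativeRing r₁ r₂) (S : Pred (Unit R) r₃)
  (N : ℕ) (order : HasOrder (generatedSubgroup (unitGroup R) S) N) where
  open CommutativeRing R using (Carrier; _≈_; _*_; 1#; *-comm)
  open Mult (Group.monoid (unitGroup R)) using () renaming (_×_ to _·_)
  open Unit

  pow-order : ∀ u → Generated (unitGroup R) S u → pow R N (value u) ≈ 1#
  pow-order u u∈ = ≡.subst (_≈ 1#) (value-· N)
    (order-annihilates (unitGroup R) (λ u v → *-comm (value u) (value v)) S N order u∈)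
    where
    value-· : ∀ n → value (n · u) ≡ pow R n (value u)
    value-· zero    = ≡.refl
    value-· (suc n) = ≡.cong (value u *_) (value-· n)

-- Splitting and Vieta's relations

module _ {r₁ r₂ : Level} (R : CommutativeRing r₁ r₂) where
  open CommutativeRing R renaming (refl to ≈-refl; sym to ≈-sym; trans to ≈-trans)
  open Polynomial R
  open RingProperties ring using (-‿distribˡ-*; -‿distribʳ-*; -‿involutive; -‿injective; -‿+-comm; -0#≈0#)
  open import Relation.Binary.Reasoning.Setoid setoid
  open import Algebra.Solver.Ring.NaturalCoefficients.Default commutativeSemiring
    using (solve; _:+_; _:*_; _:=_; con)

  coeff-+ₚ : ∀ f g n → coeff (f +ₚ g) n ≈ coeff f n + coeff g n
  coeff-+ₚ []      g       n       = ≈-sym (+-identityˡ _)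
  coeff-+ₚ (x ∷ f) []      n       = ≈-sym (+-identityʳ _)
  coeff-+ₚ (x ∷ f) (y ∷ g) zero    = ≈-refl
  coeff-+ₚ (x ∷ f) (y ∷ g) (suc n) = coeff-+ₚ f g n

  coeff-map : ∀ x f n → coeff (map (x *_) f) n ≈ x * coeff f n
  coeff-map x []      n       = ≈-sym (zeroʳ x)
  coeff-map x (y ∷ f) zero    = ≈-refl
  coeff-map x (y ∷ f) (suc n) = coeff-map x f n

  coeff-0∷[] : ∀ n → coeff (0# ∷ []) n ≈ 0#
  coeff-0∷[] zero    = ≈-refl
  coeff-0∷[] (suc n) = ≈-refl

  coeff-X-zero : ∀ r f → coeff ((X- r) *ₚ f) 0 ≈ - (r * coeff f 0)
  coeff-X-zero r f = begin
    coeff ((X- r) *ₚ f) 0            ≈⟨ coeff-+ₚ (map (- r *_) f) _ 0 ⟩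
    coeff (map (- r *_) f) 0 + 0#    ≈⟨ +-identityʳ _ ⟩
    coeff (map (- r *_) f) 0         ≈⟨ coeff-map (- r) f 0 ⟩
    - r * coeff f 0                  ≈⟨ -‿distribˡ-* r (coeff f 0) ⟨
    - (r * coeff f 0)                ∎

  coeff-X-suc : ∀ r f n → coeff ((X- r) *ₚ f) (suc n) ≈ coeff f n - r * coeff f (suc n)
  coeff-X-suc r f n = begin
    coeff ((X- r) *ₚ f) (suc n)
      ≈⟨ coeff-+ₚ (map (- r *_) f) _ (suc n) ⟩
    coeff (map (- r *_) f) (suc n) + coeff (map (1# *_) f +ₚ (0# ∷ [])) n
      ≈⟨ +-cong (≈-trans (coeff-map (- r) f (suc n)) (≈-sym (-‿distribˡ-* r _)))
                (coeff-+ₚ (map (1# *_) f) (0# ∷ []) n) ⟩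
    - (r * coeff f (suc n)) + (coeff (map (1# *_) f) n + coeff (0# ∷ []) n)
      ≈⟨ +-congˡ (+-cong (≈-trans (coeff-map 1# f n) (*-identityˡ _)) (coeff-0∷[] n)) ⟩
    - (r * coeff f (suc n)) + (coeff f n + 0#)
      ≈⟨ +-congˡ (+-identityʳ _) ⟩
    - (r * coeff f (suc n)) + coeff f n
      ≈⟨ +-comm _ _ ⟩
    coeff f n - r * coeff f (suc n) ∎

  x-y*0≈x : ∀ x y {z} → z ≈ 0# → x - y * z ≈ x
  x-y*0≈x x y z≈0 = ≈-trans (+-congˡ (≈-trans (-‿cong (≈-trans (*-congˡ z≈0) (zeroʳ y))) -0#≈0#)) (+-identityʳ x)

  private
    ∏X- : List Carrier → Poly
    ∏X- = foldr (λ r g → (X- r) *ₚ g) 1ₚ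

  degree-∏X- : ∀ rs n → length rs ℕ.< n → coeff (∏X- rs) n ≈ 0#
  degree-∏X- []       (suc n) _ = ≈-refl
  degree-∏X- (r ∷ rs) (suc n) (s≤s lt) = begin
    coeff (∏X- (r ∷ rs)) (suc n)                     ≈⟨ coeff-X-suc r (∏X- rs) n ⟩
    coeff (∏X- rs) n - r * coeff (∏X- rs) (suc n)    ≈⟨ x-y*0≈x _ r (degree-∏X- rs (suc n) (ℕ.m<n⇒m<1+n lt)) ⟩
    coeff (∏X- rs) n                                 ≈⟨ degree-∏X- rs n lt ⟩
    0#                                               ∎

  monic-∏X- : ∀ rs → coeff (∏X- rs) (length rs) ≈ 1#
  monic-∏X- []       = ≈-refl
  monic-∏X- (r ∷ rs) = begin
    coeff (∏X- (r ∷ rs)) (suc (length rs))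
      ≈⟨ coeff-X-suc r (∏X- rs) (length rs) ⟩
    coeff (∏X- rs) (length rs) - r * coeff (∏X- rs) (suc (length rs))
      ≈⟨ x-y*0≈x _ r (degree-∏X- rs _ (ℕ.n<1+n _)) ⟩
    coeff (∏X- rs) (length rs)
      ≈⟨ monic-∏X- rs ⟩
    1# ∎

  -- Vieta's relations retain multiplicities, and the root equations follow from them. The second is
  -- written without subtraction because the solver works over semirings.
  record TribonacciRoots : Set (r₁ ⊔ r₂) where
    field
      α β γ : Carrier
      sum-1      : α + β + γ ≈ 1#
      pairs+1    : α * β + β * γ + γ * α + 1# ≈ 0#
      product-1  : α * β * γ ≈ 1#

  rotate-roots : TribonacciRoots → TribonacciRoots
  rotate-roots t = record
    { α = β ; β = γ ; γ = α
    ; sum-1     = ≈-trans (solve 3 (λ a b c → b :+ c :+ a := a :+ b :+ c) ≈-refl α β γ) sum-1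
    ; pairs+1   = ≈-trans (+-congʳ (solve 3 (λ a b c → b :* c :+ c :* a :+ a :* b :=
                    a :* b :+ b :* c :+ c :* a) ≈-refl α β γ)) pairs+1
    ; product-1 = ≈-trans (solve 3 (λ a b c → b :* c :* a := a :* b :* c) ≈-refl α β γ) product-1
    }
    where open TribonacciRoots t

  -- In terms of the elementary symmetric functions, α³ + α e₂ = α² e₁ + e₃. A semiring solver
  -- cannot subtract, so the vanishing term α (e₂ + 1) is added first.
  root-equation : (t : TribonacciRoots) → let open TribonacciRoots t in
                  α * α * α ≈ α * α + α + 1#
  root-equation t = begin
    α * α * α
      ≈⟨ +-identityʳ _ ⟨
    α * α * α + 0#
      ≈⟨ +-congˡ (zeroʳ α) ⟨
    α * α * α + α * 0#
      ≈⟨ +-congˡ (*-congˡ pairs+1) ⟨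
    α * α * α + α * (α * β + β * γ + γ * α + 1#)
      ≈⟨ solve 3 (λ a b c → a :* a :* a :+ a :* (a :* b :+ b :* c :+ c :* a :+ con 1) :=
           a :* a :* (a :+ b :+ c) :+ a :+ a :* b :* c) ≈-refl α β γ ⟩
    α * α * (α + β + γ) + α + α * β * γ
      ≈⟨ +-cong (+-congʳ (≈-trans (*-congˡ sum-1) (*-identityʳ _))) product-1 ⟩
    α * α + α + 1# ∎
    where open TribonacciRoots t

  -- Degrees force exactly three factors: a shorter product has coefficient 0 at X³, a longer one
  -- has leading coefficient 1 where the polynomial has 0.
  splits⇒roots : ¬ 1# ≈ 0# → SplitsMonic tribonacciPolynomial → TribonacciRoots
  splits⇒roots 1≉0 ([] , f≈) = contradiction (f≈ 3) 1≉0
  splits⇒roots 1≉0 (rs@(_ ∷ []) , f≈) =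
    contradiction (≈-trans (f≈ 3) (degree-∏X- rs 3 (s<s z<s))) 1≉0
  splits⇒roots 1≉0 (rs@(_ ∷ _ ∷ []) , f≈) =
    contradiction (≈-trans (f≈ 3) (degree-∏X- rs 3 (s<s (s<s z<s)))) 1≉0
  splits⇒roots 1≉0 (rs@(_ ∷ _ ∷ _ ∷ _ ∷ _) , f≈) =
    contradiction (≈-sym (≈-trans (f≈ (length rs)) (monic-∏X- rs))) 1≉0
  splits⇒roots 1≉0 (a ∷ b ∷ c ∷ [] , f≈) = record
    { α = a ; β = b ; γ = c
    ; sum-1 = -‿injective (begin
        - (a + b + c)                   ≈⟨ -‿+-comm (a + b) c ⟨
        - (a + b) - c                   ≈⟨ +-congʳ (-‿+-comm a b) ⟨
        - a - b - c                     ≈⟨ solve 3 (λ a b c → a :+ b :+ c := c :+ b :+ a) ≈-refl (- a) (- b) (- c) ⟩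
        - c - b - a                     ≈⟨ +-congˡ (-‿cong (≈-trans (*-congˡ (monic-∏X- (b ∷ c ∷ []))) (*-identityʳ a))) ⟨
        - c - b - a * coeff h 2         ≈⟨ +-congʳ h₁ ⟨
        coeff h 1 - a * coeff h 2       ≈⟨ coeff-X-suc a h 1 ⟨
        coeff (∏X- (a ∷ b ∷ c ∷ [])) 2  ≈⟨ f≈ 2 ⟨
        - 1#                            ∎)
    ; pairs+1 = begin
        a * b + b * c + c * a + 1#
          ≈⟨ solve 3 (λ a b c → a :* b :+ b :* c :+ c :* a :+ con 1 :=
                (b :* c :+ a :* (c :+ b)) :+ con 1) ≈-refl a b c ⟩
        b * c + a * (c + b) + 1#
          ≈⟨ +-congʳ (+-congˡ (-‿involutive _)) ⟨
        b * c - - (a * (c + b)) + 1#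
          ≈⟨ +-congʳ (+-congˡ (-‿cong (≈-trans (-‿distribʳ-* a (c + b)) (*-congˡ (≈-sym (-‿+-comm c b)))))) ⟩
        b * c - a * (- c - b) + 1#
          ≈⟨ +-congʳ (+-cong h₀ (-‿cong (*-congˡ h₁))) ⟨
        coeff h 0 - a * coeff h 1 + 1#
          ≈⟨ +-congʳ (coeff-X-suc a h 0) ⟨
        coeff (∏X- (a ∷ b ∷ c ∷ [])) 1 + 1#
          ≈⟨ +-congʳ (f≈ 1) ⟨
        - 1# + 1#
          ≈⟨ -‿inverseˡ 1# ⟩
        0# ∎
    ; product-1 = -‿injective (begin
        - (a * b * c)                   ≈⟨ -‿cong (*-assoc a b c) ⟩
        - (a * (b * c))                 ≈⟨ -‿cong (*-congˡ h₀) ⟨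
        - (a * coeff h 0)               ≈⟨ coeff-X-zero a h ⟨
        coeff (∏X- (a ∷ b ∷ c ∷ [])) 0  ≈⟨ f≈ 0 ⟨
        - 1#                            ∎)
    }
    where
    h : Poly
    h = ∏X- (b ∷ c ∷ [])

    k₀ : coeff (∏X- (c ∷ [])) 0 ≈ - c
    k₀ = ≈-trans (coeff-X-zero c 1ₚ) (-‿cong (*-identityʳ c))

    h₀ : coeff h 0 ≈ b * c
    h₀ = begin
      coeff h 0                          ≈⟨ coeff-X-zero b (∏X- (c ∷ [])) ⟩
      - (b * coeff (∏X- (c ∷ [])) 0)     ≈⟨ -‿cong (*-congˡ k₀) ⟩
      - (b * - c)                        ≈⟨ -‿cong (-‿distribʳ-* b c) ⟨
      - - (b * c)                        ≈⟨ -‿involutive _ ⟩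
      b * c                              ∎

    h₁ : coeff h 1 ≈ - c - b
    h₁ = begin
      coeff h 1
        ≈⟨ coeff-X-suc b (∏X- (c ∷ [])) 0 ⟩
      coeff (∏X- (c ∷ [])) 0 - b * coeff (∏X- (c ∷ [])) 1
        ≈⟨ +-cong k₀ (-‿cong (≈-trans (*-congˡ (monic-∏X- (c ∷ []))) (*-identityʳ b))) ⟩
      - c - b ∎

  -- With a as numerator and s as denominator, this is the root equation multiplied by s³. The right
  -- side is arranged to exhibit a factor s, as in the rational root theorem.
  scale-cubic : ∀ x s a → x * x * x ≈ x * x + x + 1# → x * s ≈ a →
                a * a * a ≈ s * (a * a + s * (a + s))
  scale-cubic x s a cubic xs≈a = begin
    a * a * a                              ≈⟨ *-cong (*-cong xs≈a xs≈a) xs≈a ⟨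
    x * s * (x * s) * (x * s)              ≈⟨ solve 2 (λ x s → x :* s :* (x :* s) :* (x :* s) :=
                                                x :* x :* x :* (s :* s :* s)) ≈-refl x s ⟩
    x * x * x * (s * s * s)                ≈⟨ *-congʳ cubic ⟩
    (x * x + x + 1#) * (s * s * s)         ≈⟨ solve 2 (λ x s → (x :* x :+ x :+ con 1) :* (s :* s :* s) :=
                                                s :* (x :* s :* (x :* s) :+ s :* (x :* s :+ s))) ≈-refl x s ⟩
    s * (x * s * (x * s) + s * (x * s + s)) ≈⟨ *-congˡ (+-cong (*-cong xs≈a xs≈a) (*-congˡ (+-congʳ xs≈a))) ⟩
    s * (a * a + s * (a + s))              ∎

-- Integrality of the roots in a localization

module _ {r₁ r₂ : Level} (R : CommutativeRing r₁ r₂) (s : CommutativeRing.Carrier R) where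
  open CommutativeRing R renaming (refl to ≈-refl; sym to ≈-sym; trans to ≈-trans)
  open import Relation.Binary.Reasoning.Setoid setoid
  open import Algebra.Properties.Semiring.Exp semiring using (_^_)

  private
    module L = CommutativeRing (Localization R s)

  ι : Carrier → Fraction R s
  ι x = x /s^ 0

  ι-+ : ∀ x y → ι x L.+ ι y L.≈ ι (x + y)
  ι-+ x y = frac-eq 0 (*-congˡ (*-congʳ (+-cong (*-identityʳ x) (*-identityʳ y))))

  clear-fraction : ∀ a k → (a /s^ k) L.* ι (s ^ k) L.≈ ι a
  clear-fraction a k = frac-eq 0 (*-congˡ (begin
    a * s ^ k * 1#         ≈⟨ *-identityʳ _ ⟩
    a * s ^ k              ≡⟨ ≡.cong (λ i → a * s ^ i) (ℕ.+-identityʳ k) ⟨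
    a * s ^ (k ℕ.+ 0)      ∎))

  cancel-fraction : ∀ a b k → a ≈ s * b → (a /s^ suc k) L.≈ (b /s^ k)
  cancel-fraction a b k a≈sb = frac-eq 0 (*-congˡ (begin
    a * s ^ k              ≈⟨ *-congʳ a≈sb ⟩
    s * b * s ^ k          ≈⟨ *-congʳ (*-comm s b) ⟩
    b * s * s ^ k          ≈⟨ *-assoc b s (s ^ k) ⟩
    b * (s * s ^ k)        ∎))

  module _ (cancel-s : ∀ x y → s * x ≈ s * y → x ≈ y)
    (divide : ∀ x y → x * x * x ≈ s * y → ∃[ z ] x ≈ s * z) where

    ι-injective : ∀ {x y} → ι x L.≈ ι y → x ≈ y
    ι-injective {x} {y} (frac-eq k eq) =
      ≈-trans (≈-sym (*-identityʳ x)) (≈-trans (cancel-power k (x * 1#) (y * 1#) eq) (*-identityʳ y))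
      where
      cancel-power : ∀ k x y → s ^ k * x ≈ s ^ k * y → x ≈ y
      cancel-power zero    x y eq = ≈-trans (≈-sym (*-identityˡ x)) (≈-trans eq (*-identityˡ y))
      cancel-power (suc k) x y eq = cancel-power k x y (cancel-s _ _
        (≈-trans (≈-sym (*-assoc s (s ^ k) x)) (≈-trans eq (*-assoc s (s ^ k) y))))

    -- Descent on the exponent of the denominator: the cleared equation puts a factor s into a³,
    -- `divide` puts one into a, and it cancels from the fraction.
    integral-fraction : ∀ k a → let x = a /s^ k in
      x L.* x L.* x L.≈ x L.* x L.+ x L.+ L.1# → ∃[ y ] x L.≈ ι y
    integral-fraction zero    a _     = a , L.refl
    integral-fraction (suc k) a cubic =
      reduce (divide a (s ^ k * (a * a + s ^ suc k * (a + s ^ suc k))) (≈-trans a³≈ (*-assoc s (s ^ k) _)))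
      where
      t : Carrier
      t = s ^ suc k

      a³≈ : a * a * a ≈ t * (a * a + t * (a + t))
      a³≈ = ι-injective (L.trans
        (scale-cubic (Localization R s) (a /s^ suc k) (ι t) (ι a) cubic (clear-fraction a (suc k)))
        (L.*-congˡ {ι t} (L.trans (L.+-congˡ {ι (a * a)} (L.*-congˡ {ι t} (ι-+ a t))) (ι-+ (a * a) (t * (a + t))))))

      reduce : ∃[ b ] a ≈ s * b → ∃[ y ] (a /s^ suc k) L.≈ ι y
      reduce (b , a≈sb) = proj₁ rec , L.trans a≈b (proj₂ rec)
        where
        a≈b = cancel-fraction a b k a≈sb
        rec = integral-fraction k b (L.trans (L.sym (L.*-cong (L.*-cong a≈b a≈b) a≈b))
          (L.trans cubic (L.+-congʳ (L.+-cong (L.*-cong a≈b a≈b) a≈b))))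

    integral : ∀ x → x L.* x L.* x L.≈ x L.* x L.+ x L.+ L.1# → ∃[ y ] x L.≈ ι y
    integral (a /s^ k) = integral-fraction k a

    integral-roots : TribonacciRoots (Localization R s) → TribonacciRoots R
    integral-roots t = record
      { α = a ; β = b ; γ = c
      ; sum-1     = ι-injective (L.trans (L.sym (L.trans (L.+-cong (L.+-cong α≈ β≈) γ≈)
          (L.trans (L.+-congʳ (ι-+ a b)) (ι-+ (a + b) c)))) sum-1)
      ; pairs+1   = ι-injective (L.trans (L.sym (L.trans
          (L.+-congʳ (L.+-cong (L.+-cong (L.*-cong α≈ β≈) (L.*-cong β≈ γ≈)) (L.*-cong γ≈ α≈)))
          (L.trans (L.+-congʳ (L.trans (L.+-congʳ (ι-+ (a * b) (b * c))) (ι-+ (a * b + b * c) (c * a))))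
            (ι-+ (a * b + b * c + c * a) 1#)))) pairs+1)
      ; product-1 = ι-injective (L.trans (L.sym (L.*-cong (L.*-cong α≈ β≈) γ≈)) product-1)
      }
      where
      open TribonacciRoots t
      root-α = integral α (root-equation (Localization R s) t)
      root-β = integral β (root-equation (Localization R s) (rotate-roots (Localization R s) t))
      root-γ = integral γ (root-equation (Localization R s)
                 (rotate-roots (Localization R s) (rotate-roots (Localization R s) t)))
      a = proj₁ root-α
      b = proj₁ root-β
      c = proj₁ root-γ
      α≈ = proj₂ root-α
      β≈ = proj₂ root-β
      γ≈ = proj₂ root-γ

-- Valuations

x-y+y≡x : ∀ x y → x ℤ.- y ℤ.+ y ≡ x
x-y+y≡x = solve-∀

x-[x-y]≡y : ∀ x y → x ℤ.- (x ℤ.- y) ≡ y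
x-[x-y]≡y = solve-∀

pos-^ : ∀ m n → + (m ℕ.^ n) ≡ (+ m) ℤ.^ n
pos-^ m zero    = refl
pos-^ m (suc n) = trans (ℤ.pos-* m (m ℕ.^ n)) (cong (+ m ℤ.*_) (pos-^ m n))

^-monoʳ-∣ : ∀ x {m n} → m ℕ.≤ n → x ℤ.^ m ∣ℤ x ℤ.^ n
^-monoʳ-∣ x {m} {n} m≤n = subst (x ℤ.^ m ∣ℤ_)
  (trans (sym (ℤ.^-distribˡ-+-* x m (n ℕ.∸ m))) (cong (x ℤ.^_) (ℕ.m+[n∸m]≡n m≤n)))
  (ℤ.∣m⇒∣m*n (x ℤ.^ (n ℕ.∸ m)) ℤ.∣-refl)

n<m^n : ∀ {m} → 1 ℕ.< m → ∀ n → n ℕ.< m ℕ.^ n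
n<m^n 1<m zero    = z<s
n<m^n {m} 1<m (suc n) = ℕ.<-≤-trans (s<s (n<m^n 1<m n)) (begin
  suc (m ℕ.^ n)          ≤⟨ ℕ.+-monoˡ-≤ _ (ℕ.≤-trans z<s (n<m^n 1<m n)) ⟩
  m ℕ.^ n ℕ.+ m ℕ.^ n    ≡⟨ cong (m ℕ.^ n ℕ.+_) (ℕ.+-identityʳ _) ⟨
  2 ℕ.* m ℕ.^ n          ≤⟨ ℕ.*-monoˡ-≤ (m ℕ.^ n) 1<m ⟩
  m ℕ.* m ℕ.^ n          ∎)
  where open ℕ.≤-Reasoning

largestExponent-unique : ∀ {p n k} bound → p ℕ.^ k ℕ.∣ n →
  (∀ j → p ℕ.^ j ℕ.∣ n → j ℕ.≤ k) → k ℕ.≤ bound → largestExponent p n bound ≡ k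
largestExponent-unique zero _ _ z≤n = refl
largestExponent-unique {p} {n} {k} (suc b) pᵏ∣n maximal k≤1+b
  with (p ℕ.^ suc b) ℕ.∣? n
... | yes d = ℕ.≤-antisym (maximal (suc b) d) k≤1+b
... | no ¬d = largestExponent-unique b pᵏ∣n maximal
  (ℕ.s≤s⁻¹ (ℕ.≤∧≢⇒< k≤1+b λ { refl → ¬d pᵏ∣n }))

fromℤ-mkℚ : ∀ z → fromℤ z ≡ mkℚ z 0 (Coprimality.sym (Coprimality.1-coprimeTo ℤ.∣ z ∣))
fromℤ-mkℚ z = ℚ.↥p/↧p≡p (mkℚ z 0 _)

toℚᵘ-fromℤ : ∀ z → ℚ.toℚᵘ (fromℤ z) ≡ ℚᵘ.mkℚᵘ z 0
toℚᵘ-fromℤ z = cong ℚ.toℚᵘ (fromℤ-mkℚ z)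

fromℤ-homo-* : ∀ x y → fromℤ (x ℤ.* y) ≡ fromℤ x ℚ.* fromℤ y
fromℤ-homo-* x y rewrite fromℤ-mkℚ x | fromℤ-mkℚ y = refl

fromℤ-homo-- : ∀ x y → fromℤ (x ℤ.- y) ≡ fromℤ x ℚ.- fromℤ y
fromℤ-homo-- x y = ℚ.toℚᵘ-injective (begin
  ℚ.toℚᵘ (fromℤ (x ℤ.- y))
    ≡⟨ toℚᵘ-fromℤ (x ℤ.- y) ⟩
  ℚᵘ.mkℚᵘ (x ℤ.- y) 0
    ≈⟨ ℚᵘ.*≡* (lemma x y) ⟩
  ℚᵘ.mkℚᵘ x 0 ℚᵘ.- ℚᵘ.mkℚᵘ y 0
    ≡⟨ cong₂ ℚᵘ._-_ (toℚᵘ-fromℤ x) (toℚᵘ-fromℤ y) ⟨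
  ℚ.toℚᵘ (fromℤ x) ℚᵘ.- ℚ.toℚᵘ (fromℤ y)
    ≈⟨ ℚᵘ.+-congʳ (ℚ.toℚᵘ (fromℤ x)) (ℚ.toℚᵘ-homo‿- (fromℤ y)) ⟨
  ℚ.toℚᵘ (fromℤ x) ℚᵘ.+ ℚ.toℚᵘ (ℚ.- fromℤ y)
    ≈⟨ ℚ.toℚᵘ-homo-+ (fromℤ x) (ℚ.- fromℤ y) ⟨
  ℚ.toℚᵘ (fromℤ x ℚ.- fromℤ y) ∎)
  where
  open ℚᵘ.≃-Reasoning
  lemma : ∀ x y → (x ℤ.- y) ℤ.* 1ℤ ≡ (x ℤ.* 1ℤ ℤ.+ (ℤ.- y) ℤ.* 1ℤ) ℤ.* 1ℤ
  lemma = solve-∀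

fromℤ-injective : ∀ {x y} → fromℤ x ≡ fromℤ y → x ≡ y
fromℤ-injective {x} {y} eq =
  trans (sym (cong ↥_ (fromℤ-mkℚ x))) (trans (cong ↥_ eq) (cong ↥_ (fromℤ-mkℚ y)))

clear-denominator : ∀ d z x → fromℤ d ℚ.* x ≡ fromℤ z → d ℤ.* ↥ x ≡ z ℤ.* ↧ x
clear-denominator d z x@(mkℚ n m _) eq with
  ℚᵘ.≃-trans (ℚᵘ.≃-reflexive (sym (cong (ℚᵘ._* ℚ.toℚᵘ x) (toℚᵘ-fromℤ d))))
  (ℚᵘ.≃-trans (ℚᵘ.≃-sym (ℚ.toℚᵘ-homo-* (fromℤ d) x))
    (ℚᵘ.≃-reflexive (trans (cong ℚ.toℚᵘ eq) (toℚᵘ-fromℤ z))))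
... | ℚᵘ.*≡* e = trans (sym (ℤ.*-identityʳ _)) (trans e (cong (λ k → z ℤ.* + suc k) (ℕ.+-identityʳ m)))

clear-difference : ∀ d u v x y → fromℤ d ℚ.* x ≡ fromℤ u → fromℤ d ℚ.* y ≡ fromℤ v →
                   fromℤ d ℚ.* (x ℚ.- y) ≡ fromℤ (u ℤ.- v)
clear-difference d u v x y dx≡u dy≡v = begin
  fromℤ d ℚ.* (x ℚ.- y)                        ≡⟨ ℚ.*-distribˡ-+ (fromℤ d) x (ℚ.- y) ⟩
  fromℤ d ℚ.* x ℚ.+ fromℤ d ℚ.* (ℚ.- y)        ≡⟨ cong (fromℤ d ℚ.* x ℚ.+_) (ℚ.neg-distribʳ-* (fromℤ d) y) ⟨
  fromℤ d ℚ.* x ℚ.- fromℤ d ℚ.* y              ≡⟨ cong₂ ℚ._-_ dx≡u dy≡v ⟩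
  fromℤ u ℚ.- fromℤ v                          ≡⟨ fromℤ-homo-- u v ⟨
  fromℤ (u ℤ.- v)                              ∎
  where open ≡.≡-Reasoning

ν-0 : ∀ p d x → d ≢ 0ℤ → fromℤ d ℚ.* x ≡ fromℤ 0ℤ → ν p x ≡ ⊤⁺
ν-0 p d x d≢0 eq with ↥ x ℤ.≟ 0ℤ
... | yes _   = refl
... | no ↥x≢0 = contradiction
  (ℤ.i*j≡0⇒i≡0∨j≡0 d (trans (clear-denominator d 0ℤ x eq) (ℤ.*-zeroˡ (↧ x))))
  [ d≢0 , ↥x≢0 ]′

module _ (p : ℕ) (p-prime : Prime p) where

  private
    P : ℤ
    P = + p

    instance
      p-nonZero : NonZero p
      p-nonZero = prime⇒nonZero p-prime

      P-nonZero : ℤ.NonZero P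
      P-nonZero = p-nonZero

  Pᵏ≢0 : ∀ k → P ℤ.^ k ≢ 0ℤ
  Pᵏ≢0 k eq = ℕ.≢-nonZero⁻¹ p (ℤ.+-injective (ℤ.i^n≡0⇒i≡0 P k eq))

  Pᵏ-nonZero : ∀ k → ℤ.NonZero (P ℤ.^ k)
  Pᵏ-nonZero k = ℤ.≢-nonZero (Pᵏ≢0 k)

  1<p : 1 ℕ.< p
  1<p = ℕ.nonTrivial⇒n>1 p {{prime⇒nonTrivial p-prime}}

  prime-∣-* : ∀ x y → P ∣ℤ x ℤ.* y → P ∣ℤ x ⊎ P ∣ℤ y
  prime-∣-* x y d = Sum.map ∣ᵤ⇒∣ ∣ᵤ⇒∣ (euclidsLemma ℤ.∣ x ∣ ℤ.∣ y ∣ p-prime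
    (subst (p ℕ.∣_) (ℤ.abs-* x y) (∣⇒∣ᵤ d)))

  ∤-* : ∀ x y → ¬ P ∣ℤ x → ¬ P ∣ℤ y → ¬ P ∣ℤ x ℤ.* y
  ∤-* x y ¬x ¬y d = [ ¬x , ¬y ]′ (prime-∣-* x y d)

  -- Euclid's lemma moves the factors p into z one at a time. In this way units modulo p, such as 2,
  -- D N or the Vandermonde determinant, are cancelled from congruences modulo p^k.
  ^-∣-* : ∀ k d {z} → ¬ P ∣ℤ d → P ℤ.^ k ∣ℤ d ℤ.* z → P ℤ.^ k ∣ℤ z
  ^-∣-* zero    d {z} _  _ = divides z (sym (ℤ.*-identityʳ z))
  ^-∣-* (suc k) d {z} ¬d h with prime-∣-* d z (ℤ.∣-trans (ℤ.∣m⇒∣m*n (P ℤ.^ k) ℤ.∣-refl) h)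
  ... | inj₁ p∣d = contradiction p∣d ¬d
  ... | inj₂ (divides w refl) =
    subst (P ℤ.^ suc k ∣ℤ_) (ℤ.*-comm P w)
      (ℤ.*-monoʳ-∣ P (^-∣-* k d ¬d
        (ℤ.*-cancelˡ-∣ P (subst (P ℤ.^ suc k ∣ℤ_) (lemma d w P) h))))
    where
    lemma : ∀ d w P → d ℤ.* (w ℤ.* P) ≡ P ℤ.* (d ℤ.* w)
    lemma = solve-∀

  -- Multiplicative form of ν(z) = k for z ≠ 0, convenient for arithmetic with integers.
  record ExactPower (k : ℕ) (z : ℤ) : Set where
    constructor exact
    field
      cofactor : ℤ
      equation : z ≡ P ℤ.^ k ℤ.* cofactor
      maximal  : ¬ P ∣ℤ cofactor

  exactPower : ∀ z → z ≢ 0ℤ → ∃[ k ] ExactPower k z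
  exactPower z = go z (<-wellFounded ℤ.∣ z ∣)
    where
    go : ∀ z → Acc ℕ._<_ ℤ.∣ z ∣ → z ≢ 0ℤ → ∃[ k ] ExactPower k z
    go z (acc rec) z≢0 with P ℤ.∣? z
    ... | no ¬d = 0 , exact z (sym (ℤ.*-identityˡ z)) ¬d
    ... | yes (divides q refl) with go q (rec smaller) q≢0
      where
      q≢0 : q ≢ 0ℤ
      q≢0 refl = z≢0 refl

      smaller : ℤ.∣ q ∣ ℕ.< ℤ.∣ q ℤ.* P ∣
      smaller = subst (ℤ.∣ q ∣ ℕ.<_) (sym (ℤ.abs-* q P))
        (ℕ.m<m*n ℤ.∣ q ∣ p {{ℤ.≢-nonZero q≢0}} 1<p)
    ... | k , exact w refl ¬w = suc k , exact w (lemma P (P ℤ.^ k) w) ¬w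
      where
      lemma : ∀ P Q w → Q ℤ.* w ℤ.* P ≡ P ℤ.* Q ℤ.* w
      lemma = solve-∀

  exactPower⇒≢0 : ∀ {k z} → ExactPower k z → z ≢ 0ℤ
  exactPower⇒≢0 {k} (exact w refl ¬w) eq with ℤ.i*j≡0⇒i≡0∨j≡0 (P ℤ.^ k) eq
  ... | inj₁ Pᵏ≡0 = contradiction Pᵏ≡0 (Pᵏ≢0 k)
  ... | inj₂ refl = ¬w (divides 0ℤ refl)

  νℕ-exact : ∀ {k z} → ExactPower k z → νℕ p ℤ.∣ z ∣ ≡ k
  νℕ-exact {k} {z} e@(exact w refl ¬w) = largestExponent-unique ℤ.∣ z ∣
    (∣⇒∣ᵤ (subst (_∣ℤ z) (sym (pos-^ p k)) (ℤ.∣m⇒∣m*n w ℤ.∣-refl))) maximal′ bounded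
    where
    maximal′ : ∀ j → p ℕ.^ j ℕ.∣ ℤ.∣ z ∣ → j ℕ.≤ k
    maximal′ j pʲ∣z with j ℕ.≤? k
    ... | yes j≤k = j≤k
    ... | no  j≰k = contradiction (ℤ.*-cancelˡ-∣ (P ℤ.^ k) {{Pᵏ-nonZero k}} Pᵏ⁺¹∣z) ¬w
      where
      Pᵏ⁺¹∣z : P ℤ.^ k ℤ.* P ∣ℤ z
      Pᵏ⁺¹∣z = subst (_∣ℤ z) (ℤ.*-comm P (P ℤ.^ k))
        (ℤ.∣-trans (^-monoʳ-∣ P (ℕ.≰⇒> j≰k))
          (subst (_∣ℤ z) (pos-^ p j) (∣ᵤ⇒∣ pʲ∣z)))

    instance
      z-nonZero : ℤ.NonZero z
      z-nonZero = ℤ.≢-nonZero (exactPower⇒≢0 e)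

    bounded : k ℕ.≤ ℤ.∣ z ∣
    bounded = ℕ.<⇒≤ (ℕ.<-≤-trans (n<m^n 1<p k) (ℕ.∣⇒≤
      (∣⇒∣ᵤ (subst (_∣ℤ z) (sym (pos-^ p k)) (ℤ.∣m⇒∣m*n w ℤ.∣-refl)))))

  -- The reduced fraction satisfies d (↥ x) = z (↧ x). If p divided ↧ x, it would divide d or ↥ x,
  -- against `¬d` or coprimality; so ↥ x carries the same power of p as z.
  ν-exact : ∀ {k z} d x → ¬ P ∣ℤ d → fromℤ d ℚ.* x ≡ fromℤ z → ExactPower k z →
            ν p x ≡ [ + k ]
  ν-exact {k} {z} d x@(mkℚ num den-1 coprime) ¬d dx≡z e@(exact w refl ¬w) with ↥ x ℤ.≟ 0ℤ
  ... | yes refl = contradiction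
    (ℤ.i*j≡0⇒i≡0∨j≡0 z (trans (sym (clear-denominator d z x dx≡z)) (ℤ.*-zeroʳ d)))
    [ exactPower⇒≢0 e , (λ ()) ]′
  ... | no ↥x≢0 = cong [_] (begin
    + νℕ p ℤ.∣ ↥ x ∣ ℤ.- + νℕ p (↧ₙ x)
      ≡⟨ cong₂ (λ i j → + i ℤ.- + j) (νℕ-exact exact-↥) (νℕ-exact exact-↧) ⟩
    + k ℤ.- 0ℤ
      ≡⟨ ℤ.+-identityʳ (+ k) ⟩
    + k ∎)
    where
    open ≡.≡-Reasoning

    d↥≡z↧ : d ℤ.* ↥ x ≡ z ℤ.* ↧ x
    d↥≡z↧ = clear-denominator d z x dx≡z

    ¬↧ : ¬ P ∣ℤ ↧ x
    ¬↧ p∣↧ with prime-∣-* d (↥ x) (subst (P ∣ℤ_) (sym d↥≡z↧) (ℤ.∣n⇒∣m*n z p∣↧))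
    ... | inj₁ p∣d = ¬d p∣d
    ... | inj₂ p∣↥ = contradiction
      (Coprimality.recompute coprime (∣⇒∣ᵤ p∣↥ , ∣⇒∣ᵤ p∣↧)) (ℕ.<⇒≢ 1<p ∘ sym)

    Pᵏ∣↥ : P ℤ.^ k ∣ℤ ↥ x
    Pᵏ∣↥ = ^-∣-* k d ¬d (subst (P ℤ.^ k ∣ℤ_) (sym d↥≡z↧)
      (ℤ.∣m⇒∣m*n (↧ x) (ℤ.∣m⇒∣m*n w ℤ.∣-refl)))

    exact-↥ : ExactPower k (↥ x)
    exact-↥ with Pᵏ∣↥
    ... | divides v ↥≡v*Pᵏ = exact v (trans ↥≡v*Pᵏ (ℤ.*-comm v (P ℤ.^ k))) λ p∣v →
      ∤-* w (↧ x) ¬w ¬↧ (subst (P ∣ℤ_) (ℤ.*-cancelˡ-≡ (P ℤ.^ k) _ _ {{Pᵏ-nonZero k}} (begin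
        P ℤ.^ k ℤ.* (d ℤ.* v)   ≡⟨ lemma (P ℤ.^ k) d v ⟩
        d ℤ.* (v ℤ.* P ℤ.^ k)   ≡⟨ cong (d ℤ.*_) ↥≡v*Pᵏ ⟨
        d ℤ.* ↥ x               ≡⟨ d↥≡z↧ ⟩
        P ℤ.^ k ℤ.* w ℤ.* ↧ x   ≡⟨ ℤ.*-assoc (P ℤ.^ k) w (↧ x) ⟩
        P ℤ.^ k ℤ.* (w ℤ.* ↧ x) ∎)) (ℤ.∣n⇒∣m*n d p∣v))
      where
      lemma : ∀ Q d v → Q ℤ.* (d ℤ.* v) ≡ d ℤ.* (v ℤ.* Q)
      lemma = solve-∀

    exact-↧ : ExactPower 0 (↧ x)
    exact-↧ = exact (↧ x) (sym (ℤ.*-identityˡ (↧ x))) ¬↧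

  ν-fromℤ : ∀ {k z} → ExactPower k z → ν p (fromℤ z) ≡ [ + k ]
  ν-fromℤ {z = z} = ν-exact 1ℤ (fromℤ z)
    (λ d → ℕ.<⇒≱ 1<p (ℕ.∣⇒≤ (∣⇒∣ᵤ d))) (ℚ.*-identityˡ (fromℤ z))

-- Powers modulo prime powers

linear-expansion : ∀ v n → v ℤ.* v ∣ℤ (1ℤ ℤ.+ v) ℤ.^ n ℤ.- 1ℤ ℤ.- + n ℤ.* v
linear-expansion v zero    = divides 0ℤ (lemma v)
  where
  lemma : ∀ v → 1ℤ ℤ.- 1ℤ ℤ.- 0ℤ ℤ.* v ≡ 0ℤ ℤ.* (v ℤ.* v)
  lemma = solve-∀
linear-expansion v (suc n) =
  subst (v ℤ.* v ∣ℤ_) (lemma v (+ n) ((1ℤ ℤ.+ v) ℤ.^ n))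
    (ℤ.∣m∣n⇒∣m+n (ℤ.∣n⇒∣m*n (1ℤ ℤ.+ v) (linear-expansion v n)) (ℤ.∣n⇒∣m*n (+ n) ℤ.∣-refl))
  where
  lemma : ∀ v n e → (1ℤ ℤ.+ v) ℤ.* (e ℤ.- 1ℤ ℤ.- n ℤ.* v) ℤ.+ n ℤ.* (v ℤ.* v) ≡
                    (1ℤ ℤ.+ v) ℤ.* e ℤ.- 1ℤ ℤ.- (1ℤ ℤ.+ n) ℤ.* v
  lemma = solve-∀

-- Doubled, so that the binomial coefficient n (n - 1) / 2 appears without a division.
quadratic-expansion : ∀ v n → v ℤ.* v ℤ.* v ∣ℤ
  + 2 ℤ.* ((1ℤ ℤ.+ v) ℤ.^ n ℤ.- 1ℤ ℤ.- + n ℤ.* v) ℤ.- + n ℤ.* (+ n ℤ.- 1ℤ) ℤ.* (v ℤ.* v)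
quadratic-expansion v zero    = divides 0ℤ (lemma v)
  where
  lemma : ∀ v → + 2 ℤ.* (1ℤ ℤ.- 1ℤ ℤ.- 0ℤ ℤ.* v) ℤ.- 0ℤ ℤ.* (0ℤ ℤ.- 1ℤ) ℤ.* (v ℤ.* v) ≡ 0ℤ ℤ.* (v ℤ.* v ℤ.* v)
  lemma = solve-∀
quadratic-expansion v (suc n) =
  subst (v ℤ.* v ℤ.* v ∣ℤ_) (lemma v (+ n) ((1ℤ ℤ.+ v) ℤ.^ n))
    (ℤ.∣m∣n⇒∣m+n (ℤ.∣n⇒∣m*n (1ℤ ℤ.+ v) (quadratic-expansion v n))
      (ℤ.∣n⇒∣m*n (+ n ℤ.* (+ n ℤ.- 1ℤ)) ℤ.∣-refl))
  where
  lemma : ∀ v n e →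
    (1ℤ ℤ.+ v) ℤ.* (+ 2 ℤ.* (e ℤ.- 1ℤ ℤ.- n ℤ.* v) ℤ.- n ℤ.* (n ℤ.- 1ℤ) ℤ.* (v ℤ.* v))
      ℤ.+ n ℤ.* (n ℤ.- 1ℤ) ℤ.* (v ℤ.* v ℤ.* v) ≡
    + 2 ℤ.* ((1ℤ ℤ.+ v) ℤ.* e ℤ.- 1ℤ ℤ.- (1ℤ ℤ.+ n) ℤ.* v)
      ℤ.- (1ℤ ℤ.+ n) ℤ.* (1ℤ ℤ.+ n ℤ.- 1ℤ) ℤ.* (v ℤ.* v)
  lemma = solve-∀

module _ (p : ℕ) (p-prime : Prime p) where

  private
    P : ℤ
    P = + p

  ∤-prime : ∀ {q} → Prime q → p ≢ q → ¬ P ∣ℤ + q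
  ∤-prime q-prime p≢q d with prime⇒irreducible q-prime (∣⇒∣ᵤ d)
  ... | inj₁ p≡1 = ℕ.<⇒≢ (1<p p p-prime) (sym p≡1)
  ... | inj₂ p≡q = p≢q p≡q

  -- The quadratic term p (p - 1) w² / 2 of (1 + w)^p has a factor p beyond w² as p is odd.
  power-expansion-step : ¬ P ∣ℤ + 2 → ∀ j w → P ℤ.^ (1 ℕ.+ j) ∣ℤ w →
    P ℤ.^ (3 ℕ.+ j) ∣ℤ (1ℤ ℤ.+ w) ℤ.^ p ℤ.- 1ℤ ℤ.- P ℤ.* w
  power-expansion-step p∤2 j w (divides d refl) = ^-∣-* p p-prime (3 ℕ.+ j) (+ 2) p∤2
    (subst (P ℤ.^ (3 ℕ.+ j) ∣ℤ_)
      (x-y+y≡x (+ 2 ℤ.* ((1ℤ ℤ.+ w) ℤ.^ p ℤ.- 1ℤ ℤ.- P ℤ.* w)) (P ℤ.* (P ℤ.- 1ℤ) ℤ.* (w ℤ.* w)))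
      (ℤ.∣m∣n⇒∣m+n (ℤ.∣-trans cube (quadratic-expansion w p)) square))
    where

    cube-identity : ∀ P Q d → d ℤ.* (P ℤ.* Q) ℤ.* (d ℤ.* (P ℤ.* Q)) ℤ.* (d ℤ.* (P ℤ.* Q)) ≡
      (d ℤ.* d ℤ.* d ℤ.* Q ℤ.* Q) ℤ.* (P ℤ.* (P ℤ.* (P ℤ.* Q)))
    cube-identity = solve-∀

    cube : P ℤ.^ (3 ℕ.+ j) ∣ℤ w ℤ.* w ℤ.* w
    cube = divides (d ℤ.* d ℤ.* d ℤ.* P ℤ.^ j ℤ.* P ℤ.^ j) (cube-identity P (P ℤ.^ j) d)

    square-identity : ∀ P Q d → P ℤ.* (P ℤ.- 1ℤ) ℤ.* (d ℤ.* (P ℤ.* Q) ℤ.* (d ℤ.* (P ℤ.* Q))) ≡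
      ((P ℤ.- 1ℤ) ℤ.* d ℤ.* d ℤ.* Q) ℤ.* (P ℤ.* (P ℤ.* (P ℤ.* Q)))
    square-identity = solve-∀

    square : P ℤ.^ (3 ℕ.+ j) ∣ℤ P ℤ.* (P ℤ.- 1ℤ) ℤ.* (w ℤ.* w)
    square = divides ((P ℤ.- 1ℤ) ℤ.* d ℤ.* d ℤ.* P ℤ.^ j) (square-identity P (P ℤ.^ j) d)

  -- Induction on j by p-th powers. For z = y^m with p^j ∣ m, p^(j+1) divides z - 1, so z^p - 1 ≡ p
  -- (z - 1) modulo p^(j+3); p times the induction hypothesis turns this into p m (y - 1).
  power-expansion : ¬ P ∣ℤ + 2 → ∀ j y q → P ∣ℤ y ℤ.- 1ℤ →
    P ℤ.^ (2 ℕ.+ j) ∣ℤ y ℤ.^ (q ℕ.* p ℕ.^ j) ℤ.- 1ℤ ℤ.- + (q ℕ.* p ℕ.^ j) ℤ.* (y ℤ.- 1ℤ)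
  power-expansion p∤2 zero y q (divides c y-1≡c*P) =
    subst (P ℤ.^ 2 ∣ℤ_) (cong (λ x → x ℤ.^ (q ℕ.* 1) ℤ.- 1ℤ ℤ.- + (q ℕ.* 1) ℤ.* (y ℤ.- 1ℤ)) (lemma y))
      (ℤ.∣-trans square (linear-expansion (y ℤ.- 1ℤ) (q ℕ.* 1)))
    where
    lemma : ∀ y → 1ℤ ℤ.+ (y ℤ.- 1ℤ) ≡ y
    lemma = solve-∀

    square-identity : ∀ c P → c ℤ.* P ℤ.* (c ℤ.* P) ≡ c ℤ.* c ℤ.* (P ℤ.* (P ℤ.* 1ℤ))
    square-identity = solve-∀

    square : P ℤ.^ 2 ∣ℤ (y ℤ.- 1ℤ) ℤ.* (y ℤ.- 1ℤ)
    square = divides (c ℤ.* c) (trans (cong (λ x → x ℤ.* x) y-1≡c*P) (square-identity c P))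
  power-expansion p∤2 (suc j) y q p∣y-1@(divides c y-1≡c*P) =
    subst (λ k → P ℤ.^ (3 ℕ.+ j) ∣ℤ y ℤ.^ k ℤ.- 1ℤ ℤ.- + k ℤ.* (y ℤ.- 1ℤ)) reassociate
      (subst (P ℤ.^ (3 ℕ.+ j) ∣ℤ_) combine
        (ℤ.∣m∣n⇒∣m+n (power-expansion-step p∤2 j (z ℤ.- 1ℤ) p∣z-1)
                     (ℤ.*-monoʳ-∣ P (power-expansion p∤2 j y q p∣y-1))))
    where
    open ≡.≡-Reasoning

    m = q ℕ.* p ℕ.^ j
    z = y ℤ.^ m

    reassociate : m ℕ.* p ≡ q ℕ.* p ℕ.^ suc j
    reassociate = trans (ℕ.*-assoc q (p ℕ.^ j) p) (cong (q ℕ.*_) (ℕ.*-comm (p ℕ.^ j) p))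

    multiple-identity : ∀ q Q c P → q ℤ.* Q ℤ.* (c ℤ.* P) ≡ q ℤ.* c ℤ.* (P ℤ.* Q)
    multiple-identity = solve-∀

    p∣m*[y-1] : P ℤ.^ (1 ℕ.+ j) ∣ℤ + m ℤ.* (y ℤ.- 1ℤ)
    p∣m*[y-1] = divides (+ q ℤ.* c) (begin
      + m ℤ.* (y ℤ.- 1ℤ)
        ≡⟨ cong₂ ℤ._*_ (trans (ℤ.pos-* q (p ℕ.^ j)) (cong (+ q ℤ.*_) (pos-^ p j))) y-1≡c*P ⟩
      + q ℤ.* P ℤ.^ j ℤ.* (c ℤ.* P)
        ≡⟨ multiple-identity (+ q) (P ℤ.^ j) c P ⟩
      + q ℤ.* c ℤ.* (P ℤ.* P ℤ.^ j) ∎)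

    p∣z-1 : P ℤ.^ (1 ℕ.+ j) ∣ℤ z ℤ.- 1ℤ
    p∣z-1 = subst (P ℤ.^ (1 ℕ.+ j) ∣ℤ_) (x-y+y≡x (z ℤ.- 1ℤ) (+ m ℤ.* (y ℤ.- 1ℤ)))
      (ℤ.∣m∣n⇒∣m+n (ℤ.∣-trans (ℤ.∣n⇒∣m*n P ℤ.∣-refl) (power-expansion p∤2 j y q p∣y-1))
                   p∣m*[y-1])

    combine-identity : ∀ x P z m v →
      x ℤ.- 1ℤ ℤ.- P ℤ.* (z ℤ.- 1ℤ) ℤ.+ P ℤ.* (z ℤ.- 1ℤ ℤ.- m ℤ.* v) ≡ x ℤ.- 1ℤ ℤ.- m ℤ.* P ℤ.* v
    combine-identity = solve-∀

    1+[z-1] : ∀ z → 1ℤ ℤ.+ (z ℤ.- 1ℤ) ≡ z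
    1+[z-1] = solve-∀

    combine : (1ℤ ℤ.+ (z ℤ.- 1ℤ)) ℤ.^ p ℤ.- 1ℤ ℤ.- P ℤ.* (z ℤ.- 1ℤ)
                ℤ.+ P ℤ.* (z ℤ.- 1ℤ ℤ.- + m ℤ.* (y ℤ.- 1ℤ)) ≡
              y ℤ.^ (m ℕ.* p) ℤ.- 1ℤ ℤ.- + (m ℕ.* p) ℤ.* (y ℤ.- 1ℤ)
    combine = trans (combine-identity ((1ℤ ℤ.+ (z ℤ.- 1ℤ)) ℤ.^ p) P z (+ m) (y ℤ.- 1ℤ))
      (cong₂ (λ x k → x ℤ.- 1ℤ ℤ.- k ℤ.* (y ℤ.- 1ℤ))
        (trans (cong (ℤ._^ p) (1+[z-1] z)) (ℤ.^-*-assoc y m p)) (sym (ℤ.pos-* m p)))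

infixl 6 _∣+_ _∣-_
infixl 7 _∣*_

-- Abstract, lest type checking symbolically evaluate the equality proofs of the ring solver.
abstract
  _∣+_ : ∀ {m x y} → m ∣ℤ x → m ∣ℤ y → m ∣ℤ x ℤ.+ y
  _∣+_ = ℤ.∣m∣n⇒∣m+n

  _∣-_ : ∀ {m x y} → m ∣ℤ x → m ∣ℤ y → m ∣ℤ x ℤ.- y
  _∣-_ = ℤ.∣m∣n⇒∣m-n

  _∣*_ : ∀ {m x} → m ∣ℤ x → ∀ y → m ∣ℤ x ℤ.* y
  d ∣* y = ℤ.∣m⇒∣m*n y d

  ∣-≡ : ∀ {m x y} → m ∣ℤ x → x ≡ y → m ∣ℤ y
  ∣-≡ d refl = d

  ∣0 : ∀ {m} → m ∣ℤ 0ℤ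
  ∣0 = divides 0ℤ refl

∣-0≡ : ∀ {m x} → x ≡ 0ℤ → m ∣ℤ x
∣-0≡ eq = ∣-≡ ∣0 (sym eq)

∣x-1⇒∣xⁿ-1 : ∀ {m} x n → m ∣ℤ x ℤ.- 1ℤ → m ∣ℤ x ℤ.^ n ℤ.- 1ℤ
∣x-1⇒∣xⁿ-1 x zero    d = ∣0
∣x-1⇒∣xⁿ-1 x (suc n) d = ∣-≡ (∣x-1⇒∣xⁿ-1 x n d ∣* x ∣+ d) (lemma x (x ℤ.^ n))
  where
  lemma : ∀ x e → (e ℤ.- 1ℤ) ℤ.* x ℤ.+ (x ℤ.- 1ℤ) ≡ x ℤ.* e ℤ.- 1ℤ
  lemma = solve-∀

^-distribʳ-* : ∀ x y n → (x ℤ.* y) ℤ.^ n ≡ x ℤ.^ n ℤ.* y ℤ.^ n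
^-distribʳ-* x y zero    = refl
^-distribʳ-* x y (suc n) = trans (cong (x ℤ.* y ℤ.*_) (^-distribʳ-* x y n))
                                 (lemma x y (x ℤ.^ n) (y ℤ.^ n))
  where
  lemma : ∀ x y a b → x ℤ.* y ℤ.* (a ℤ.* b) ≡ x ℤ.* a ℤ.* (y ℤ.* b)
  lemma = solve-∀

-- The Tribonacci sequence modulo prime powers

ℕ-induction₃ : ∀ {p} (Q : ℕ → Set p) → Q 0 → Q 1 → Q 2 →
  (∀ n → Q n → Q (suc n) → Q (suc (suc n)) → Q (suc (suc (suc n)))) → ∀ n → Q n
ℕ-induction₃ Q q₀ q₁ q₂ step 0 = q₀
ℕ-induction₃ Q q₀ q₁ q₂ step 1 = q₁
ℕ-induction₃ Q q₀ q₁ q₂ step 2 = q₂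
ℕ-induction₃ Q q₀ q₁ q₂ step (suc (suc (suc n))) = step n
  (ℕ-induction₃ Q q₀ q₁ q₂ step n)
  (ℕ-induction₃ Q q₀ q₁ q₂ step (suc n))
  (ℕ-induction₃ Q q₀ q₁ q₂ step (suc (suc n)))

SatisfiesRecurrence : (ℤ → ℤ) → Set
SatisfiesRecurrence u = ∀ n → u (n ℤ.+ + 3) ≡ u (n ℤ.+ + 2) ℤ.+ u (n ℤ.+ + 1) ℤ.+ u n

-- The lowest coefficient of the recurrence is 1, so it runs backwards within ℤ. Congruences
-- obtained from powers of the roots at 0, 1, 2 thereby reach negative indices.
∣-recurrence : ∀ {m} u → SatisfiesRecurrence u →
  m ∣ℤ u (+ 0) → m ∣ℤ u (+ 1) → m ∣ℤ u (+ 2) → ∀ n → m ∣ℤ u n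
∣-recurrence {m} u rec d₀ d₁ d₂ = λ { (+ n) → forward n ; -[1+ n ] → backward n }
  where
  forward : ∀ n → m ∣ℤ u (+ n)
  forward 0 = d₀
  forward 1 = d₁
  forward 2 = d₂
  forward (suc (suc (suc n))) = ∣-≡
    (forward (suc (suc n)) ∣+ forward (suc n) ∣+ forward n)
    (sym (subst (λ k → u (+ k) ≡ u (+ suc (suc n)) ℤ.+ u (+ suc n) ℤ.+ u (+ n)) (ℕ.+-comm n 3)
      (trans (rec (+ n))
        (cong₂ (λ i j → u (+ i) ℤ.+ u (+ j) ℤ.+ u (+ n)) (ℕ.+-comm n 2) (ℕ.+-comm n 1)))))

  solve-last : ∀ n → m ∣ℤ u (n ℤ.+ + 3) → m ∣ℤ u (n ℤ.+ + 2) → m ∣ℤ u (n ℤ.+ + 1) → m ∣ℤ u n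
  solve-last n a b c = ∣-≡ (∣-≡ a (rec n) ∣- b ∣- c)
    (lemma (u (n ℤ.+ + 2)) (u (n ℤ.+ + 1)) (u n))
    where
    lemma : ∀ x y z → x ℤ.+ y ℤ.+ z ℤ.- x ℤ.- y ≡ z
    lemma = solve-∀

  backward : ∀ n → m ∣ℤ u -[1+ n ]
  backward 0 = solve-last -[1+ 0 ] d₂ d₁ d₀
  backward 1 = solve-last -[1+ 1 ] d₁ d₀ (backward 0)
  backward 2 = solve-last -[1+ 2 ] d₀ (backward 0) (backward 1)
  backward (suc (suc (suc n))) =
    solve-last -[1+ suc (suc (suc n)) ] (backward n) (backward (suc n)) (backward (suc (suc n)))

shift-recurrence : ∀ c → SatisfiesRecurrence (λ n → T (n ℤ.+ c))
shift-recurrence c n = begin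
  T (n ℤ.+ + 3 ℤ.+ c)
    ≡⟨ cong T (commute n (+ 3) c) ⟩
  T (n ℤ.+ c ℤ.+ + 3)
    ≡⟨ T-recurrence (n ℤ.+ c) ⟩
  T (n ℤ.+ c ℤ.+ + 2) ℤ.+ T (n ℤ.+ c ℤ.+ + 1) ℤ.+ T (n ℤ.+ c)
    ≡⟨ cong₂ (λ x y → T x ℤ.+ T y ℤ.+ T (n ℤ.+ c)) (commute n (+ 2) c) (commute n (+ 1) c) ⟨
  T (n ℤ.+ + 2 ℤ.+ c) ℤ.+ T (n ℤ.+ + 1 ℤ.+ c) ℤ.+ T (n ℤ.+ c) ∎
  where
  open ≡.≡-Reasoning
  commute : ∀ n k c → n ℤ.+ k ℤ.+ c ≡ n ℤ.+ c ℤ.+ k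
  commute = solve-∀

-- Equal to (a - b) (b - c) (a - c), in the alternating shape shared by `powerSum`.
vandermonde : ℤ → ℤ → ℤ → ℤ
vandermonde a b c = a ℤ.* a ℤ.* (b ℤ.- c) ℤ.+ b ℤ.* b ℤ.* (c ℤ.- a) ℤ.+ c ℤ.* c ℤ.* (a ℤ.- b)

-- Integers representing p-adic roots satisfy Vieta's relations only modulo m.
record Vieta (m a b c : ℤ) : Set where
  field
    ∣e₁-1 : m ∣ℤ a ℤ.+ b ℤ.+ c ℤ.- 1ℤ
    ∣e₂+1 : m ∣ℤ a ℤ.* b ℤ.+ b ℤ.* c ℤ.+ c ℤ.* a ℤ.+ 1ℤ
    ∣e₃-1 : m ∣ℤ a ℤ.* b ℤ.* c ℤ.- 1ℤ

rotate : ∀ {m a b c} → Vieta m a b c → Vieta m b c a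
rotate {a = a} {b} {c} v = record
  { ∣e₁-1 = ∣-≡ ∣e₁-1 (lemma₁ a b c)
  ; ∣e₂+1 = ∣-≡ ∣e₂+1 (lemma₂ a b c)
  ; ∣e₃-1 = ∣-≡ ∣e₃-1 (lemma₃ a b c)
  }
  where
  open Vieta v
  lemma₁ : ∀ a b c → a ℤ.+ b ℤ.+ c ℤ.- 1ℤ ≡ b ℤ.+ c ℤ.+ a ℤ.- 1ℤ
  lemma₁ = solve-∀
  lemma₂ : ∀ a b c → a ℤ.* b ℤ.+ b ℤ.* c ℤ.+ c ℤ.* a ℤ.+ 1ℤ ≡ b ℤ.* c ℤ.+ c ℤ.* a ℤ.+ a ℤ.* b ℤ.+ 1ℤ
  lemma₂ = solve-∀
  lemma₃ : ∀ a b c → a ℤ.* b ℤ.* c ℤ.- 1ℤ ≡ b ℤ.* c ℤ.* a ℤ.- 1ℤ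
  lemma₃ = solve-∀

root : ∀ {m a b c} → Vieta m a b c → m ∣ℤ a ℤ.* (a ℤ.* a) ℤ.- a ℤ.* a ℤ.- a ℤ.- 1ℤ
root {a = a} {b} {c} v = ∣-≡ (∣e₁-1 ∣* (a ℤ.* a) ∣- ∣e₂+1 ∣* a ∣+ ∣e₃-1) (lemma a b c)
  where
  open Vieta v
  lemma : ∀ a b c →
    (a ℤ.+ b ℤ.+ c ℤ.- 1ℤ) ℤ.* (a ℤ.* a) ℤ.- (a ℤ.* b ℤ.+ b ℤ.* c ℤ.+ c ℤ.* a ℤ.+ 1ℤ) ℤ.* a
      ℤ.+ (a ℤ.* b ℤ.* c ℤ.- 1ℤ) ≡ a ℤ.* (a ℤ.* a) ℤ.- a ℤ.* a ℤ.- a ℤ.- 1ℤ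
  lemma = solve-∀

-- The discriminant of X³ - X² - X - 1 is -44.
discriminant : ∀ {m a b c} → Vieta m a b c →
  m ∣ℤ vandermonde a b c ℤ.* vandermonde a b c ℤ.+ + 44
discriminant {m} {a} {b} {c} v = ∣-≡
  -- The discriminant as a polynomial in e₁, e₂, e₃ is moved to the point (1, -1, 1) one variable at
  -- a time; each multiplier is the difference quotient.
  (∣e₁-1 ∣* ((x ℤ.+ 1ℤ) ℤ.* y ℤ.* y ℤ.- + 4 ℤ.* (x ℤ.* x ℤ.+ x ℤ.+ 1ℤ) ℤ.* z ℤ.+ + 18 ℤ.* y ℤ.* z)
    ∣+ ∣e₂+1 ∣* (y ℤ.- 1ℤ ℤ.- + 4 ℤ.* (y ℤ.* y ℤ.- y ℤ.+ 1ℤ) ℤ.+ + 18 ℤ.* z)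
    ∣+ ∣e₃-1 ∣* (ℤ.- (+ 27 ℤ.* z) ℤ.- + 49))
  (trans (telescope x y z) (cong (ℤ._+ + 44) (sym (square a b c))))
  where
  open Vieta v
  x = a ℤ.+ b ℤ.+ c
  y = a ℤ.* b ℤ.+ b ℤ.* c ℤ.+ c ℤ.* a
  z = a ℤ.* b ℤ.* c
  square : ∀ a b c →
    let x = a ℤ.+ b ℤ.+ c ; y = a ℤ.* b ℤ.+ b ℤ.* c ℤ.+ c ℤ.* a ; z = a ℤ.* b ℤ.* c
        d = a ℤ.* a ℤ.* (b ℤ.- c) ℤ.+ b ℤ.* b ℤ.* (c ℤ.- a) ℤ.+ c ℤ.* c ℤ.* (a ℤ.- b) in
    d ℤ.* d ≡ x ℤ.* x ℤ.* y ℤ.* y ℤ.- + 4 ℤ.* (y ℤ.* y ℤ.* y) ℤ.- + 4 ℤ.* (x ℤ.* x ℤ.* x ℤ.* z)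
                ℤ.+ + 18 ℤ.* (x ℤ.* y ℤ.* z) ℤ.- + 27 ℤ.* (z ℤ.* z)
  square = solve-∀
  telescope : ∀ x y z →
    (x ℤ.- 1ℤ) ℤ.* ((x ℤ.+ 1ℤ) ℤ.* y ℤ.* y ℤ.- + 4 ℤ.* (x ℤ.* x ℤ.+ x ℤ.+ 1ℤ) ℤ.* z ℤ.+ + 18 ℤ.* y ℤ.* z)
      ℤ.+ (y ℤ.+ 1ℤ) ℤ.* (y ℤ.- 1ℤ ℤ.- + 4 ℤ.* (y ℤ.* y ℤ.- y ℤ.+ 1ℤ) ℤ.+ + 18 ℤ.* z)
      ℤ.+ (z ℤ.- 1ℤ) ℤ.* (ℤ.- (+ 27 ℤ.* z) ℤ.- + 49) ≡
    x ℤ.* x ℤ.* y ℤ.* y ℤ.- + 4 ℤ.* (y ℤ.* y ℤ.* y) ℤ.- + 4 ℤ.* (x ℤ.* x ℤ.* x ℤ.* z)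
      ℤ.+ + 18 ℤ.* (x ℤ.* y ℤ.* z) ℤ.- + 27 ℤ.* (z ℤ.* z) ℤ.+ + 44
  telescope = solve-∀

module _ {m a b c : ℤ} (v : Vieta m a b c) where
  open Vieta v

  private
    V : ℤ
    V = vandermonde a b c

  -- Since V / ((a - b) (a - c)) = b - c, and cyclically, this is V times Binet's sum of a^n / ((a -
  -- b) (a - c)), free of division.
  powerSum : ℕ → ℤ
  powerSum n = a ℤ.^ n ℤ.* (b ℤ.- c) ℤ.+ b ℤ.^ n ℤ.* (c ℤ.- a) ℤ.+ c ℤ.^ n ℤ.* (a ℤ.- b)

  powerSum-recurrence : ∀ n →
    m ∣ℤ powerSum (3 ℕ.+ n) ℤ.- powerSum (2 ℕ.+ n) ℤ.- powerSum (1 ℕ.+ n) ℤ.- powerSum n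
  powerSum-recurrence n = ∣-≡
    (term a (root v) (b ℤ.- c) ∣+ term b (root (rotate v)) (c ℤ.- a)
      ∣+ term c (root (rotate (rotate v))) (a ℤ.- b))
    (regroup (t 3 a (b ℤ.- c)) (t 2 a (b ℤ.- c)) (t 1 a (b ℤ.- c)) (t 0 a (b ℤ.- c))
             (t 3 b (c ℤ.- a)) (t 2 b (c ℤ.- a)) (t 1 b (c ℤ.- a)) (t 0 b (c ℤ.- a))
             (t 3 c (a ℤ.- b)) (t 2 c (a ℤ.- b)) (t 1 c (a ℤ.- b)) (t 0 c (a ℤ.- b)))
    where
    t : ℕ → ℤ → ℤ → ℤ
    t k x u = x ℤ.^ (k ℕ.+ n) ℤ.* u

    lemma : ∀ x y u → (x ℤ.* (x ℤ.* x) ℤ.- x ℤ.* x ℤ.- x ℤ.- 1ℤ) ℤ.* (y ℤ.* u) ≡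
      x ℤ.* (x ℤ.* (x ℤ.* y)) ℤ.* u ℤ.- x ℤ.* (x ℤ.* y) ℤ.* u ℤ.- x ℤ.* y ℤ.* u ℤ.- y ℤ.* u
    lemma = solve-∀

    term : ∀ x → m ∣ℤ x ℤ.* (x ℤ.* x) ℤ.- x ℤ.* x ℤ.- x ℤ.- 1ℤ → ∀ u →
           m ∣ℤ t 3 x u ℤ.- t 2 x u ℤ.- t 1 x u ℤ.- t 0 x u
    term x d u = ∣-≡ (d ∣* (x ℤ.^ n ℤ.* u)) (lemma x (x ℤ.^ n) u)

    regroup : ∀ a₃ a₂ a₁ a₀ b₃ b₂ b₁ b₀ c₃ c₂ c₁ c₀ →
      a₃ ℤ.- a₂ ℤ.- a₁ ℤ.- a₀ ℤ.+ (b₃ ℤ.- b₂ ℤ.- b₁ ℤ.- b₀) ℤ.+ (c₃ ℤ.- c₂ ℤ.- c₁ ℤ.- c₀) ≡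
      (a₃ ℤ.+ b₃ ℤ.+ c₃) ℤ.- (a₂ ℤ.+ b₂ ℤ.+ c₂) ℤ.- (a₁ ℤ.+ b₁ ℤ.+ c₁) ℤ.- (a₀ ℤ.+ b₀ ℤ.+ c₀)
    regroup = solve-∀

  -- Both terms obey the recurrence modulo m and agree identically at 0 and 1. At 2 the sum equals
  -- (a + b + c) V, which is where e₁ ≡ 1 enters.
  binet : ∀ n → m ∣ℤ V ℤ.* T (+ n) ℤ.- powerSum (suc n)
  binet = ℕ-induction₃ (λ n → m ∣ℤ V ℤ.* T (+ n) ℤ.- powerSum (suc n))
    (∣-0≡ (lemma₀ a b c)) (∣-0≡ (lemma₁ a b c)) (∣-≡ (∣e₁-1 ∣* (ℤ.- V)) (lemma₂ a b c))
    λ n d₀ d₁ d₂ → ∣-≡ (d₂ ∣+ d₁ ∣+ d₀ ∣- powerSum-recurrence (suc n))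
      (lemma₃ V (T (+ suc (suc n))) (T (+ suc n)) (T (+ n))
        (powerSum (4 ℕ.+ n)) (powerSum (3 ℕ.+ n)) (powerSum (2 ℕ.+ n)) (powerSum (1 ℕ.+ n)))
    where
    lemma₀ : ∀ a b c →
      (a ℤ.* a ℤ.* (b ℤ.- c) ℤ.+ b ℤ.* b ℤ.* (c ℤ.- a) ℤ.+ c ℤ.* c ℤ.* (a ℤ.- b)) ℤ.* 0ℤ
      ℤ.- (a ℤ.* 1ℤ ℤ.* (b ℤ.- c) ℤ.+ b ℤ.* 1ℤ ℤ.* (c ℤ.- a) ℤ.+ c ℤ.* 1ℤ ℤ.* (a ℤ.- b)) ≡ 0ℤ
    lemma₀ = solve-∀
    lemma₁ : ∀ a b c →
      (a ℤ.* a ℤ.* (b ℤ.- c) ℤ.+ b ℤ.* b ℤ.* (c ℤ.- a) ℤ.+ c ℤ.* c ℤ.* (a ℤ.- b)) ℤ.* 1ℤ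
      ℤ.- (a ℤ.* (a ℤ.* 1ℤ) ℤ.* (b ℤ.- c) ℤ.+ b ℤ.* (b ℤ.* 1ℤ) ℤ.* (c ℤ.- a) ℤ.+ c ℤ.* (c ℤ.* 1ℤ) ℤ.* (a ℤ.- b)) ≡ 0ℤ
    lemma₁ = solve-∀
    lemma₂ : ∀ a b c →
      (a ℤ.+ b ℤ.+ c ℤ.- 1ℤ) ℤ.*
      (ℤ.- (a ℤ.* a ℤ.* (b ℤ.- c) ℤ.+ b ℤ.* b ℤ.* (c ℤ.- a) ℤ.+ c ℤ.* c ℤ.* (a ℤ.- b))) ≡
      (a ℤ.* a ℤ.* (b ℤ.- c) ℤ.+ b ℤ.* b ℤ.* (c ℤ.- a) ℤ.+ c ℤ.* c ℤ.* (a ℤ.- b)) ℤ.* 1ℤ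
      ℤ.- (a ℤ.* (a ℤ.* (a ℤ.* 1ℤ)) ℤ.* (b ℤ.- c) ℤ.+ b ℤ.* (b ℤ.* (b ℤ.* 1ℤ)) ℤ.* (c ℤ.- a)
             ℤ.+ c ℤ.* (c ℤ.* (c ℤ.* 1ℤ)) ℤ.* (a ℤ.- b))
    lemma₂ = solve-∀
    lemma₃ : ∀ V x y z s₄ s₃ s₂ s₁ →
      V ℤ.* x ℤ.- s₃ ℤ.+ (V ℤ.* y ℤ.- s₂) ℤ.+ (V ℤ.* z ℤ.- s₁) ℤ.- (s₄ ℤ.- s₃ ℤ.- s₂ ℤ.- s₁) ≡
      V ℤ.* (x ℤ.+ y ℤ.+ z) ℤ.- s₄
    lemma₃ = solve-∀

  -- A relation x^i - 1 ≡ k (x^j - 1) valid at all three roots survives multiplication by powers and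
  -- summation, hence passes to T. The main instance is i = N m, j = N, k = m.
  powerSum-shift : ∀ i j k → let R = λ x → x ℤ.^ i ℤ.- 1ℤ ℤ.- k ℤ.* (x ℤ.^ j ℤ.- 1ℤ) in
    m ∣ℤ R a → m ∣ℤ R b → m ∣ℤ R c → ∀ n →
    m ∣ℤ powerSum (suc (n ℕ.+ i)) ℤ.- powerSum (suc n)
           ℤ.- k ℤ.* (powerSum (suc (n ℕ.+ j)) ℤ.- powerSum (suc n))
  powerSum-shift i j k ra rb rc n = ∣-≡
    (term a ra (b ℤ.- c) ∣+ term b rb (c ℤ.- a) ∣+ term c rc (a ℤ.- b))
    (regroup k (t i a (b ℤ.- c)) (t₀ a (b ℤ.- c)) (t j a (b ℤ.- c))
               (t i b (c ℤ.- a)) (t₀ b (c ℤ.- a)) (t j b (c ℤ.- a))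
               (t i c (a ℤ.- b)) (t₀ c (a ℤ.- b)) (t j c (a ℤ.- b)))
    where
    t : ℕ → ℤ → ℤ → ℤ
    t k x u = x ℤ.^ suc (n ℕ.+ k) ℤ.* u

    t₀ : ℤ → ℤ → ℤ
    t₀ x u = x ℤ.^ suc n ℤ.* u

    lemma : ∀ xⁱ xʲ k y u → (xⁱ ℤ.- 1ℤ ℤ.- k ℤ.* (xʲ ℤ.- 1ℤ)) ℤ.* (y ℤ.* u) ≡
      y ℤ.* xⁱ ℤ.* u ℤ.- y ℤ.* u ℤ.- k ℤ.* (y ℤ.* xʲ ℤ.* u ℤ.- y ℤ.* u)
    lemma = solve-∀

    term : ∀ x → m ∣ℤ x ℤ.^ i ℤ.- 1ℤ ℤ.- k ℤ.* (x ℤ.^ j ℤ.- 1ℤ) → ∀ u →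
           m ∣ℤ t i x u ℤ.- t₀ x u ℤ.- k ℤ.* (t j x u ℤ.- t₀ x u)
    term x d u = ∣-≡ (d ∣* (x ℤ.^ suc n ℤ.* u))
      (trans (lemma (x ℤ.^ i) (x ℤ.^ j) k (x ℤ.^ suc n) u)
        (cong₂ (λ y z → y ℤ.* u ℤ.- t₀ x u ℤ.- k ℤ.* (z ℤ.* u ℤ.- t₀ x u))
          (sym (ℤ.^-distribˡ-+-* x (suc n) i)) (sym (ℤ.^-distribˡ-+-* x (suc n) j))))

    regroup : ∀ k aᵢ a₀ aⱼ bᵢ b₀ bⱼ cᵢ c₀ cⱼ →
      aᵢ ℤ.- a₀ ℤ.- k ℤ.* (aⱼ ℤ.- a₀) ℤ.+ (bᵢ ℤ.- b₀ ℤ.- k ℤ.* (bⱼ ℤ.- b₀))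
        ℤ.+ (cᵢ ℤ.- c₀ ℤ.- k ℤ.* (cⱼ ℤ.- c₀)) ≡
      aᵢ ℤ.+ bᵢ ℤ.+ cᵢ ℤ.- (a₀ ℤ.+ b₀ ℤ.+ c₀)
        ℤ.- k ℤ.* (aⱼ ℤ.+ bⱼ ℤ.+ cⱼ ℤ.- (a₀ ℤ.+ b₀ ℤ.+ c₀))
    regroup = solve-∀

  T-shift : ∀ i j k → let R = λ x → x ℤ.^ i ℤ.- 1ℤ ℤ.- k ℤ.* (x ℤ.^ j ℤ.- 1ℤ) in
    m ∣ℤ R a → m ∣ℤ R b → m ∣ℤ R c → ∀ n →
    m ∣ℤ V ℤ.* (T (+ (n ℕ.+ i)) ℤ.- T (+ n) ℤ.- k ℤ.* (T (+ (n ℕ.+ j)) ℤ.- T (+ n)))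
  T-shift i j k ra rb rc n = combine
    V (T (+ (n ℕ.+ i))) (T (+ n)) (T (+ (n ℕ.+ j))) k
    (powerSum (suc (n ℕ.+ i))) (powerSum (suc n)) (powerSum (suc (n ℕ.+ j)))
    (binet (n ℕ.+ i)) (binet n) (binet (n ℕ.+ j)) (powerSum-shift i j k ra rb rc n)
    where
    lemma : ∀ V t t₀ t′ k s s₀ s′ →
      V ℤ.* t ℤ.- s ℤ.- (V ℤ.* t₀ ℤ.- s₀) ℤ.- (V ℤ.* t′ ℤ.- s′ ℤ.- (V ℤ.* t₀ ℤ.- s₀)) ℤ.* k
        ℤ.+ (s ℤ.- s₀ ℤ.- k ℤ.* (s′ ℤ.- s₀)) ≡
      V ℤ.* (t ℤ.- t₀ ℤ.- k ℤ.* (t′ ℤ.- t₀))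
    lemma = solve-∀

    combine : ∀ V t t₀ t′ k s s₀ s′ →
      m ∣ℤ V ℤ.* t ℤ.- s → m ∣ℤ V ℤ.* t₀ ℤ.- s₀ → m ∣ℤ V ℤ.* t′ ℤ.- s′ →
      m ∣ℤ s ℤ.- s₀ ℤ.- k ℤ.* (s′ ℤ.- s₀) → m ∣ℤ V ℤ.* (t ℤ.- t₀ ℤ.- k ℤ.* (t′ ℤ.- t₀))
    combine V t t₀ t′ k s s₀ s′ d d₀ d′ e =
      ∣-≡ (d ∣- d₀ ∣- (d′ ∣- d₀) ∣* k ∣+ e) (lemma V t t₀ t′ k s s₀ s′)

prime[11] : Prime 11
prime[11] = from-yes (prime? 11)

prime[3] : Prime 3
prime[3] = from-yes (prime? 3)

∣-* : ∀ {m n x y} → m ∣ℤ x → n ∣ℤ y → m ℤ.* n ∣ℤ x ℤ.* y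
∣-* {m} {n} (divides q refl) (divides r refl) = divides (q ℤ.* r) (lemma q m r n)
  where
  lemma : ∀ q m r n → q ℤ.* m ℤ.* (r ℤ.* n) ≡ q ℤ.* r ℤ.* (m ℤ.* n)
  lemma = solve-∀

recurrence-shift-combination : ∀ i j k → SatisfiesRecurrence
  (λ n → T (n ℤ.+ i) ℤ.- T n ℤ.- k ℤ.* (T (n ℤ.+ j) ℤ.- T n))
recurrence-shift-combination i j k n =
  trans (cong₂ (λ x y → x ℤ.- T (n ℤ.+ + 3) ℤ.- k ℤ.* (y ℤ.- T (n ℤ.+ + 3)))
          (shift-recurrence i n) (shift-recurrence j n))
  (trans (cong (λ z → X 2 i ℤ.+ X 1 i ℤ.+ T (n ℤ.+ i) ℤ.- z ℤ.-
                      k ℤ.* (X 2 j ℤ.+ X 1 j ℤ.+ T (n ℤ.+ j) ℤ.- z)) (T-recurrence n))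
  (lemma (X 2 i) (X 1 i) (T (n ℤ.+ i)) (T (n ℤ.+ + 2)) (T (n ℤ.+ + 1)) (T n)
         (X 2 j) (X 1 j) (T (n ℤ.+ j)) k))
  where
  X : ℕ → ℤ → ℤ
  X a i = T (n ℤ.+ + a ℤ.+ i)

  lemma : ∀ i₂ i₁ i₀ t₂ t₁ t₀ j₂ j₁ j₀ k →
    i₂ ℤ.+ i₁ ℤ.+ i₀ ℤ.- (t₂ ℤ.+ t₁ ℤ.+ t₀)
      ℤ.- k ℤ.* (j₂ ℤ.+ j₁ ℤ.+ j₀ ℤ.- (t₂ ℤ.+ t₁ ℤ.+ t₀)) ≡
    (i₂ ℤ.- t₂ ℤ.- k ℤ.* (j₂ ℤ.- t₂)) ℤ.+ (i₁ ℤ.- t₁ ℤ.- k ℤ.* (j₁ ℤ.- t₁))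
      ℤ.+ (i₀ ℤ.- t₀ ℤ.- k ℤ.* (j₀ ℤ.- t₀))
  lemma = solve-∀

module _ (p : ℕ) (p-prime : Prime p) (p≢2 : p ≢ 2) (p≢11 : p ≢ 11) where

  private
    P : ℤ
    P = + p

  ∤2 : ¬ P ∣ℤ + 2
  ∤2 = ∤-prime p p-prime prime[2] p≢2

  -- V² ≡ -44 modulo p and 44 = 2 · 2 · 11. The roots thus stay distinct modulo p, and V can be
  -- cancelled from Binet's formula.
  ∤vandermonde : ∀ {m a b c} → P ∣ℤ m → Vieta m a b c → ¬ P ∣ℤ vandermonde a b c
  ∤vandermonde {a = a} {b} {c} P∣m v d =
    ∤-* p p-prime (+ 2) (+ 22) ∤2 (∤-* p p-prime (+ 2) (+ 11) ∤2 (∤-prime p p-prime prime[11] p≢11))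
      (∣-≡ (ℤ.∣-trans P∣m (discriminant v) ∣- d ∣* V) (lemma (V ℤ.* V)))
    where
    V = vandermonde a b c
    lemma : ∀ x → x ℤ.+ + 44 ℤ.- x ≡ + 44
    lemma = solve-∀

  -- What the integer argument needs from the p-adic roots: representatives to a given precision,
  -- and their orders modulo p alone. The exponent `suc k` ensures that p divides the modulus.
  record RootsModulo (N k : ℕ) : Set where
    field
      α β γ : ℤ
      vieta : Vieta (P ℤ.^ suc k) α β γ
      α-order : P ∣ℤ α ℤ.^ N ℤ.- 1ℤ
      β-order : P ∣ℤ β ℤ.^ N ℤ.- 1ℤ
      γ-order : P ∣ℤ γ ℤ.^ N ℤ.- 1ℤ

  -- Expansion of T along residue classes modulo N

  module Periods (N : ℕ) (roots : ∀ k → RootsModulo N k) where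

    drift : ℤ → ℤ
    drift n = T (n ℤ.+ + N) ℤ.- T n

    P∣Pˢ : ∀ k → P ∣ℤ P ℤ.^ suc k
    P∣Pˢ k = ℤ.∣m⇒∣m*n (P ℤ.^ k) ℤ.∣-refl

    T-shift-ℤ : ∀ k i j c → let open RootsModulo (roots k)
                                R = λ x → x ℤ.^ i ℤ.- 1ℤ ℤ.- c ℤ.* (x ℤ.^ j ℤ.- 1ℤ) in
      P ℤ.^ suc k ∣ℤ R α → P ℤ.^ suc k ∣ℤ R β → P ℤ.^ suc k ∣ℤ R γ → ∀ n →
      P ℤ.^ suc k ∣ℤ T (n ℤ.+ + i) ℤ.- T n ℤ.- c ℤ.* (T (n ℤ.+ + j) ℤ.- T n)
    T-shift-ℤ k i j c rα rβ rγ = ∣-recurrence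
      (λ n → T (n ℤ.+ + i) ℤ.- T n ℤ.- c ℤ.* (T (n ℤ.+ + j) ℤ.- T n))
      (recurrence-shift-combination (+ i) (+ j) c) (initial 0) (initial 1) (initial 2)
      where
      open RootsModulo (roots k)
      initial : ∀ n → P ℤ.^ suc k ∣ℤ
        T (+ (n ℕ.+ i)) ℤ.- T (+ n) ℤ.- c ℤ.* (T (+ (n ℕ.+ j)) ℤ.- T (+ n))
      initial n = ^-∣-* p p-prime (suc k) (vandermonde α β γ) (∤vandermonde (P∣Pˢ k) vieta)
        (T-shift vieta i j c rα rβ rγ n)

    P∣drift : ∀ n → P ∣ℤ drift n
    P∣drift n = subst (_∣ℤ drift n) (ℤ.*-identityʳ P)
      -- The coefficient 0 removes the second shift; what remains of the relation is x^N ≡ 1 at each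
      -- root.
      (∣-≡ (T-shift-ℤ 0 N 0 0ℤ (R α-order) (R β-order) (R γ-order) n)
        (lemma (T (n ℤ.+ + N)) (T n) (T (n ℤ.+ + 0))))
      where
      open RootsModulo (roots 0)
      lemma : ∀ x y z → x ℤ.- y ℤ.- 0ℤ ℤ.* (z ℤ.- y) ≡ x ℤ.- y
      lemma = solve-∀
      R : ∀ {x} → P ∣ℤ x ℤ.^ N ℤ.- 1ℤ → P ℤ.^ 1 ∣ℤ x ℤ.^ N ℤ.- 1ℤ ℤ.- 0ℤ ℤ.* (x ℤ.^ 0 ℤ.- 1ℤ)
      R {x} d = subst (_∣ℤ x ℤ.^ N ℤ.- 1ℤ ℤ.- 0ℤ ℤ.* (x ℤ.^ 0 ℤ.- 1ℤ)) (sym (ℤ.*-identityʳ P))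
        (∣-≡ d (sym (ℤ.+-identityʳ (x ℤ.^ N ℤ.- 1ℤ))))

    T-multiple-ℕ : ∀ j m → p ℕ.^ j ℕ.∣ m → ∀ n →
      P ℤ.^ (2 ℕ.+ j) ∣ℤ T (n ℤ.+ + (N ℕ.* m)) ℤ.- T n ℤ.- + m ℤ.* drift n
    T-multiple-ℕ j m (ℕ.divides q refl) =
      T-shift-ℤ (suc j) (N ℕ.* m) N (+ m) (R α α-order) (R β β-order) (R γ γ-order)
      where
      open RootsModulo (roots (suc j))
      R : ∀ x → P ∣ℤ x ℤ.^ N ℤ.- 1ℤ →
          P ℤ.^ (2 ℕ.+ j) ∣ℤ x ℤ.^ (N ℕ.* m) ℤ.- 1ℤ ℤ.- + m ℤ.* (x ℤ.^ N ℤ.- 1ℤ)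
      R x d = subst (λ z → P ℤ.^ (2 ℕ.+ j) ∣ℤ z ℤ.- 1ℤ ℤ.- + m ℤ.* (x ℤ.^ N ℤ.- 1ℤ))
        (ℤ.^-*-assoc x N m) (power-expansion p p-prime ∤2 j (x ℤ.^ N) q d)

    -- Modulo p² the value T(n + N m) is affine in m, so consecutive differences are constant:
    -- subtract the expansions for m + 1 and m.
    drift-shift : ∀ m n → P ℤ.^ 2 ∣ℤ drift (n ℤ.+ + (N ℕ.* m)) ℤ.- drift n
    drift-shift m n = ∣-≡
      (T-multiple-ℕ 0 (suc m) (ℕ.1∣ suc m) n ∣- T-multiple-ℕ 0 m (ℕ.1∣ m) n)
      (trans (lemma (T (n ℤ.+ + (N ℕ.* suc m))) (T (n ℤ.+ + (N ℕ.* m))) (T n) (+ m) (drift n))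
        (cong (λ k → T k ℤ.- T (n ℤ.+ + (N ℕ.* m)) ℤ.- drift n) index))
      where
      lemma : ∀ x y t m d → x ℤ.- t ℤ.- (1ℤ ℤ.+ m) ℤ.* d ℤ.- (y ℤ.- t ℤ.- m ℤ.* d) ≡ x ℤ.- y ℤ.- d
      lemma = solve-∀
      index : n ℤ.+ + (N ℕ.* suc m) ≡ n ℤ.+ + (N ℕ.* m) ℤ.+ + N
      index = trans (cong (λ k → n ℤ.+ + k) (trans (ℕ.*-suc N m) (ℕ.+-comm N (N ℕ.* m))))
                    (sym (ℤ.+-assoc n (+ (N ℕ.* m)) (+ N)))

    private
      above : ∀ n n′ k → n′ ℤ.- n ≡ + k ℤ.* + N → n′ ≡ n ℤ.+ + (N ℕ.* k)
      above n n′ k eq = trans (sym (lemma n n′)) (cong (λ i → n ℤ.+ i)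
        (trans eq (trans (sym (ℤ.pos-* k N)) (cong +_ (ℕ.*-comm k N)))))
        where
        lemma : ∀ x y → x ℤ.+ (y ℤ.- x) ≡ y
        lemma = solve-∀

      below : ∀ n n′ k → n′ ℤ.- n ≡ -[1+ k ] ℤ.* + N → n ≡ n′ ℤ.+ + (N ℕ.* suc k)
      below n n′ k eq = above n′ n (suc k) (trans (flip n n′)
        (trans (cong (ℤ.-_) eq) (ℤ.neg-distribˡ-* -[1+ k ] (+ N))))
        where
        flip : ∀ n n′ → n ℤ.- n′ ≡ ℤ.- (n′ ℤ.- n)
        flip = solve-∀

    drift-cong : ∀ n n′ → + N ∣ℤ n′ ℤ.- n → P ℤ.^ 2 ∣ℤ drift n′ ℤ.- drift n
    drift-cong n n′ (divides (+ k) eq) = subst (λ i → P ℤ.^ 2 ∣ℤ drift i ℤ.- drift n)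
      (sym (above n n′ k eq)) (drift-shift k n)
    drift-cong n n′ (divides -[1+ k ] eq) = ∣-≡
      (∣0 ∣- subst (λ i → P ℤ.^ 2 ∣ℤ drift i ℤ.- drift n′) (sym (below n n′ k eq)) (drift-shift (suc k) n′))
      (lemma (drift n) (drift n′))
      where
      lemma : ∀ x y → 0ℤ ℤ.- (x ℤ.- y) ≡ y ℤ.- x
      lemma = solve-∀

    T-multiple : ∀ j n n′ q → n′ ℤ.- n ≡ q ℤ.* + N → P ℤ.^ j ∣ℤ q →
      P ℤ.^ (2 ℕ.+ j) ∣ℤ T n′ ℤ.- T n ℤ.- q ℤ.* drift n
    T-multiple j n n′ (+ k) eq Pʲ∣q = subst
      (λ i → P ℤ.^ (2 ℕ.+ j) ∣ℤ T i ℤ.- T n ℤ.- + k ℤ.* drift n) (sym (above n n′ k eq))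
      (T-multiple-ℕ j k (∣⇒∣ᵤ (subst (_∣ℤ + k) (sym (pos-^ p j)) Pʲ∣q)) n)
    -- For negative q the expansion is taken around n′. Passing from `drift n′` to `drift n` costs
    -- their difference, divisible by p², times |q|, divisible by p^j.
    T-multiple j n n′ -[1+ k ] eq Pʲ∣q =
      subst (λ q → P ℤ.^ (2 ℕ.+ j) ∣ℤ T n′ ℤ.- T n ℤ.- q ℤ.* drift n) {x = ℤ.- + suc k} refl
        (reverse (T n) (T n′) (+ suc k) (drift n) (drift n′)
          (subst (λ i → P ℤ.^ (2 ℕ.+ j) ∣ℤ T i ℤ.- T n′ ℤ.- + suc k ℤ.* drift n′)
            (sym (below n n′ k eq)) (T-multiple-ℕ j (suc k) (∣⇒∣ᵤ pʲ∣1+k) n′))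
          (subst (_∣ℤ (drift n′ ℤ.- drift n) ℤ.* + suc k) (sym (ℤ.^-distribˡ-+-* P 2 j))
            (∣-* (drift-cong n n′ (divides -[1+ k ] eq)) (subst (_∣ℤ + suc k) (pos-^ p j) pʲ∣1+k))))
      where
      reverse : ∀ {m} t t′ k d d′ → m ∣ℤ t ℤ.- t′ ℤ.- k ℤ.* d′ → m ∣ℤ (d′ ℤ.- d) ℤ.* k →
        m ∣ℤ t′ ℤ.- t ℤ.- (ℤ.- k) ℤ.* d
      reverse t t′ k d d′ x y = ∣-≡ (∣0 ∣- x ∣- y) (lemma t t′ k d d′)
        where
        lemma : ∀ t t′ k d d′ → 0ℤ ℤ.- (t ℤ.- t′ ℤ.- k ℤ.* d′) ℤ.- (d′ ℤ.- d) ℤ.* k ≡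
          t′ ℤ.- t ℤ.- (ℤ.- k) ℤ.* d
        lemma = solve-∀

      pʲ∣1+k : + (p ℕ.^ j) ∣ℤ + suc k
      pʲ∣1+k = ∣ᵤ⇒∣ (∣⇒∣ᵤ (subst (_∣ℤ -[1+ k ]) (sym (pos-^ p j)) Pʲ∣q))

    T-periodic : ∀ n n′ → + N ∣ℤ n′ ℤ.- n → P ∣ℤ T n′ ℤ.- T n
    T-periodic n n′ (divides q eq) = ∣-≡
      (ℤ.∣-trans (P∣Pˢ 1) (T-multiple 0 n n′ q eq (divides q (sym (ℤ.*-identityʳ q))))
        ∣+ ℤ.∣n⇒∣m*n q (P∣drift n))
      (lemma (T n′) (T n) (q ℤ.* drift n))
      where
      lemma : ∀ x y z → x ℤ.- y ℤ.- z ℤ.+ z ≡ x ℤ.- y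
      lemma = solve-∀

    -- e approximates the rational zero b / D of the p-adic interpolation of T.
    T-exactPower : ¬ P ∣ℤ + N → ∀ {k} D b n e → ¬ P ∣ℤ D → + N ∣ℤ n ℤ.- e →
      ExactPower p p-prime k (D ℤ.* n ℤ.- b) → P ℤ.^ (2 ℕ.+ k) ∣ℤ D ℤ.* e ℤ.- b →
      P ℤ.^ (2 ℕ.+ k) ∣ℤ T e → ¬ P ℤ.^ 2 ∣ℤ drift e → ExactPower p p-prime (suc k) (T n)
    T-exactPower P∤N {k} D b n e P∤D (divides q n-e≡qN) (exact w Dn-b≡Pᵏw P∤w)
      (divides r De-b≡) (divides s Te≡) P²∤drift =
      finish
        (^-∣-* p p-prime k (D ℤ.* + N) (∤-* p p-prime D (+ N) P∤D P∤N)
          (divides (w ℤ.- r ℤ.* (P ℤ.* P)) DNq≡))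
        (P∣drift e)
      where
      open ≡.≡-Reasoning
      lemma₁ : ∀ D N q → D ℤ.* N ℤ.* q ≡ D ℤ.* (q ℤ.* N)
      lemma₁ = solve-∀
      lemma₂ : ∀ D n e b → D ℤ.* (n ℤ.- e) ≡ D ℤ.* n ℤ.- b ℤ.- (D ℤ.* e ℤ.- b)
      lemma₂ = solve-∀
      lemma₃ : ∀ P Q w r → Q ℤ.* w ℤ.- r ℤ.* (P ℤ.* (P ℤ.* Q)) ≡ (w ℤ.- r ℤ.* (P ℤ.* P)) ℤ.* Q
      lemma₃ = solve-∀
      -- D (n - e) and D n - b agree modulo p^(k+2), so q = (n - e) / N inherits the exact exponent
      -- k.
      DNq≡ : D ℤ.* + N ℤ.* q ≡ (w ℤ.- r ℤ.* (P ℤ.* P)) ℤ.* P ℤ.^ k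
      DNq≡ = begin
        D ℤ.* + N ℤ.* q                                ≡⟨ lemma₁ D (+ N) q ⟩
        D ℤ.* (q ℤ.* + N)                              ≡⟨ cong (D ℤ.*_) n-e≡qN ⟨
        D ℤ.* (n ℤ.- e)                                ≡⟨ lemma₂ D n e b ⟩
        D ℤ.* n ℤ.- b ℤ.- (D ℤ.* e ℤ.- b)              ≡⟨ cong₂ ℤ._-_ Dn-b≡Pᵏw De-b≡ ⟩
        P ℤ.^ k ℤ.* w ℤ.- r ℤ.* (P ℤ.* (P ℤ.* P ℤ.^ k)) ≡⟨ lemma₃ P (P ℤ.^ k) w r ⟩
        (w ℤ.- r ℤ.* (P ℤ.* P)) ℤ.* P ℤ.^ k            ∎

      finish : P ℤ.^ k ∣ℤ q → P ∣ℤ drift e → ExactPower p p-prime (suc k) (T n)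
      finish Pᵏ∣q@(divides q′ q≡) (divides d drift≡) =
        conclude (T-multiple k e n q n-e≡qN Pᵏ∣q)
        where
        DNq′≡ : D ℤ.* + N ℤ.* q′ ≡ w ℤ.- r ℤ.* (P ℤ.* P)
        DNq′≡ = ℤ.*-cancelʳ-≡ (D ℤ.* + N ℤ.* q′) (w ℤ.- r ℤ.* (P ℤ.* P)) (P ℤ.^ k)
          {{Pᵏ-nonZero p p-prime k}}
          (trans (ℤ.*-assoc (D ℤ.* + N) q′ (P ℤ.^ k))
            (trans (cong (D ℤ.* + N ℤ.*_) (sym q≡)) DNq≡))

        P∤q′ : ¬ P ∣ℤ q′
        P∤q′ P∣q′ = P∤w (∣-≡
          (ℤ.∣n⇒∣m*n (D ℤ.* + N) P∣q′ ∣+ ℤ.∣n⇒∣m*n r (ℤ.∣n⇒∣m*n P ℤ.∣-refl))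
          (trans (cong (ℤ._+ r ℤ.* (P ℤ.* P)) DNq′≡) (x-y+y≡x w (r ℤ.* (P ℤ.* P)))))

        P∤d : ¬ P ∣ℤ d
        P∤d (divides x d≡) = P²∤drift (divides x (trans drift≡ (trans (cong (ℤ._* P) d≡) (assoc x P))))
          where
          assoc : ∀ x P → x ℤ.* P ℤ.* P ≡ x ℤ.* (P ℤ.* (P ℤ.* 1ℤ))
          assoc = solve-∀

        conclude : P ℤ.^ (2 ℕ.+ k) ∣ℤ T n ℤ.- T e ℤ.- q ℤ.* drift e →
                   ExactPower p p-prime (suc k) (T n)
        -- The term `q ℤ.* drift e` contributes exactly p^k · p; `T e` and the error of the
        -- expansion are divisible by p^(k+2).
        conclude (divides t eq) = exact (q′ ℤ.* d ℤ.+ P ℤ.* (s ℤ.+ t)) (begin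
          T n
            ≡⟨ expand (T n) (T e) (q ℤ.* drift e) ⟩
          T n ℤ.- T e ℤ.- q ℤ.* drift e ℤ.+ T e ℤ.+ q ℤ.* drift e
            ≡⟨ cong₂ ℤ._+_ (cong₂ ℤ._+_ eq Te≡) (cong₂ ℤ._*_ q≡ drift≡) ⟩
          t ℤ.* (P ℤ.* (P ℤ.* P ℤ.^ k)) ℤ.+ s ℤ.* (P ℤ.* (P ℤ.* P ℤ.^ k))
            ℤ.+ q′ ℤ.* P ℤ.^ k ℤ.* (d ℤ.* P)
            ≡⟨ collect t s q′ d P (P ℤ.^ k) ⟩
          P ℤ.* P ℤ.^ k ℤ.* (q′ ℤ.* d ℤ.+ P ℤ.* (s ℤ.+ t)) ∎)
          λ P∣ → ∤-* p p-prime q′ d P∤q′ P∤d (ℤ.∣m+n∣n⇒∣m P∣ (ℤ.∣m⇒∣m*n (s ℤ.+ t) ℤ.∣-refl))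
          where
          expand : ∀ x y z → x ≡ x ℤ.- y ℤ.- z ℤ.+ y ℤ.+ z
          expand = solve-∀
          collect : ∀ t s q d P Q → t ℤ.* (P ℤ.* (P ℤ.* Q)) ℤ.+ s ℤ.* (P ℤ.* (P ℤ.* Q))
            ℤ.+ q ℤ.* Q ℤ.* (d ℤ.* P) ≡ P ℤ.* Q ℤ.* (q ℤ.* d ℤ.+ P ℤ.* (s ℤ.+ t))
          collect = solve-∀

-- Cube roots of the roots

-- The alternating sum of x^i y^j z^k (with ijk as in the name) is the Vandermonde
-- determinant, the case 210, times a Schur polynomial.
alternant-630 : ∀ x y z →
  let V = x ℤ.* x ℤ.* (y ℤ.- z) ℤ.+ y ℤ.* y ℤ.* (z ℤ.- x) ℤ.+ z ℤ.* z ℤ.* (x ℤ.- y)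
      X = x ℤ.* x ℤ.* x ; Y = y ℤ.* y ℤ.* y ; Z = z ℤ.* z ℤ.* z in
  X ℤ.* X ℤ.* (Y ℤ.- Z) ℤ.+ Y ℤ.* Y ℤ.* (Z ℤ.- X) ℤ.+ Z ℤ.* Z ℤ.* (X ℤ.- Y) ≡
  V ℤ.* ((x ℤ.* x ℤ.+ x ℤ.* y ℤ.+ y ℤ.* y) ℤ.* (y ℤ.* y ℤ.+ y ℤ.* z ℤ.+ z ℤ.* z)
           ℤ.* (z ℤ.* z ℤ.+ z ℤ.* x ℤ.+ x ℤ.* x))
alternant-630 = solve-∀

alternant-430 : ∀ x y z →
  let V = x ℤ.* x ℤ.* (y ℤ.- z) ℤ.+ y ℤ.* y ℤ.* (z ℤ.- x) ℤ.+ z ℤ.* z ℤ.* (x ℤ.- y)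
      X = x ℤ.* x ℤ.* x ; Y = y ℤ.* y ℤ.* y ; Z = z ℤ.* z ℤ.* z
      s₁ = x ℤ.+ y ℤ.+ z ; s₂ = x ℤ.* y ℤ.+ y ℤ.* z ℤ.+ z ℤ.* x ; s₃ = x ℤ.* y ℤ.* z in
  X ℤ.* x ℤ.* (Y ℤ.- Z) ℤ.+ Y ℤ.* y ℤ.* (Z ℤ.- X) ℤ.+ Z ℤ.* z ℤ.* (X ℤ.- Y) ≡
  V ℤ.* (s₂ ℤ.* s₂ ℤ.- s₁ ℤ.* s₃)
alternant-430 = solve-∀

alternant-520 : ∀ x y z →
  let V = x ℤ.* x ℤ.* (y ℤ.- z) ℤ.+ y ℤ.* y ℤ.* (z ℤ.- x) ℤ.+ z ℤ.* z ℤ.* (x ℤ.- y)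
      X = x ℤ.* x ℤ.* x ; Y = y ℤ.* y ℤ.* y ; Z = z ℤ.* z ℤ.* z
      s₁ = x ℤ.+ y ℤ.+ z ; s₂ = x ℤ.* y ℤ.+ y ℤ.* z ℤ.+ z ℤ.* x ; s₃ = x ℤ.* y ℤ.* z in
  (y ℤ.* z) ℤ.* (y ℤ.* z) ℤ.* (Y ℤ.- Z) ℤ.+ (z ℤ.* x) ℤ.* (z ℤ.* x) ℤ.* (Z ℤ.- X)
    ℤ.+ (x ℤ.* y) ℤ.* (x ℤ.* y) ℤ.* (X ℤ.- Y) ≡
  V ℤ.* (s₁ ℤ.* s₁ ℤ.* s₂ ℤ.- s₂ ℤ.* s₂ ℤ.- s₁ ℤ.* s₃)
alternant-520 = solve-∀

∣-cong-* : ∀ {m} x x′ y y′ → m ∣ℤ x ℤ.- x′ → m ∣ℤ y ℤ.- y′ → m ∣ℤ x ℤ.* y ℤ.- x′ ℤ.* y′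
∣-cong-* x x′ y y′ d e = ∣-≡ (d ∣* y ∣+ ℤ.∣n⇒∣m*n x′ e) (lemma x x′ y y′)
  where
  lemma : ∀ x x′ y y′ → (x ℤ.- x′) ℤ.* y ℤ.+ x′ ℤ.* (y ℤ.- y′) ≡ x ℤ.* y ℤ.- x′ ℤ.* y′
  lemma = solve-∀

∣-cong-+ : ∀ {m} x x′ y y′ → m ∣ℤ x ℤ.- x′ → m ∣ℤ y ℤ.- y′ → m ∣ℤ x ℤ.+ y ℤ.- (x′ ℤ.+ y′)
∣-cong-+ x x′ y y′ d e = ∣-≡ (d ∣+ e) (lemma x x′ y y′)
  where
  lemma : ∀ x x′ y y′ → x ℤ.- x′ ℤ.+ (y ℤ.- y′) ≡ x ℤ.+ y ℤ.- (x′ ℤ.+ y′)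
  lemma = solve-∀

∣-cong-- : ∀ {m} x x′ y y′ → m ∣ℤ x ℤ.- x′ → m ∣ℤ y ℤ.- y′ → m ∣ℤ x ℤ.- y ℤ.- (x′ ℤ.- y′)
∣-cong-- x x′ y y′ d e = ∣-≡ (d ∣- e) (lemma x x′ y y′)
  where
  lemma : ∀ x x′ y y′ → x ℤ.- x′ ℤ.- (y ℤ.- y′) ≡ x ℤ.- y ℤ.- (x′ ℤ.- y′)
  lemma = solve-∀

∣-trans-- : ∀ {m} x y z → m ∣ℤ x ℤ.- y → m ∣ℤ y ℤ.- z → m ∣ℤ x ℤ.- z
∣-trans-- x y z d e = ∣-≡ (d ∣+ e) (lemma x y z)
  where
  lemma : ∀ x y z → x ℤ.- y ℤ.+ (y ℤ.- z) ≡ x ℤ.- z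
  lemma = solve-∀

∣-flip : ∀ {m} x y → m ∣ℤ x ℤ.- y → m ∣ℤ y ℤ.- x
∣-flip x y d = ∣-≡ (∣0 ∣- d) (lemma x y)
  where
  lemma : ∀ x y → 0ℤ ℤ.- (x ℤ.- y) ≡ y ℤ.- x
  lemma = solve-∀

alternant-cong : ∀ {m} u₁ u₂ u₃ v₁ v₂ v₃ a b c a′ b′ c′ →
  m ∣ℤ u₁ ℤ.- v₁ → m ∣ℤ u₂ ℤ.- v₂ → m ∣ℤ u₃ ℤ.- v₃ →
  m ∣ℤ a ℤ.- a′ → m ∣ℤ b ℤ.- b′ → m ∣ℤ c ℤ.- c′ →
  m ∣ℤ u₁ ℤ.* (b ℤ.- c) ℤ.+ u₂ ℤ.* (c ℤ.- a) ℤ.+ u₃ ℤ.* (a ℤ.- b)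
         ℤ.- (v₁ ℤ.* (b′ ℤ.- c′) ℤ.+ v₂ ℤ.* (c′ ℤ.- a′) ℤ.+ v₃ ℤ.* (a′ ℤ.- b′))
alternant-cong u₁ u₂ u₃ v₁ v₂ v₃ a b c a′ b′ c′ d₁ d₂ d₃ da db dc =
  ∣-cong-+ (u₁ ℤ.* (b ℤ.- c) ℤ.+ u₂ ℤ.* (c ℤ.- a)) (v₁ ℤ.* (b′ ℤ.- c′) ℤ.+ v₂ ℤ.* (c′ ℤ.- a′))
           (u₃ ℤ.* (a ℤ.- b)) (v₃ ℤ.* (a′ ℤ.- b′))
    (∣-cong-+ (u₁ ℤ.* (b ℤ.- c)) (v₁ ℤ.* (b′ ℤ.- c′)) (u₂ ℤ.* (c ℤ.- a)) (v₂ ℤ.* (c′ ℤ.- a′))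
      (∣-cong-* u₁ v₁ (b ℤ.- c) (b′ ℤ.- c′) d₁ (∣-cong-- b b′ c c′ db dc))
      (∣-cong-* u₂ v₂ (c ℤ.- a) (c′ ℤ.- a′) d₂ (∣-cong-- c c′ a a′ dc da)))
    (∣-cong-* u₃ v₃ (a ℤ.- b) (a′ ℤ.- b′) d₃ (∣-cong-- a a′ b b′ da db))

vandermonde-cubes : ∀ x y z X Y Z →
  x ℤ.* x ℤ.* x ≡ X → y ℤ.* y ℤ.* y ≡ Y → z ℤ.* z ℤ.* z ≡ Z →
  X ℤ.* X ℤ.* (Y ℤ.- Z) ℤ.+ Y ℤ.* Y ℤ.* (Z ℤ.- X) ℤ.+ Z ℤ.* Z ℤ.* (X ℤ.- Y) ≡
  vandermonde x y z ℤ.* ((x ℤ.* x ℤ.+ x ℤ.* y ℤ.+ y ℤ.* y)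
    ℤ.* (y ℤ.* y ℤ.+ y ℤ.* z ℤ.+ z ℤ.* z) ℤ.* (z ℤ.* z ℤ.+ z ℤ.* x ℤ.+ x ℤ.* x))
vandermonde-cubes x y z _ _ _ refl refl refl = alternant-630 x y z

powerSum₁ : ∀ x y z X Y Z s₁ s₂ s₃ →
  x ℤ.* x ℤ.* x ≡ X → y ℤ.* y ℤ.* y ≡ Y → z ℤ.* z ℤ.* z ≡ Z →
  x ℤ.+ y ℤ.+ z ≡ s₁ → x ℤ.* y ℤ.+ y ℤ.* z ℤ.+ z ℤ.* x ≡ s₂ →
  x ℤ.* y ℤ.* z ≡ s₃ → X ℤ.+ Y ℤ.+ Z ≡
  s₁ ℤ.* s₁ ℤ.* s₁ ℤ.- + 3 ℤ.* (s₁ ℤ.* s₂) ℤ.+ + 3 ℤ.* s₃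
powerSum₁ x y z _ _ _ _ _ _ refl refl refl refl refl refl = lemma x y z
  where
  lemma : ∀ x y z →
    let s₁ = x ℤ.+ y ℤ.+ z ; s₂ = x ℤ.* y ℤ.+ y ℤ.* z ℤ.+ z ℤ.* x ; s₃ = x ℤ.* y ℤ.* z in
    x ℤ.* x ℤ.* x ℤ.+ y ℤ.* y ℤ.* y ℤ.+ z ℤ.* z ℤ.* z ≡
    s₁ ℤ.* s₁ ℤ.* s₁ ℤ.- + 3 ℤ.* (s₁ ℤ.* s₂) ℤ.+ + 3 ℤ.* s₃
  lemma = solve-∀

-- This is `powerSum₁` for x y, y z, z x, whose elementary symmetric functions are s₂, s₁ s₃ and
-- s₃².
powerSum₂ : ∀ x y z X Y Z s₁ s₂ s₃ →
  x ℤ.* x ℤ.* x ≡ X → y ℤ.* y ℤ.* y ≡ Y → z ℤ.* z ℤ.* z ≡ Z →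
  x ℤ.+ y ℤ.+ z ≡ s₁ → x ℤ.* y ℤ.+ y ℤ.* z ℤ.+ z ℤ.* x ≡ s₂ →
  x ℤ.* y ℤ.* z ≡ s₃ →
  X ℤ.* Y ℤ.+ Y ℤ.* Z ℤ.+ Z ℤ.* X ≡
  s₂ ℤ.* s₂ ℤ.* s₂ ℤ.- + 3 ℤ.* (s₁ ℤ.* s₂) ℤ.* s₃ ℤ.+ + 3 ℤ.* (s₃ ℤ.* s₃)
powerSum₂ x y z _ _ _ _ _ _ refl refl refl refl refl refl = lemma x y z
  where
  lemma : ∀ x y z →
    let s₁ = x ℤ.+ y ℤ.+ z ; s₂ = x ℤ.* y ℤ.+ y ℤ.* z ℤ.+ z ℤ.* x ; s₃ = x ℤ.* y ℤ.* z
        X = x ℤ.* x ℤ.* x ; Y = y ℤ.* y ℤ.* y ; Z = z ℤ.* z ℤ.* z in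
    X ℤ.* Y ℤ.+ Y ℤ.* Z ℤ.+ Z ℤ.* X ≡
    s₂ ℤ.* s₂ ℤ.* s₂ ℤ.- + 3 ℤ.* (s₁ ℤ.* s₂) ℤ.* s₃ ℤ.+ + 3 ℤ.* (s₃ ℤ.* s₃)
  lemma = solve-∀

module CubeRoots (m a b c x y z X Y Z s₁ s₂ s₃ : ℤ) (v : Vieta m a b c)
  (x³≡ : x ℤ.* x ℤ.* x ≡ X) (y³≡ : y ℤ.* y ℤ.* y ≡ Y) (z³≡ : z ℤ.* z ℤ.* z ≡ Z)
  (X-a : m ∣ℤ X ℤ.- a) (Y-b : m ∣ℤ Y ℤ.- b) (Z-c : m ∣ℤ Z ℤ.- c)
  (e₁≡ : x ℤ.+ y ℤ.+ z ≡ s₁) (e₂≡ : x ℤ.* y ℤ.+ y ℤ.* z ℤ.+ z ℤ.* x ≡ s₂)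
  (e₃≡ : x ℤ.* y ℤ.* z ≡ s₃) (s₃-1 : m ∣ℤ s₃ ℤ.- 1ℤ) where

  open Vieta v

  -- Newton's identity with x³ + y³ + z³ ≡ a + b + c ≡ 1 and s₃ ≡ 1. The companion `s₂³` rests on a
  -- b + b c + c a ≡ -1.
  s₁³ : m ∣ℤ s₁ ℤ.* s₁ ℤ.* s₁ ℤ.- (+ 3 ℤ.* (s₁ ℤ.* s₂) ℤ.- + 2)
  s₁³ = combine (powerSum₁ x y z X Y Z s₁ s₂ s₃ x³≡ y³≡ z³≡ e₁≡ e₂≡ e₃≡)
    (∣-trans-- (X ℤ.+ Y ℤ.+ Z) (a ℤ.+ b ℤ.+ c) 1ℤ
      (∣-cong-+ (X ℤ.+ Y) (a ℤ.+ b) Z c (∣-cong-+ X a Y b X-a Y-b) Z-c) ∣e₁-1)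
    where
    identity : ∀ s₁ s₂ s₃ →
      s₁ ℤ.* s₁ ℤ.* s₁ ℤ.- + 3 ℤ.* (s₁ ℤ.* s₂) ℤ.+ + 3 ℤ.* s₃ ℤ.- 1ℤ ℤ.- (s₃ ℤ.- 1ℤ) ℤ.* + 3 ≡
      s₁ ℤ.* s₁ ℤ.* s₁ ℤ.- (+ 3 ℤ.* (s₁ ℤ.* s₂) ℤ.- + 2)
    identity = solve-∀
    combine : ∀ {t} → t ≡ s₁ ℤ.* s₁ ℤ.* s₁ ℤ.- + 3 ℤ.* (s₁ ℤ.* s₂) ℤ.+ + 3 ℤ.* s₃ →
      m ∣ℤ t ℤ.- 1ℤ → m ∣ℤ s₁ ℤ.* s₁ ℤ.* s₁ ℤ.- (+ 3 ℤ.* (s₁ ℤ.* s₂) ℤ.- + 2)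
    combine refl e = ∣-≡ (e ∣- s₃-1 ∣* + 3) (identity s₁ s₂ s₃)

  s₂³ : m ∣ℤ s₂ ℤ.* s₂ ℤ.* s₂ ℤ.- (+ 3 ℤ.* (s₁ ℤ.* s₂) ℤ.- + 4)
  s₂³ = combine (powerSum₂ x y z X Y Z s₁ s₂ s₃ x³≡ y³≡ z³≡ e₁≡ e₂≡ e₃≡)
    (shift (X ℤ.* Y ℤ.+ Y ℤ.* Z ℤ.+ Z ℤ.* X) (a ℤ.* b ℤ.+ b ℤ.* c ℤ.+ c ℤ.* a)
      (∣-cong-+ (X ℤ.* Y ℤ.+ Y ℤ.* Z) (a ℤ.* b ℤ.+ b ℤ.* c) (Z ℤ.* X) (c ℤ.* a)
        (∣-cong-+ (X ℤ.* Y) (a ℤ.* b) (Y ℤ.* Z) (b ℤ.* c)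
          (∣-cong-* X a Y b X-a Y-b) (∣-cong-* Y b Z c Y-b Z-c))
        (∣-cong-* Z c X a Z-c X-a))
      ∣e₂+1)
    where
    shift : ∀ t u → m ∣ℤ t ℤ.- u → m ∣ℤ u ℤ.+ 1ℤ → m ∣ℤ t ℤ.+ 1ℤ
    shift t u d e = ∣-≡ (d ∣+ e) (lemma t u)
      where
      lemma : ∀ t u → t ℤ.- u ℤ.+ (u ℤ.+ 1ℤ) ≡ t ℤ.+ 1ℤ
      lemma = solve-∀
    identity : ∀ s₁ s₂ s₃ →
      s₂ ℤ.* s₂ ℤ.* s₂ ℤ.- + 3 ℤ.* (s₁ ℤ.* s₂) ℤ.* s₃ ℤ.+ + 3 ℤ.* (s₃ ℤ.* s₃) ℤ.+ 1ℤ
        ℤ.+ (s₃ ℤ.- 1ℤ) ℤ.* (+ 3 ℤ.* (s₁ ℤ.* s₂) ℤ.- + 3 ℤ.* (s₃ ℤ.+ 1ℤ)) ≡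
      s₂ ℤ.* s₂ ℤ.* s₂ ℤ.- (+ 3 ℤ.* (s₁ ℤ.* s₂) ℤ.- + 4)
    identity = solve-∀
    combine : ∀ {t} →
      t ≡ s₂ ℤ.* s₂ ℤ.* s₂ ℤ.- + 3 ℤ.* (s₁ ℤ.* s₂) ℤ.* s₃ ℤ.+ + 3 ℤ.* (s₃ ℤ.* s₃) →
      m ∣ℤ t ℤ.+ 1ℤ → m ∣ℤ s₂ ℤ.* s₂ ℤ.* s₂ ℤ.- (+ 3 ℤ.* (s₁ ℤ.* s₂) ℤ.- + 4)
    combine refl e =
      ∣-≡ (e ∣+ s₃-1 ∣* (+ 3 ℤ.* (s₁ ℤ.* s₂) ℤ.- + 3 ℤ.* (s₃ ℤ.+ 1ℤ))) (identity s₁ s₂ s₃)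

  -- The factor s₁ s₂ - 2 belongs to the cube roots for which T(1/3) = T(-5/3) = 0, the
  -- other one to the remaining choices of cube roots with product 1.
  resolvent : let s = s₁ ℤ.* s₂ in m ∣ℤ ((s ℤ.- + 2) ℤ.* (s ℤ.- + 5) ℤ.- + 6) ℤ.* (s ℤ.- + 2)
  -- For s = s₁ s₂ the two cubes multiply to s³ ≡ (3 s - 2) (3 s - 4), and the difference factors as
  -- (s - 2) (s² - 7 s + 4). The quadratic is written (s - 2) (s - 5) - 6 to display its value at s
  -- = 2.
  resolvent = ∣-≡ (s₁³ ∣* (s₂ ℤ.* s₂ ℤ.* s₂) ∣+ s₂³ ∣* (+ 3 ℤ.* (s₁ ℤ.* s₂) ℤ.- + 2))
    (identity s₁ s₂)
    where
    identity : ∀ t u → let s = t ℤ.* u in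
      (t ℤ.* t ℤ.* t ℤ.- (+ 3 ℤ.* s ℤ.- + 2)) ℤ.* (u ℤ.* u ℤ.* u)
        ℤ.+ (u ℤ.* u ℤ.* u ℤ.- (+ 3 ℤ.* s ℤ.- + 4)) ℤ.* (+ 3 ℤ.* s ℤ.- + 2) ≡
      ((s ℤ.- + 2) ℤ.* (s ℤ.- + 5) ℤ.- + 6) ℤ.* (s ℤ.- + 2)
    identity = solve-∀

  -- The factor s₂² - s₁ is T(1/3) up to a unit, by `T-third`. Multiplied by s₂ it depends on s₁ s₂
  -- alone, because s₂³ does.
  s₂*[s₂²-s₁] : m ∣ℤ s₂ ℤ.* (s₂ ℤ.* s₂ ℤ.- s₁) ℤ.- + 2 ℤ.* (s₁ ℤ.* s₂ ℤ.- + 2)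
  s₂*[s₂²-s₁] = ∣-≡ s₂³ (identity s₁ s₂)
    where
    identity : ∀ t u → u ℤ.* u ℤ.* u ℤ.- (+ 3 ℤ.* (t ℤ.* u) ℤ.- + 4) ≡
      u ℤ.* (u ℤ.* u ℤ.- t) ℤ.- + 2 ℤ.* (t ℤ.* u ℤ.- + 2)
    identity = solve-∀

  -- The analogue for T(-5/3): with s = s₁ s₂, the product s² - s₂³ - s becomes s² - 4 s + 4, a
  -- square, which still forces s ≡ 2 modulo p when p divides it.
  s₂*[s₁²s₂-s₂²-s₁] : m ∣ℤ s₂ ℤ.* (s₁ ℤ.* s₁ ℤ.* s₂ ℤ.- s₂ ℤ.* s₂ ℤ.- s₁)
                           ℤ.- (s₁ ℤ.* s₂ ℤ.- + 2) ℤ.* (s₁ ℤ.* s₂ ℤ.- + 2)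
  s₂*[s₁²s₂-s₂²-s₁] = ∣-≡ (∣0 ∣- s₂³) (identity s₁ s₂)
    where
    identity : ∀ t u → 0ℤ ℤ.- (u ℤ.* u ℤ.* u ℤ.- (+ 3 ℤ.* (t ℤ.* u) ℤ.- + 4)) ≡
      u ℤ.* (t ℤ.* t ℤ.* u ℤ.- u ℤ.* u ℤ.- t) ℤ.- (t ℤ.* u ℤ.- + 2) ℤ.* (t ℤ.* u ℤ.- + 2)
    identity = solve-∀

  -- The Vandermonde determinant of x, y, z divides that of their cubes, which is congruent to the
  -- one of a, b, c. As the latter is prime to p, so is the former.
  V∣vandermonde : ∃[ w ] m ∣ℤ vandermonde a b c ℤ.- vandermonde x y z ℤ.* w
  V∣vandermonde = w , subst (λ t → m ∣ℤ vandermonde a b c ℤ.- t) (vandermonde-cubes x y z X Y Z x³≡ y³≡ z³≡)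
    (∣-flip (X ℤ.* X ℤ.* (Y ℤ.- Z) ℤ.+ Y ℤ.* Y ℤ.* (Z ℤ.- X) ℤ.+ Z ℤ.* Z ℤ.* (X ℤ.- Y))
      (vandermonde a b c)
      (alternant-cong (X ℤ.* X) (Y ℤ.* Y) (Z ℤ.* Z) (a ℤ.* a) (b ℤ.* b) (c ℤ.* c) X Y Z a b c
        (∣-cong-* X a X a X-a X-a) (∣-cong-* Y b Y b Y-b Y-b) (∣-cong-* Z c Z c Z-c Z-c)
        X-a Y-b Z-c))
    where
    w : ℤ
    w = (x ℤ.* x ℤ.+ x ℤ.* y ℤ.+ y ℤ.* y) ℤ.* (y ℤ.* y ℤ.+ y ℤ.* z ℤ.+ z ℤ.* z)
          ℤ.* (z ℤ.* z ℤ.+ z ℤ.* x ℤ.+ x ℤ.* x)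

  -- Named after the partition (4, 3, 0) - (2, 1, 0) = (2, 2, 0); s₃ ≡ 1 removes s₃ from its Schur
  -- polynomial. In `schur-31` the exponents 5, 2, 0 give (3, 1, 0).
  schur-22 : ∀ V → vandermonde x y z ≡ V →
    m ∣ℤ X ℤ.* x ℤ.* (Y ℤ.- Z) ℤ.+ Y ℤ.* y ℤ.* (Z ℤ.- X) ℤ.+ Z ℤ.* z ℤ.* (X ℤ.- Y)
           ℤ.- V ℤ.* (s₂ ℤ.* s₂ ℤ.- s₁)
  schur-22 V V≡ = combine (value x y z V X Y Z s₁ s₂ s₃ V≡ x³≡ y³≡ z³≡ e₁≡ e₂≡ e₃≡)
    where
    value : ∀ x y z V X Y Z s₁ s₂ s₃ → vandermonde x y z ≡ V →
      x ℤ.* x ℤ.* x ≡ X → y ℤ.* y ℤ.* y ≡ Y → z ℤ.* z ℤ.* z ≡ Z →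
      x ℤ.+ y ℤ.+ z ≡ s₁ → x ℤ.* y ℤ.+ y ℤ.* z ℤ.+ z ℤ.* x ≡ s₂ → x ℤ.* y ℤ.* z ≡ s₃ →
      X ℤ.* x ℤ.* (Y ℤ.- Z) ℤ.+ Y ℤ.* y ℤ.* (Z ℤ.- X) ℤ.+ Z ℤ.* z ℤ.* (X ℤ.- Y) ≡
      V ℤ.* (s₂ ℤ.* s₂ ℤ.- s₁ ℤ.* s₃)
    value x y z _ _ _ _ _ _ _ refl refl refl refl refl refl refl = alternant-430 x y z
    identity : ∀ V s₁ s₂ s₃ → (s₃ ℤ.- 1ℤ) ℤ.* (ℤ.- (V ℤ.* s₁)) ≡
      V ℤ.* (s₂ ℤ.* s₂ ℤ.- s₁ ℤ.* s₃) ℤ.- V ℤ.* (s₂ ℤ.* s₂ ℤ.- s₁)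
    identity = solve-∀
    combine : ∀ {t} → t ≡ V ℤ.* (s₂ ℤ.* s₂ ℤ.- s₁ ℤ.* s₃) →
      m ∣ℤ t ℤ.- V ℤ.* (s₂ ℤ.* s₂ ℤ.- s₁)
    combine refl = ∣-≡ (s₃-1 ∣* (ℤ.- (V ℤ.* s₁))) (identity V s₁ s₂ s₃)

  schur-31 : ∀ V → vandermonde x y z ≡ V →
    m ∣ℤ (y ℤ.* z) ℤ.* (y ℤ.* z) ℤ.* (Y ℤ.- Z) ℤ.+ (z ℤ.* x) ℤ.* (z ℤ.* x) ℤ.* (Z ℤ.- X)
           ℤ.+ (x ℤ.* y) ℤ.* (x ℤ.* y) ℤ.* (X ℤ.- Y)
           ℤ.- V ℤ.* (s₁ ℤ.* s₁ ℤ.* s₂ ℤ.- s₂ ℤ.* s₂ ℤ.- s₁)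
  schur-31 V V≡ = combine (value x y z V X Y Z s₁ s₂ s₃ V≡ x³≡ y³≡ z³≡ e₁≡ e₂≡ e₃≡)
    where
    value : ∀ x y z V X Y Z s₁ s₂ s₃ → vandermonde x y z ≡ V →
      x ℤ.* x ℤ.* x ≡ X → y ℤ.* y ℤ.* y ≡ Y → z ℤ.* z ℤ.* z ≡ Z →
      x ℤ.+ y ℤ.+ z ≡ s₁ → x ℤ.* y ℤ.+ y ℤ.* z ℤ.+ z ℤ.* x ≡ s₂ → x ℤ.* y ℤ.* z ≡ s₃ →
      (y ℤ.* z) ℤ.* (y ℤ.* z) ℤ.* (Y ℤ.- Z) ℤ.+ (z ℤ.* x) ℤ.* (z ℤ.* x) ℤ.* (Z ℤ.- X)
        ℤ.+ (x ℤ.* y) ℤ.* (x ℤ.* y) ℤ.* (X ℤ.- Y) ≡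
      V ℤ.* (s₁ ℤ.* s₁ ℤ.* s₂ ℤ.- s₂ ℤ.* s₂ ℤ.- s₁ ℤ.* s₃)
    value x y z _ _ _ _ _ _ _ refl refl refl refl refl refl refl = alternant-520 x y z
    identity : ∀ V s₁ s₂ s₃ → (s₃ ℤ.- 1ℤ) ℤ.* (ℤ.- (V ℤ.* s₁)) ≡
      V ℤ.* (s₁ ℤ.* s₁ ℤ.* s₂ ℤ.- s₂ ℤ.* s₂ ℤ.- s₁ ℤ.* s₃)
        ℤ.- V ℤ.* (s₁ ℤ.* s₁ ℤ.* s₂ ℤ.- s₂ ℤ.* s₂ ℤ.- s₁)
    identity = solve-∀
    combine : ∀ {t} → t ≡ V ℤ.* (s₁ ℤ.* s₁ ℤ.* s₂ ℤ.- s₂ ℤ.* s₂ ℤ.- s₁ ℤ.* s₃) →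
      m ∣ℤ t ℤ.- V ℤ.* (s₁ ℤ.* s₁ ℤ.* s₂ ℤ.- s₂ ℤ.* s₂ ℤ.- s₁)
    combine refl = ∣-≡ (s₃-1 ∣* (ℤ.- (V ℤ.* s₁))) (identity V s₁ s₂ s₃)

  -- Here f stands for 1/3: a^(f+1) = a x ≡ x⁴ and b - c ≡ y³ - z³ turn Binet's sum into the
  -- alternant with exponents 4, 3, 0.
  T-third : ∀ f → a ℤ.^ f ≡ x → b ℤ.^ f ≡ y → c ℤ.^ f ≡ z → ∀ V → vandermonde x y z ≡ V →
    m ∣ℤ vandermonde a b c ℤ.* T (+ f) ℤ.- V ℤ.* (s₂ ℤ.* s₂ ℤ.- s₁)
  T-third f aᶠ≡x bᶠ≡y cᶠ≡z V V≡ = ∣-trans-- (vandermonde a b c ℤ.* T (+ f)) (powerSum v (suc f)) G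
    (binet v f)
    (∣-trans-- (powerSum v (suc f))
      (X ℤ.* x ℤ.* (Y ℤ.- Z) ℤ.+ Y ℤ.* y ℤ.* (Z ℤ.- X) ℤ.+ Z ℤ.* z ℤ.* (X ℤ.- Y)) G
      (∣-flip _ (powerSum v (suc f)) (alternant-cong (X ℤ.* x) (Y ℤ.* y) (Z ℤ.* z)
        (a ℤ.^ suc f) (b ℤ.^ suc f) (c ℤ.^ suc f) X Y Z a b c
        (term a X x X-a aᶠ≡x) (term b Y y Y-b bᶠ≡y) (term c Z z Z-c cᶠ≡z) X-a Y-b Z-c))
      (schur-22 V V≡))
    where
    G : ℤ
    G = V ℤ.* (s₂ ℤ.* s₂ ℤ.- s₁)

    identity : ∀ a X x → (X ℤ.- a) ℤ.* x ≡ X ℤ.* x ℤ.- a ℤ.* x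
    identity = solve-∀

    term : ∀ a X x → m ∣ℤ X ℤ.- a → a ℤ.^ f ≡ x → m ∣ℤ X ℤ.* x ℤ.- a ℤ.^ suc f
    term a X _ d refl = ∣-≡ (d ∣* (a ℤ.^ f)) (identity a X (a ℤ.^ f))

  -- Since abc = xyz = 1, a⁻¹ x = b c x = y³ z³ x = y² z².
  T-third-2 : ∀ e → a ℤ.^ (2 ℕ.+ e) ≡ x → b ℤ.^ (2 ℕ.+ e) ≡ y → c ℤ.^ (2 ℕ.+ e) ≡ z →
    ∀ V → vandermonde x y z ≡ V →
    m ∣ℤ vandermonde a b c ℤ.* T (+ e) ℤ.- V ℤ.* (s₁ ℤ.* s₁ ℤ.* s₂ ℤ.- s₂ ℤ.* s₂ ℤ.- s₁)
  T-third-2 e aᶠ≡x bᶠ≡y cᶠ≡z V V≡ = ∣-trans-- (vandermonde a b c ℤ.* T (+ e)) (powerSum v (suc e)) G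
    (binet v e)
    (∣-trans-- (powerSum v (suc e))
      ((y ℤ.* z) ℤ.* (y ℤ.* z) ℤ.* (Y ℤ.- Z) ℤ.+ (z ℤ.* x) ℤ.* (z ℤ.* x) ℤ.* (Z ℤ.- X)
         ℤ.+ (x ℤ.* y) ℤ.* (x ℤ.* y) ℤ.* (X ℤ.- Y)) G
      (∣-flip _ (powerSum v (suc e)) (alternant-cong
        ((y ℤ.* z) ℤ.* (y ℤ.* z)) ((z ℤ.* x) ℤ.* (z ℤ.* x)) ((x ℤ.* y) ℤ.* (x ℤ.* y))
        (a ℤ.^ suc e) (b ℤ.^ suc e) (c ℤ.^ suc e) X Y Z a b c
        (term a b c x y z Y Z v aᶠ≡x y³≡ z³≡ Y-b Z-c e₃≡)
        (term b c a y z x Z X (rotate v) bᶠ≡y z³≡ x³≡ Z-c X-a (trans (cycle y z x) (trans (cycle z x y) e₃≡)))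
        (term c a b z x y X Y (rotate (rotate v)) cᶠ≡z x³≡ y³≡ X-a Y-b (trans (cycle z x y) e₃≡))
        X-a Y-b Z-c))
      (schur-31 V V≡))
    where
    G : ℤ
    G = V ℤ.* (s₁ ℤ.* s₁ ℤ.* s₂ ℤ.- s₂ ℤ.* s₂ ℤ.- s₁)

    cycle : ∀ x y z → x ℤ.* y ℤ.* z ≡ y ℤ.* z ℤ.* x
    cycle = solve-∀

    identity : ∀ a b c u y z →
      (a ℤ.* b ℤ.* c ℤ.- 1ℤ) ℤ.* u ℤ.+ (y ℤ.* y ℤ.* y ℤ.* (z ℤ.* z ℤ.* z) ℤ.- b ℤ.* c) ℤ.* (a ℤ.* u)
        ℤ.- (a ℤ.* u ℤ.* y ℤ.* z ℤ.- 1ℤ) ℤ.* ((y ℤ.* z) ℤ.* (y ℤ.* z)) ≡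
      (y ℤ.* z) ℤ.* (y ℤ.* z) ℤ.- u
    identity = solve-∀

    term′ : ∀ a b c u y z → m ∣ℤ a ℤ.* b ℤ.* c ℤ.- 1ℤ →
      m ∣ℤ y ℤ.* y ℤ.* y ℤ.* (z ℤ.* z ℤ.* z) ℤ.- b ℤ.* c → m ∣ℤ a ℤ.* u ℤ.* y ℤ.* z ℤ.- 1ℤ →
      m ∣ℤ (y ℤ.* z) ℤ.* (y ℤ.* z) ℤ.- u
    term′ a b c u y z d₁ d₂ d₃ = ∣-≡
      (d₁ ∣* u ∣+ d₂ ∣* (a ℤ.* u) ∣- d₃ ∣* ((y ℤ.* z) ℤ.* (y ℤ.* z))) (identity a b c u y z)

    term : ∀ a b c x y z Y Z → Vieta m a b c → a ℤ.^ (2 ℕ.+ e) ≡ x →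
      y ℤ.* y ℤ.* y ≡ Y → z ℤ.* z ℤ.* z ≡ Z → m ∣ℤ Y ℤ.- b → m ∣ℤ Z ℤ.- c →
      x ℤ.* y ℤ.* z ≡ s₃ → m ∣ℤ (y ℤ.* z) ℤ.* (y ℤ.* z) ℤ.- a ℤ.^ suc e
    term a b c _ y z _ _ v refl refl refl d e′ xyz≡s₃ =
      term′ a b c (a ℤ.^ suc e) y z (Vieta.∣e₃-1 v)
        (∣-cong-* (y ℤ.* y ℤ.* y) b (z ℤ.* z ℤ.* z) c d e′)
        (subst (λ t → m ∣ℤ t ℤ.- 1ℤ) (sym xyz≡s₃) s₃-1)

-- Rational zeros

-- The number 2 + e represents 1/3 modulo M, and e represents -5/3. The multipliers 5 and 4, rather
-- than 2 and 1, keep 2 + e at least 2 even for M = 1 and M = 2.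
third-exponent : ∀ M → ¬ (3 ℕ.∣ M) → ∃[ e ] ∃[ c ] 3 ℕ.* (2 ℕ.+ e) ≡ 1 ℕ.+ c ℕ.* M
third-exponent M 3∤M with M % 3 | m≡m%n+[m/n]*n M 3 | m%n<n M 3
... | 0 | M≡ | _ = contradiction (ℕ.divides (M / 3) M≡) 3∤M
... | 1 | M≡ | _ = 5 ℕ.* (M / 3) , 5 ,
  trans (lemma (M / 3)) (cong (λ m → 1 ℕ.+ 5 ℕ.* m) (sym M≡))
  where
  lemma : ∀ q → 3 ℕ.* (2 ℕ.+ 5 ℕ.* q) ≡ 1 ℕ.+ 5 ℕ.* (1 ℕ.+ q ℕ.* 3)
  lemma = ℕ-solver.solve-∀
... | 2 | M≡ | _ = 1 ℕ.+ 4 ℕ.* (M / 3) , 4 ,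
  trans (lemma (M / 3)) (cong (λ m → 1 ℕ.+ 4 ℕ.* m) (sym M≡))
  where
  lemma : ∀ q → 3 ℕ.* (2 ℕ.+ (1 ℕ.+ 4 ℕ.* q)) ≡ 1 ℕ.+ 4 ℕ.* (2 ℕ.+ q ℕ.* 3)
  lemma = ℕ-solver.solve-∀
... | suc (suc (suc _)) | _ | s≤s (s≤s (s≤s ()))

-- The polynomial takes the values -1, -2, 1 at 0, 1, 2. This excludes p = 3, so that 3 is a unit
-- modulo p.
no-root-mod-3 : ∀ {a b c} → ¬ Vieta (+ 3) a b c
no-root-mod-3 {a} v = excluded (a ℤ.%ℕ 3) (a ℤ./ℕ 3) (ℤ.a≡a%ℕn+[a/ℕn]*n a 3) (ℤ.n%ℕd<d a 3) (root v)
  where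
  f : ℤ → ℤ
  f a = a ℤ.* (a ℤ.* a) ℤ.- a ℤ.* a ℤ.- a ℤ.- 1ℤ

  taylor : ∀ r q → f (r ℤ.+ q ℤ.* + 3) ℤ.- (+ 3 ℤ.* (q ℤ.* ((r ℤ.* r ℤ.+ r ℤ.* (r ℤ.+ q ℤ.* + 3)
    ℤ.+ (r ℤ.+ q ℤ.* + 3) ℤ.* (r ℤ.+ q ℤ.* + 3)) ℤ.- (r ℤ.+ (r ℤ.+ q ℤ.* + 3)) ℤ.- 1ℤ))) ≡ f r
  taylor = identity
    where
    identity : ∀ r q → let a = r ℤ.+ q ℤ.* + 3 in
      a ℤ.* (a ℤ.* a) ℤ.- a ℤ.* a ℤ.- a ℤ.- 1ℤ
        ℤ.- (+ 3 ℤ.* (q ℤ.* ((r ℤ.* r ℤ.+ r ℤ.* a ℤ.+ a ℤ.* a) ℤ.- (r ℤ.+ a) ℤ.- 1ℤ))) ≡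
      r ℤ.* (r ℤ.* r) ℤ.- r ℤ.* r ℤ.- r ℤ.- 1ℤ
    identity = solve-∀

  reduce : ∀ r q → a ≡ r ℤ.+ q ℤ.* + 3 → + 3 ∣ℤ f a → + 3 ∣ℤ f r
  reduce r q refl d = ∣-≡ (d ∣- ℤ.∣m⇒∣m*n _ ℤ.∣-refl) (taylor r q)

  excluded : ∀ r q → a ≡ + r ℤ.+ q ℤ.* + 3 → r ℕ.< 3 → ¬ + 3 ∣ℤ f a
  excluded 0 q eq _ d = contradiction (∣⇒∣ᵤ (reduce (+ 0) q eq d)) (ℕ.>⇒∤ (s<s z<s))
  excluded 1 q eq _ d = contradiction (∣⇒∣ᵤ (reduce (+ 1) q eq d)) (ℕ.>⇒∤ (s<s (s<s z<s)))
  excluded 2 q eq _ d = contradiction (∣⇒∣ᵤ (reduce (+ 2) q eq d)) (ℕ.>⇒∤ (s<s z<s))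
  excluded (suc (suc (suc _))) _ _ (s≤s (s≤s (s≤s ())))

module _ (p : ℕ) (p-prime : Prime p) where

  private
    P : ℤ
    P = + p

  -- With y the N-th power of a root, this makes exponents of roots matter only modulo N p^k when
  -- working modulo p^(k+1).
  unit-power : ¬ P ∣ℤ + 2 → ∀ k y q → P ∣ℤ y ℤ.- 1ℤ →
               P ℤ.^ suc k ∣ℤ y ℤ.^ (q ℕ.* p ℕ.^ k) ℤ.- 1ℤ
  unit-power P∤2 k y q P∣y-1 = ∣-≡
    (ℤ.∣-trans (^-monoʳ-∣ P (ℕ.n≤1+n (suc k))) (power-expansion p p-prime P∤2 k y q P∣y-1)
      ∣+ subst (P ℤ.^ suc k ∣ℤ_) (cong (ℤ._* (y ℤ.- 1ℤ)) (sym +m≡))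
           (subst (_∣ℤ + q ℤ.* P ℤ.^ k ℤ.* (y ℤ.- 1ℤ)) (ℤ.*-comm (P ℤ.^ k) P)
             (∣-* (ℤ.∣n⇒∣m*n (+ q) ℤ.∣-refl) P∣y-1)))
    (lemma (y ℤ.^ (q ℕ.* p ℕ.^ k)) (+ (q ℕ.* p ℕ.^ k) ℤ.* (y ℤ.- 1ℤ)))
    where
    +m≡ : + (q ℕ.* p ℕ.^ k) ≡ + q ℤ.* P ℤ.^ k
    +m≡ = trans (ℤ.pos-* q (p ℕ.^ k)) (cong (+ q ℤ.*_) (pos-^ p k))
    lemma : ∀ x y → x ℤ.- 1ℤ ℤ.- y ℤ.+ y ≡ x ℤ.- 1ℤ
    lemma = solve-∀

  ∤-+ : ∀ {x y} → P ∣ℤ x → ¬ P ∣ℤ y → ¬ P ∣ℤ x ℤ.+ y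
  ∤-+ P∣x P∤y P∣x+y = P∤y (ℤ.∣m+n∣m⇒∣n P∣x+y P∣x)

  -- p ∣ t only gives p ∣ σ, but then r is a unit and r σ ≡ 0 yields σ ≡ 0 mod pᵏ⁺¹.
  lift-zero : ∀ k V′ V t G s₂ h σ r → ¬ P ∣ℤ V′ → ¬ P ∣ℤ V →
    P ℤ.^ suc k ∣ℤ V′ ℤ.* t ℤ.- V ℤ.* G → P ℤ.^ suc k ∣ℤ s₂ ℤ.* G ℤ.- h ℤ.* σ →
    P ℤ.^ suc k ∣ℤ r ℤ.* σ → (P ∣ℤ h ℤ.* σ → P ∣ℤ σ) →
    (P ∣ℤ σ → ¬ P ∣ℤ r) → (P ∣ℤ σ → ¬ P ∣ℤ s₂) → P ∣ℤ t → P ℤ.^ suc k ∣ℤ t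
  lift-zero k V′ V t G s₂ h σ r P∤V′ P∤V t≈ G≈ rσ≈0 hσ P∤r P∤s₂ P∣t =
    ^-∣-* p p-prime (suc k) V′ P∤V′ (∣-≡ (t≈ ∣+ ℤ.∣n⇒∣m*n V Pᵏ∣G) (x-y+y≡x (V′ ℤ.* t) (V ℤ.* G)))
    where

    P∣Pᵏ : P ∣ℤ P ℤ.^ suc k
    P∣Pᵏ = ℤ.∣m⇒∣m*n (P ℤ.^ k) ℤ.∣-refl

    P∣V*G : P ∣ℤ V ℤ.* G
    P∣V*G = ∣-≡ (ℤ.∣n⇒∣m*n V′ P∣t ∣- ℤ.∣-trans P∣Pᵏ t≈) (x-[x-y]≡y (V′ ℤ.* t) (V ℤ.* G))

    P∣G : P ∣ℤ G
    P∣G = [ (λ P∣V → contradiction P∣V P∤V) , (λ d → d) ]′ (prime-∣-* p p-prime V G P∣V*G)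

    P∣σ : P ∣ℤ σ
    P∣σ = hσ (∣-≡ (ℤ.∣n⇒∣m*n s₂ P∣G ∣- ℤ.∣-trans P∣Pᵏ G≈) (x-[x-y]≡y (s₂ ℤ.* G) (h ℤ.* σ)))

    Pᵏ∣σ : P ℤ.^ suc k ∣ℤ σ
    Pᵏ∣σ = ^-∣-* p p-prime (suc k) r (P∤r P∣σ) rσ≈0

    Pᵏ∣G : P ℤ.^ suc k ∣ℤ G
    Pᵏ∣G = ^-∣-* p p-prime (suc k) s₂ (P∤s₂ P∣σ)
      (∣-≡ (G≈ ∣+ ℤ.∣n⇒∣m*n h Pᵏ∣σ) (x-y+y≡x (s₂ ℤ.* G) (h ℤ.* σ)))

module Zeros (p : ℕ) (p-prime : Prime p) (p≢2 : p ≢ 2) (p≢11 : p ≢ 11)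
  (N : ℕ) (3∤N : ¬ (3 ℕ.∣ N)) (roots : ∀ k → RootsModulo p p-prime p≢2 p≢11 N k) where

  open Periods p p-prime p≢2 p≢11 N roots

  private
    P : ℤ
    P = + p

  p≢3 : p ≢ 3
  p≢3 refl = no-root-mod-3 (RootsModulo.vieta (roots 0))

  P∤2 : ¬ P ∣ℤ + 2
  P∤2 = ∤2 p p-prime p≢2 p≢11

  P∤3 : ¬ P ∣ℤ + 3
  P∤3 = ∤-prime p p-prime prime[3] p≢3

  -- Expresses that T, interpolated p-adically on the class of ℓ, vanishes at b / D: integers of the
  -- class tend to b / D while their T-values tend to 0.
  Approximates : (D b ℓ : ℤ) → Set
  Approximates D b ℓ = ∀ k → ∃[ e ] (+ N ∣ℤ e ℤ.- ℓ) ×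
    (P ℤ.^ suc k ∣ℤ D ℤ.* e ℤ.- b) × (P ℤ.^ suc k ∣ℤ T e)

  module Third (k e c : ℕ) (3f≡ : 3 ℕ.* (2 ℕ.+ e) ≡ 1 ℕ.+ c ℕ.* (N ℕ.* p ℕ.^ suc k)) where
    open RootsModulo (roots k)

    f : ℕ
    f = 2 ℕ.+ e

    m : ℤ
    m = P ℤ.^ suc k

    cube-root : ∀ a → P ∣ℤ a ℤ.^ N ℤ.- 1ℤ → m ∣ℤ a ℤ.^ f ℤ.* a ℤ.^ f ℤ.* a ℤ.^ f ℤ.- a
    cube-root a order = ∣-≡ (unit-power p p-prime P∤2 k (a ℤ.^ N) (c ℕ.* p) order ∣* a)
      (trans (lemma a ((a ℤ.^ N) ℤ.^ (c ℕ.* p ℕ.* p ℕ.^ k))) (cong (ℤ._- a) (sym cube≡)))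
      where
      open ≡.≡-Reasoning
      lemma : ∀ a x → (x ℤ.- 1ℤ) ℤ.* a ≡ a ℤ.* x ℤ.- a
      lemma = solve-∀
      cube-^ : ∀ x → x ℤ.* x ℤ.* x ≡ x ℤ.* (x ℤ.* (x ℤ.* 1ℤ))
      cube-^ = solve-∀
      exponent : ∀ c N p q → c ℕ.* (N ℕ.* (p ℕ.* q)) ≡ N ℕ.* (c ℕ.* p ℕ.* q)
      exponent = ℕ-solver.solve-∀
      cube≡ : a ℤ.^ f ℤ.* a ℤ.^ f ℤ.* a ℤ.^ f ≡ a ℤ.* (a ℤ.^ N) ℤ.^ (c ℕ.* p ℕ.* p ℕ.^ k)
      cube≡ = begin
        a ℤ.^ f ℤ.* a ℤ.^ f ℤ.* a ℤ.^ f               ≡⟨ cube-^ (a ℤ.^ f) ⟩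
        (a ℤ.^ f) ℤ.^ 3                               ≡⟨ ℤ.^-*-assoc a f 3 ⟩
        a ℤ.^ (f ℕ.* 3)                               ≡⟨ cong (a ℤ.^_) (trans (ℕ.*-comm f 3) 3f≡) ⟩
        a ℤ.* a ℤ.^ (c ℕ.* (N ℕ.* p ℕ.^ suc k))       ≡⟨ cong (λ i → a ℤ.* a ℤ.^ i) (exponent c N p (p ℕ.^ k)) ⟩
        a ℤ.* a ℤ.^ (N ℕ.* (c ℕ.* p ℕ.* p ℕ.^ k))     ≡⟨ cong (a ℤ.*_) (ℤ.^-*-assoc a N (c ℕ.* p ℕ.* p ℕ.^ k)) ⟨
        a ℤ.* (a ℤ.^ N) ℤ.^ (c ℕ.* p ℕ.* p ℕ.^ k)     ∎

    x y z X Y Z s₁ s₂ s₃ V V′ σ r : ℤ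
    x = α ℤ.^ f
    y = β ℤ.^ f
    z = γ ℤ.^ f
    X = x ℤ.* x ℤ.* x
    Y = y ℤ.* y ℤ.* y
    Z = z ℤ.* z ℤ.* z
    s₁ = x ℤ.+ y ℤ.+ z
    s₂ = x ℤ.* y ℤ.+ y ℤ.* z ℤ.+ z ℤ.* x
    s₃ = x ℤ.* y ℤ.* z
    V = vandermonde x y z
    V′ = vandermonde α β γ
    σ = s₁ ℤ.* s₂ ℤ.- + 2
    r = σ ℤ.* (s₁ ℤ.* s₂ ℤ.- + 5) ℤ.- + 6

    product≡1 : m ∣ℤ s₃ ℤ.- 1ℤ
    product≡1 = subst (λ t → m ∣ℤ t ℤ.- 1ℤ)
      (trans (^-distribʳ-* (α ℤ.* β) γ f) (cong (ℤ._* z) (^-distribʳ-* α β f)))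
      (∣x-1⇒∣xⁿ-1 (α ℤ.* β ℤ.* γ) f (Vieta.∣e₃-1 vieta))

    open CubeRoots m α β γ x y z X Y Z s₁ s₂ s₃ vieta refl refl refl
      (cube-root α α-order) (cube-root β β-order) (cube-root γ γ-order) refl refl refl product≡1

    P∣m : P ∣ℤ m
    P∣m = P∣Pˢ k

    P∤V′ : ¬ P ∣ℤ V′
    P∤V′ = ∤vandermonde p p-prime p≢2 p≢11 P∣m vieta

    P∤V : ¬ P ∣ℤ V
    P∤V P∣V = P∤V′ (∣-≡ (ℤ.∣-trans P∣m (proj₂ V∣vandermonde) ∣+ P∣V ∣* proj₁ V∣vandermonde)
      (x-y+y≡x V′ (V ℤ.* proj₁ V∣vandermonde)))

    P∤r : P ∣ℤ σ → ¬ P ∣ℤ r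
    P∤r P∣σ = ∤-+ p p-prime (P∣σ ∣* (s₁ ℤ.* s₂ ℤ.- + 5)) (∤-* p p-prime (+ 2) -[1+ 2 ] P∤2 P∤-3)
      where
      P∤-3 : ¬ P ∣ℤ -[1+ 2 ]
      P∤-3 d = P∤3 (∣ᵤ⇒∣ (∣⇒∣ᵤ d))

    -- For s₁ s₂ ≡ 2 the equation for s₂³ reads s₂³ ≡ 3 · 2 - 4 = 2.
    P∤s₂ : P ∣ℤ σ → ¬ P ∣ℤ s₂
    P∤s₂ P∣σ P∣s₂ = P∤2 (∣-≡
      (P∣s₂ ∣* (s₂ ℤ.* s₂) ∣- ℤ.∣-trans P∣m s₂³ ∣- P∣σ ∣* + 3) (lemma (s₁ ℤ.* s₂) s₂))
      where
      lemma : ∀ s u → u ℤ.* (u ℤ.* u) ℤ.- (u ℤ.* u ℤ.* u ℤ.- (+ 3 ℤ.* s ℤ.- + 4))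
        ℤ.- (s ℤ.- + 2) ℤ.* + 3 ≡ + 2
      lemma = solve-∀

    m∣T[f] : P ∣ℤ T (+ f) → m ∣ℤ T (+ f)
    m∣T[f] = lift-zero p p-prime k V′ V (T (+ f)) (s₂ ℤ.* s₂ ℤ.- s₁) s₂ (+ 2) σ r P∤V′ P∤V
      (T-third f refl refl refl V refl) s₂*[s₂²-s₁] resolvent
      (λ d → [ (λ P∣2 → contradiction P∣2 P∤2) , (λ P∣σ → P∣σ) ]′ (prime-∣-* p p-prime (+ 2) σ d))
      P∤r P∤s₂

    m∣T[e] : P ∣ℤ T (+ e) → m ∣ℤ T (+ e)
    m∣T[e] = lift-zero p p-prime k V′ V (T (+ e)) (s₁ ℤ.* s₁ ℤ.* s₂ ℤ.- s₂ ℤ.* s₂ ℤ.- s₁) s₂ σ σ r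
      P∤V′ P∤V (T-third-2 e refl refl refl V refl) s₂*[s₁²s₂-s₂²-s₁] resolvent
      (λ d → [ (λ P∣σ → P∣σ) , (λ P∣σ → P∣σ) ]′ (prime-∣-* p p-prime σ σ d))
      P∤r P∤s₂

  private
    ∤-power : ∀ k → ¬ (3 ℕ.∣ N ℕ.* p ℕ.^ k)
    ∤-power zero    3∣ = 3∤N (subst (3 ℕ.∣_) (ℕ.*-identityʳ N) 3∣)
    ∤-power (suc k) 3∣ with euclidsLemma (N ℕ.* p ℕ.^ k) p prime[3]
      (subst (3 ℕ.∣_) (trans (cong (N ℕ.*_) (ℕ.*-comm p (p ℕ.^ k))) (sym (ℕ.*-assoc N (p ℕ.^ k) p))) 3∣)
    ... | inj₁ 3∣Npᵏ = ∤-power k 3∣Npᵏ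
    ... | inj₂ 3∣p = ∤-prime 3 prime[3] p-prime (p≢3 ∘ sym) (∣ᵤ⇒∣ 3∣p)

    -- f inverts 3 modulo N.
    cancel-3 : ∀ f u v → + N ∣ℤ + 3 ℤ.* f ℤ.- 1ℤ → + N ∣ℤ + 3 ℤ.* (u ℤ.- v) → + N ∣ℤ u ℤ.- v
    cancel-3 f u v d e = ∣-≡ (ℤ.∣n⇒∣m*n f e ∣- d ∣* (u ℤ.- v)) (lemma f (u ℤ.- v))
      where
      lemma : ∀ f x → f ℤ.* (+ 3 ℤ.* x) ℤ.- (+ 3 ℤ.* f ℤ.- 1ℤ) ℤ.* x ≡ x
      lemma = solve-∀

    transfer : ∀ ℓ e → P ∣ℤ T ℓ → + N ∣ℤ e ℤ.- ℓ → P ∣ℤ T e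
    transfer ℓ e P∣Tℓ N∣ = ∣-≡ (T-periodic ℓ e N∣ ∣+ P∣Tℓ) (x-y+y≡x (T e) (T ℓ))

    module _ (k : ℕ) where
      -- The modulus N p^(k+1) serves two ends: the factor N places e in the right class, the factor
      -- p^(k+1) gives the precision of the approximation.
      e c : ℕ
      e = proj₁ (third-exponent (N ℕ.* p ℕ.^ suc k) (∤-power (suc k)))
      c = proj₁ (proj₂ (third-exponent (N ℕ.* p ℕ.^ suc k) (∤-power (suc k))))

      3f≡ : 3 ℕ.* (2 ℕ.+ e) ≡ 1 ℕ.+ c ℕ.* (N ℕ.* p ℕ.^ suc k)
      3f≡ = proj₂ (proj₂ (third-exponent (N ℕ.* p ℕ.^ suc k) (∤-power (suc k))))

      3f-1≡ : + 3 ℤ.* + (2 ℕ.+ e) ℤ.- 1ℤ ≡ + c ℤ.* (+ N ℤ.* P ℤ.^ suc k)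
      3f-1≡ = begin
        + 3 ℤ.* + (2 ℕ.+ e) ℤ.- 1ℤ                     ≡⟨ cong (ℤ._- 1ℤ) (ℤ.pos-* 3 (2 ℕ.+ e)) ⟨
        + (3 ℕ.* (2 ℕ.+ e)) ℤ.- 1ℤ                     ≡⟨ cong (λ i → + i ℤ.- 1ℤ) 3f≡ ⟩
        1ℤ ℤ.+ + (c ℕ.* (N ℕ.* p ℕ.^ suc k)) ℤ.- 1ℤ    ≡⟨ lemma (+ (c ℕ.* (N ℕ.* p ℕ.^ suc k))) ⟩
        + (c ℕ.* (N ℕ.* p ℕ.^ suc k))                  ≡⟨ ℤ.pos-* c (N ℕ.* p ℕ.^ suc k) ⟩
        + c ℤ.* + (N ℕ.* p ℕ.^ suc k)                  ≡⟨ cong (+ c ℤ.*_) (ℤ.pos-* N (p ℕ.^ suc k)) ⟩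
        + c ℤ.* (+ N ℤ.* + (p ℕ.^ suc k))              ≡⟨ cong (λ i → + c ℤ.* (+ N ℤ.* i)) (pos-^ p (suc k)) ⟩
        + c ℤ.* (+ N ℤ.* P ℤ.^ suc k)                  ∎
        where
        open ≡.≡-Reasoning
        lemma : ∀ x → 1ℤ ℤ.+ x ℤ.- 1ℤ ≡ x
        lemma = solve-∀

      N∣3f-1 : + N ∣ℤ + 3 ℤ.* + (2 ℕ.+ e) ℤ.- 1ℤ
      N∣3f-1 = ∣-≡ (ℤ.∣n⇒∣m*n (+ c) (ℤ.∣m⇒∣m*n (P ℤ.^ suc k) ℤ.∣-refl)) (sym 3f-1≡)

      Pᵏ∣3f-1 : P ℤ.^ suc k ∣ℤ + 3 ℤ.* + (2 ℕ.+ e) ℤ.- 1ℤ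
      Pᵏ∣3f-1 = ∣-≡ (ℤ.∣n⇒∣m*n (+ c) (ℤ.∣n⇒∣m*n (+ N) ℤ.∣-refl)) (sym 3f-1≡)

      3e+5≡ : + 3 ℤ.* + (2 ℕ.+ e) ℤ.- 1ℤ ≡ + 3 ℤ.* + e ℤ.- -[1+ 4 ]
      3e+5≡ = lemma (+ e)
        where
        lemma : ∀ e → + 3 ℤ.* (+ 2 ℤ.+ e) ℤ.- 1ℤ ≡ + 3 ℤ.* e ℤ.- -[1+ 4 ]
        lemma = solve-∀

    difference : ∀ e ℓ b → + 3 ℤ.* e ℤ.- b ℤ.- (+ 3 ℤ.* ℓ ℤ.- b) ≡ + 3 ℤ.* (e ℤ.- ℓ)
    difference = solve-∀

  third : ∀ ℓ → P ∣ℤ T ℓ → + N ∣ℤ + 3 ℤ.* ℓ ℤ.- 1ℤ → Approximates (+ 3) 1ℤ ℓ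
  third ℓ P∣Tℓ N∣3ℓ-1 k = f , N∣f-ℓ , Pᵏ∣3f-1 k ,
    Third.m∣T[f] k (e k) (c k) (3f≡ k) (transfer ℓ f P∣Tℓ N∣f-ℓ)
    where
    f : ℤ
    f = + (2 ℕ.+ e k)
    N∣f-ℓ : + N ∣ℤ f ℤ.- ℓ
    N∣f-ℓ = cancel-3 f f ℓ (N∣3f-1 k) (∣-≡ (N∣3f-1 k ∣- N∣3ℓ-1) (difference f ℓ 1ℤ))

  minus-five-thirds : ∀ ℓ → P ∣ℤ T ℓ → + N ∣ℤ + 3 ℤ.* ℓ ℤ.- -[1+ 4 ] →
                      Approximates (+ 3) -[1+ 4 ] ℓ
  minus-five-thirds ℓ P∣Tℓ N∣3ℓ+5 k = + e k , N∣e-ℓ , ∣-≡ (Pᵏ∣3f-1 k) (3e+5≡ k) ,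
    Third.m∣T[e] k (e k) (c k) (3f≡ k) (transfer ℓ (+ e k) P∣Tℓ N∣e-ℓ)
    where
    N∣e-ℓ : + N ∣ℤ + e k ℤ.- ℓ
    N∣e-ℓ = cancel-3 (+ (2 ℕ.+ e k)) (+ e k) ℓ (N∣3f-1 k)
      (∣-≡ (∣-≡ (N∣3f-1 k) (3e+5≡ k) ∣- N∣3ℓ+5) (difference (+ e k) ℓ -[1+ 4 ]))

  integer-zero : ∀ b ℓ → T b ≡ 0ℤ → + N ∣ℤ 1ℤ ℤ.* ℓ ℤ.- b → Approximates 1ℤ b ℓ
  integer-zero b ℓ Tb≡0 N∣ℓ-b k =
    b , ∣-≡ (∣0 ∣- N∣ℓ-b) (lemma b ℓ) , ∣-0≡ (cancel b) , ∣-0≡ Tb≡0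
    where
    lemma : ∀ b ℓ → 0ℤ ℤ.- (1ℤ ℤ.* ℓ ℤ.- b) ≡ b ℤ.- ℓ
    lemma = solve-∀
    cancel : ∀ b → 1ℤ ℤ.* b ℤ.- b ≡ 0ℤ
    cancel = solve-∀

  -- `zero-at-b` covers an integer n equal to a itself, where both valuations are infinite. For 1/3
  -- and -5/3 it is vacuous, since 3 divides neither 1 nor 5.
  record RationalZero (a : ℚ) : Set where
    field
      D b       : ℤ
      D*a≡b     : fromℤ D ℚ.* a ≡ fromℤ b
      P∤D       : ¬ P ∣ℤ D
      zero-at-b : ∀ n → D ℤ.* n ≡ b → T n ≡ 0ℤ
      approximates : ∀ ℓ → P ∣ℤ T ℓ → + N ∣ℤ D ℤ.* ℓ ℤ.- b → Approximates D b ℓ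

  special-zero : ∀ {a} → a ∈ specialRationals → RationalZero a
  special-zero = λ
    { (here refl)                                         → integer 0ℤ refl
    ; (there (here refl))                                 → integer -[1+ 0 ] refl
    ; (there (there (here refl)))                         → integer -[1+ 3 ] refl
    ; (there (there (there (here refl))))                 → integer -[1+ 16 ] refl
    ; (there (there (there (there (here refl)))))         → record
      { D = + 3 ; b = 1ℤ ; D*a≡b = refl ; P∤D = P∤3
      ; zero-at-b = λ n 3n≡1 → contradiction (divisible n 3n≡1) (ℕ.>⇒∤ (s<s z<s))
      ; approximates = third }
    ; (there (there (there (there (there (here refl)))))) → record
      { D = + 3 ; b = -[1+ 4 ] ; D*a≡b = refl ; P∤D = P∤3
      ; zero-at-b = λ n 3n≡-5 → contradiction (divisible n 3n≡-5) 3∤5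
      ; approximates = minus-five-thirds }
    }
    where
    P∤1 : ¬ P ∣ℤ 1ℤ
    P∤1 d = ℕ.<⇒≱ (1<p p p-prime) (ℕ.∣⇒≤ (∣⇒∣ᵤ d))

    integer : ∀ b → T b ≡ 0ℤ → RationalZero (fromℤ b)
    integer b Tb≡0 = record
      { D = 1ℤ ; b = b ; D*a≡b = ℚ.*-identityˡ (fromℤ b) ; P∤D = P∤1
      ; zero-at-b = λ n n≡b → trans (cong T (trans (sym (ℤ.*-identityˡ n)) n≡b)) Tb≡0
      ; approximates = λ ℓ _ → integer-zero b ℓ Tb≡0 }

    divisible : ∀ {b} n → + 3 ℤ.* n ≡ b → 3 ℕ.∣ ℤ.∣ b ∣
    divisible n refl = ∣⇒∣ᵤ (ℤ.∣m⇒∣m*n {+ 3} {+ 3} n ℤ.∣-refl)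

    3∤5 : ¬ (3 ℕ.∣ 5)
    3∤5 = from-no (3 ℕ.∣? 5)

  -- Multiplication by D clears the denominator of a and leaves N ∣ m (D ℓ - b), where m is coprime
  -- to N.
  clear-congruence : ∀ {a} (z : RationalZero a) → let open RationalZero z in
    ∀ ℓ → fromℤ ℓ ≡ℚ a [mod N ] → + N ∣ℤ D ℤ.* ℓ ℤ.- b
  clear-congruence {a} z ℓ (m , coprime , u , v , mℓ≡u , ma≡v , modulo N∣u-v) =
    ∣ᵤ⇒∣ (ℤ.coprime-divisor (+ N) m (D ℤ.* ℓ ℤ.- b) (ℤ.sym {m} {+ N} coprime) (∣⇒∣ᵤ
      (∣-≡ (ℤ.∣n⇒∣m*n D N∣u-v) Du-Dv≡)))
    where
    open RationalZero z
    open ≡.≡-Reasoning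

    mℓ≡u′ : m ℤ.* ℓ ≡ u
    mℓ≡u′ = fromℤ-injective (trans (fromℤ-homo-* m ℓ) mℓ≡u)

    Dv≡mb : D ℤ.* v ≡ m ℤ.* b
    Dv≡mb = fromℤ-injective (begin
      fromℤ (D ℤ.* v)                     ≡⟨ fromℤ-homo-* D v ⟩
      fromℤ D ℚ.* fromℤ v                 ≡⟨ cong (fromℤ D ℚ.*_) ma≡v ⟨
      fromℤ D ℚ.* (fromℤ m ℚ.* a)         ≡⟨ ℚ.*-assoc (fromℤ D) (fromℤ m) a ⟨
      fromℤ D ℚ.* fromℤ m ℚ.* a           ≡⟨ cong (ℚ._* a) (ℚ.*-comm (fromℤ D) (fromℤ m)) ⟩
      fromℤ m ℚ.* fromℤ D ℚ.* a           ≡⟨ ℚ.*-assoc (fromℤ m) (fromℤ D) a ⟩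
      fromℤ m ℚ.* (fromℤ D ℚ.* a)         ≡⟨ cong (fromℤ m ℚ.*_) D*a≡b ⟩
      fromℤ m ℚ.* fromℤ b                 ≡⟨ fromℤ-homo-* m b ⟨
      fromℤ (m ℤ.* b)                     ∎)

    distribute : ∀ D u v → D ℤ.* (u ℤ.- v) ≡ D ℤ.* u ℤ.- D ℤ.* v
    distribute = solve-∀

    factor : ∀ D m ℓ b → D ℤ.* (m ℤ.* ℓ) ℤ.- m ℤ.* b ≡ m ℤ.* (D ℤ.* ℓ ℤ.- b)
    factor = solve-∀

    Du-Dv≡ : D ℤ.* (u ℤ.- v) ≡ m ℤ.* (D ℤ.* ℓ ℤ.- b)
    Du-Dv≡ = begin
      D ℤ.* (u ℤ.- v)                     ≡⟨ distribute D u v ⟩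
      D ℤ.* u ℤ.- D ℤ.* v                 ≡⟨ cong₂ (λ x y → D ℤ.* x ℤ.- y) (sym mℓ≡u′) Dv≡mb ⟩
      D ℤ.* (m ℤ.* ℓ) ℤ.- m ℤ.* b         ≡⟨ factor D m ℓ b ⟩
      m ℤ.* (D ℤ.* ℓ ℤ.- b)               ∎

  exactPower-0 : ∀ {z} → ¬ P ∣ℤ z → ExactPower p p-prime 0 z
  exactPower-0 {z} P∤z = exact z (sym (ℤ.*-identityˡ z)) P∤z

  constantOn : ∀ ℓ → ¬ P ∣ℤ T (+ ℓ) → ConstantOn p N ℓ
  constantOn ℓ P∤Tℓ = 0 , [] , λ { n (modulo N∣n-ℓ) _ →
    ν-fromℤ p p-prime {z = T n} (exactPower-0 (λ P∣Tn → P∤Tℓ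
      (∣-≡ (P∣Tn ∣- T-periodic (+ ℓ) n N∣n-ℓ) (x-[x-y]≡y (T n) (T (+ ℓ)))))) }

  -- Here κ = μ = 1. As p ∤ N gives ν(N) = 0, the condition on a - ℓ is p-integrality, which p ∤ D
  -- provides.
  linearOn : ¬ P ∣ℤ + N → ∀ ℓ {a} → P ∣ℤ T (+ ℓ) → ¬ P ℤ.^ 2 ∣ℤ drift (+ ℓ) →
             RationalZero a → fromℤ (+ ℓ) ≡ℚ a [mod N ] → LinearOn p N ℓ
  linearOn P∤N ℓ {a} P∣Tℓ P²∤drift z ℓ≡a =
    a , 1ℤ , 1 , z<s , subst (_≤∞ ν p (a ℚ.- fromℤ (+ ℓ))) (sym (ν-fromℤ p p-prime (exactPower-0 P∤N)))
      a-ℓ-integral , [] , λ { n (modulo N∣n-ℓ) _ → valuation n N∣n-ℓ }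
    where
    open RationalZero z

    D≢0 : D ≢ 0ℤ
    D≢0 D≡0 = P∤D (subst (P ∣ℤ_) (sym D≡0) ∣0)

    D*n≡ : ∀ n → fromℤ D ℚ.* fromℤ n ≡ fromℤ (D ℤ.* n)
    D*n≡ n = sym (fromℤ-homo-* D n)

    D*[n-a]≡ : ∀ n → fromℤ D ℚ.* (fromℤ n ℚ.- a) ≡ fromℤ (D ℤ.* n ℤ.- b)
    D*[n-a]≡ n = clear-difference D (D ℤ.* n) b (fromℤ n) a (D*n≡ n) D*a≡b

    D*[a-ℓ]≡ : fromℤ D ℚ.* (a ℚ.- fromℤ (+ ℓ)) ≡ fromℤ (b ℤ.- D ℤ.* + ℓ)
    D*[a-ℓ]≡ = clear-difference D b (D ℤ.* + ℓ) a (fromℤ (+ ℓ)) D*a≡b (D*n≡ (+ ℓ))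

    a-ℓ-integral : [ 0ℤ ] ≤∞ ν p (a ℚ.- fromℤ (+ ℓ))
    a-ℓ-integral with b ℤ.- D ℤ.* + ℓ ℤ.≟ 0ℤ
    ... | yes b-Dℓ≡0 = subst ([ 0ℤ ] ≤∞_)
      (sym (ν-0 p D (a ℚ.- fromℤ (+ ℓ)) D≢0 (trans D*[a-ℓ]≡ (cong fromℤ b-Dℓ≡0)))) ([ 0ℤ ] ≤∞.≤⊤⁺)
    ... | no b-Dℓ≢0 = subst ([ 0ℤ ] ≤∞_)
      (sym (ν-exact p p-prime D (a ℚ.- fromℤ (+ ℓ)) P∤D D*[a-ℓ]≡
        (proj₂ (exactPower p p-prime (b ℤ.- D ℤ.* + ℓ) b-Dℓ≢0)))) ≤∞.[ ℤ.+≤+ z≤n ]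

    valuation : ∀ n → + N ∣ℤ n ℤ.- + ℓ → ν p (fromℤ (T n)) ≡ affine 1ℤ 1 (ν p (fromℤ n ℚ.- a))
    valuation n N∣n-ℓ with D ℤ.* n ℤ.- b ℤ.≟ 0ℤ
    ... | yes Dn-b≡0 = begin
      ν p (fromℤ (T n))   ≡⟨ cong (ν p ∘ fromℤ) (zero-at-b n (ℤ.i-j≡0⇒i≡j (D ℤ.* n) b Dn-b≡0)) ⟩
      ν p (fromℤ 0ℤ)      ≡⟨ ν-0 p 1ℤ (fromℤ 0ℤ) (λ ()) (ℚ.*-identityˡ (fromℤ 0ℤ)) ⟩
      ⊤⁺                  ≡⟨ cong (affine 1ℤ 1) (ν-0 p D (fromℤ n ℚ.- a) D≢0
                               (trans (D*[n-a]≡ n) (cong fromℤ Dn-b≡0))) ⟨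
      affine 1ℤ 1 (ν p (fromℤ n ℚ.- a)) ∎
      where open ≡.≡-Reasoning
    ... | no Dn-b≢0 = finish (exactPower p p-prime (D ℤ.* n ℤ.- b) Dn-b≢0)
      where
      open ≡.≡-Reasoning

      finish : ∃[ k ] ExactPower p p-prime k (D ℤ.* n ℤ.- b) →
        ν p (fromℤ (T n)) ≡ affine 1ℤ 1 (ν p (fromℤ n ℚ.- a))
      -- The argument `suc k` requests precision p^(k+2), one power beyond the expected valuation k
      -- + 1 of `T n`.
      finish (k , Dn-b) = conclude (approximates (+ ℓ) P∣Tℓ (clear-congruence z (+ ℓ) ℓ≡a) (suc k))
        where
        conclude : ∃[ e ] (+ N ∣ℤ e ℤ.- + ℓ) × (P ℤ.^ (2 ℕ.+ k) ∣ℤ D ℤ.* e ℤ.- b) ×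
          (P ℤ.^ (2 ℕ.+ k) ∣ℤ T e) → ν p (fromℤ (T n)) ≡ affine 1ℤ 1 (ν p (fromℤ n ℚ.- a))
        conclude (e , N∣e-ℓ , De-b , Te) = begin
          ν p (fromℤ (T n))
            ≡⟨ ν-fromℤ p p-prime (T-exactPower P∤N D b n e P∤D
                 (∣-≡ (N∣n-ℓ ∣- N∣e-ℓ) (lemma n e (+ ℓ))) Dn-b De-b Te P²∤drift-e) ⟩
          [ + suc k ]
            ≡⟨ cong (λ i → [ 1ℤ ℤ.+ i ]) (ℤ.*-identityˡ (+ k)) ⟨
          affine 1ℤ 1 [ + k ]
            ≡⟨ cong (affine 1ℤ 1) (ν-exact p p-prime D (fromℤ n ℚ.- a) P∤D
                 (D*[n-a]≡ n) Dn-b) ⟨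
          affine 1ℤ 1 (ν p (fromℤ n ℚ.- a)) ∎
          where
          lemma : ∀ n e ℓ → n ℤ.- ℓ ℤ.- (e ℤ.- ℓ) ≡ n ℤ.- e
          lemma = solve-∀
          P²∤drift-e : ¬ P ℤ.^ 2 ∣ℤ drift e
          P²∤drift-e d = P²∤drift (∣-≡ (d ∣- drift-cong (+ ℓ) e N∣e-ℓ) (x-[x-y]≡y (drift e) (drift (+ ℓ))))

-- p-adic integers

module _ (p : ℕ) (p-prime : Prime p) where

  private
    P : ℤ
    P = + p
    module ℤₚ = CommutativeRing (ℤₚ p)

  1≢0-ℤₚ : ¬ ℤₚ.1# ℤₚ.≈ ℤₚ.0#
  1≢0-ℤₚ eq with residues eq 1
  ... | modulo d = ℕ.<⇒≱ (1<p p p-prime) (ℕ.∣⇒≤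
    (subst (ℕ._∣ 1) (ℕ.*-identityʳ p) (∣⇒∣ᵤ d)))

  -- Division by p loses one power of the modulus, so the residues of index n are compared through
  -- those of index n + 1.
  p-cancel : ∀ x y → constant p (+ p) ℤₚ.* x ℤₚ.≈ constant p (+ p) ℤₚ.* y → x ℤₚ.≈ y
  p-cancel x y eq = padic-eq λ n → modulo (cancel n (residues eq (suc n)) (coherent x n) (coherent y n))
    where
    lemma : ∀ P x y → P ℤ.* x ℤ.- P ℤ.* y ≡ P ℤ.* (x ℤ.- y)
    lemma = solve-∀
    lemma′ : ∀ x y x′ y′ → x′ ℤ.- y′ ℤ.- (x′ ℤ.- x) ℤ.+ (y′ ℤ.- y) ≡ x ℤ.- y
    lemma′ = solve-∀
    cancel : ∀ n → P ℤ.* residue x (suc n) ≡ℤ P ℤ.* residue y (suc n) [mod p ℕ.^ suc n ] →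
      residue x (suc n) ≡ℤ residue x n [mod p ℕ.^ n ] →
      residue y (suc n) ≡ℤ residue y n [mod p ℕ.^ n ] →
      + (p ℕ.^ n) ∣ℤ residue x n ℤ.- residue y n
    cancel n (modulo d) (modulo dx) (modulo dy) = ∣-≡
      (ℤ.*-cancelˡ-∣ P {+ (p ℕ.^ n)} {residue x (suc n) ℤ.- residue y (suc n)} {{prime⇒nonZero p-prime}}
        (subst (_∣ℤ P ℤ.* (residue x (suc n) ℤ.- residue y (suc n))) (ℤ.pos-* p (p ℕ.^ n))
          (∣-≡ d (lemma P (residue x (suc n)) (residue y (suc n)))))
        ∣- dx ∣+ dy)
      (lemma′ (residue x n) (residue y n) (residue x (suc n)) (residue y (suc n)))

  p∣residue : ∀ (x : PadicInteger p) → P ∣ℤ residue x 1 → ∀ n → P ∣ℤ residue x (suc n)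
  p∣residue x d zero    = d
  p∣residue x d (suc n) with coherent x (suc n)
  ... | modulo e = ∣-≡ (ℤ.∣-trans (subst (P ∣ℤ_) (sym (ℤ.pos-* p (p ℕ.^ n))) (ℤ.∣m⇒∣m*n {P} {P} (+ (p ℕ.^ n)) ℤ.∣-refl)) e
      ∣+ p∣residue x d n) (x-y+y≡x (residue x (suc (suc n))) (residue x (suc n)))

  -- The n-th residue of the quotient is the residue of x of index n + 1 divided by p; the shift
  -- pays for the lost power of p.
  p-divide : ∀ (x : PadicInteger p) → P ∣ℤ residue x 1 → ∃[ y ] x ℤₚ.≈ constant p (+ p) ℤₚ.* y
  p-divide x d = y , padic-eq λ n → modulo (agree n (coherent x n))
    where
    q : ℕ → ℤ
    q n = ℤ.quotient (p∣residue x d n)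

    q≡ : ∀ n → residue x (suc n) ≡ q n ℤ.* P
    q≡ n = ℤ._∣_.equality (p∣residue x d n)

    lemma : ∀ a b P → a ℤ.* P ℤ.- b ℤ.* P ≡ P ℤ.* (a ℤ.- b)
    lemma = solve-∀

    step : ∀ n → residue x (suc (suc n)) ≡ℤ residue x (suc n) [mod p ℕ.^ suc n ] →
           + (p ℕ.^ n) ∣ℤ q (suc n) ℤ.- q n
    step n (modulo e) = ℤ.*-cancelˡ-∣ P {+ (p ℕ.^ n)} {q (suc n) ℤ.- q n} {{prime⇒nonZero p-prime}}
      (subst (_∣ℤ P ℤ.* (q (suc n) ℤ.- q n)) (ℤ.pos-* p (p ℕ.^ n))
        (∣-≡ e (trans (cong₂ ℤ._-_ (q≡ (suc n)) (q≡ n)) (lemma (q (suc n)) (q n) P))))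

    y : PadicInteger p
    y = record { residue = q ; coherent = λ n → modulo (step n (coherent x (suc n))) }

    agree : ∀ n → residue x (suc n) ≡ℤ residue x n [mod p ℕ.^ n ] →
            + (p ℕ.^ n) ∣ℤ residue x n ℤ.- P ℤ.* q n
    agree n (modulo e) = ∣-≡ (∣0 ∣- e)
      (trans (flip (residue x (suc n)) (residue x n))
        (cong (λ z → residue x n ℤ.- z) (trans (q≡ n) (ℤ.*-comm (q n) P))))
      where
      flip : ∀ x y → 0ℤ ℤ.- (x ℤ.- y) ≡ y ℤ.- x
      flip = solve-∀

  p-divide-cube : ∀ x y → x ℤₚ.* x ℤₚ.* x ℤₚ.≈ constant p (+ p) ℤₚ.* y → ∃[ z ] x ℤₚ.≈ constant p (+ p) ℤₚ.* z
  p-divide-cube x y eq = p-divide x (root-of-cube (residues eq 1))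
    where
    a = residue x 1
    b = residue y 1
    root-of-cube : a ℤ.* a ℤ.* a ≡ℤ P ℤ.* b [mod p ℕ.^ 1 ] → P ∣ℤ a
    root-of-cube (modulo d) = [ (λ e → [ (λ f → f) , (λ f → f) ]′ (prime-∣-* p p-prime a a e)) , (λ f → f) ]′
      (prime-∣-* p p-prime (a ℤ.* a) a (∣-≡
        (subst (λ m → + m ∣ℤ a ℤ.* a ℤ.* a ℤ.- P ℤ.* b) (ℕ.*-identityʳ p) d
          ∣+ ℤ.∣m⇒∣m*n {P} {P} b ℤ.∣-refl) (x-y+y≡x (a ℤ.* a ℤ.* a) (P ℤ.* b))))

  1≢0-ℚₚ : ¬ CommutativeRing._≈_ (ℚₚ p) (CommutativeRing.1# (ℚₚ p)) (CommutativeRing.0# (ℚₚ p))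
  1≢0-ℚₚ eq = 1≢0-ℤₚ (ι-injective (ℤₚ p) (constant p (+ p)) p-cancel p-divide-cube {ℤₚ.1#} {ℤₚ.0#} eq)

  padic-roots : AllRootsInℚₚ p → TribonacciRoots (ℤₚ p)
  padic-roots split = integral-roots (ℤₚ p) (constant p (+ p)) p-cancel p-divide-cube
    (splits⇒roots (ℚₚ p) 1≢0-ℚₚ split)

-- Reduction modulo p and the order N

module ReductionModuloP (p : ℕ) (p-prime : Prime p) where

  private
    P : ℤ
    P = + p

    U : Group _ _
    U = unitGroup (ℤₚ/p p)

    module ℤₚ = CommutativeRing (ℤₚ p)
    module ℤₚ/p = CommutativeRing (ℤₚ/p p)
    module U = Group U

  residue-divides : ∀ (x : PadicInteger p) y n → x ℤₚ.≈ y →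
                    P ℤ.^ n ∣ℤ residue x n ℤ.- residue y n
  residue-divides x y n x≈y with residues x≈y n
  ... | modulo d = subst (_∣ℤ residue x n ℤ.- residue y n) (pos-^ p n) d

  -- Restricted to positive indices, because the residue of index 0 is determined only modulo 1.
  ≈/p⇒∣ : ∀ (x y : PadicInteger p) n → x ℤₚ/p.≈ y → P ∣ℤ residue x (suc n) ℤ.- residue y (suc n)
  ≈/p⇒∣ x y n (quot-eq {q} eq) = ∣-≡
    (ℤ.∣-trans (ℤ.∣m⇒∣m*n (P ℤ.^ n) ℤ.∣-refl)
      (residue-divides x (y ℤₚ.+ constant p (+ p) ℤₚ.* q) (suc n) eq)
      ∣+ ℤ.∣m⇒∣m*n {P} {P} (residue q (suc n)) ℤ.∣-refl)
    (lemma (residue x (suc n)) (residue y (suc n)) (P ℤ.* residue q (suc n)))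
    where
    lemma : ∀ x y z → x ℤ.- (y ℤ.+ z) ℤ.+ z ≡ x ℤ.- y
    lemma = solve-∀

  ∣⇒≈/p : ∀ (x y : PadicInteger p) → P ∣ℤ residue x 1 ℤ.- residue y 1 → x ℤₚ/p.≈ y
  ∣⇒≈/p x y d = quot-eq {quotient = proj₁ divided} (begin
    x                                     ≈⟨ ℤₚ.+-identityˡ x ⟨
    ℤₚ.0# ℤₚ.+ x                          ≈⟨ ℤₚ.+-congʳ (ℤₚ.-‿inverseʳ y) ⟨
    y ℤₚ.- y ℤₚ.+ x                       ≈⟨ ℤₚ.+-assoc y (ℤₚ.- y) x ⟩
    y ℤₚ.+ (ℤₚ.- y ℤₚ.+ x)                ≈⟨ ℤₚ.+-congˡ {y} (ℤₚ.+-comm (ℤₚ.- y) x) ⟩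
    y ℤₚ.+ (x ℤₚ.- y)                     ≈⟨ ℤₚ.+-congˡ {y} (proj₂ divided) ⟩
    y ℤₚ.+ constant p (+ p) ℤₚ.* proj₁ divided  ∎)
    where
    open import Relation.Binary.Reasoning.Setoid ℤₚ.setoid
    divided : ∃[ q ] (x ℤₚ.- y) ℤₚ.≈ constant p (+ p) ℤₚ.* q
    divided = p-divide p p-prime (x ℤₚ.- y) d

  unit-residue : ∀ (u : Unit (ℤₚ/p p)) → ¬ P ∣ℤ residue (Unit.value u) 1
  unit-residue u d = ℕ.<⇒≱ (1<p p p-prime) (ℕ.∣⇒≤ (∣⇒∣ᵤ (∣-≡
    (d ∣* residue (Unit.inverse u) 1
      ∣- ≈/p⇒∣ (Unit.value u ℤₚ.* Unit.inverse u) ℤₚ.1# 0 (Unit.value*inv u))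
    (lemma (residue (Unit.value u) 1 ℤ.* residue (Unit.inverse u) 1)))))
    where
    lemma : ∀ x → x ℤ.- (x ℤ.- 1ℤ) ≡ 1ℤ
    lemma = solve-∀

  residue-pow : ∀ n (x : PadicInteger p) k → residue (pow (ℤₚ/p p) n x) k ≡ residue x k ℤ.^ n
  residue-pow zero    x k = refl
  residue-pow (suc n) x k = cong (residue x k ℤ.*_) (residue-pow n x k)

  module _ (N : ℕ) (order : IsRootOrder p N) where
    open Bijection order using (to; injective; strictlySurjective)

    element : Fin N → Unit (ℤₚ/p p)
    element i = proj₁ (to i)

    order≢0 : N ≢ 0
    order≢0 refl with strictlySurjective (U.ε , Generated.unit)
    ... | () , _

    private
      instance
        p-nonZero : NonZero p
        p-nonZero = prime⇒nonZero p-prime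

      remainder : Fin N → ℕ
      remainder i = residue (Unit.value (element i)) 1 ℤ.%ℕ p

      remainder-spec : ∀ i → P ∣ℤ residue (Unit.value (element i)) 1 ℤ.- + remainder i
      remainder-spec i = divides (a ℤ./ℕ p)
        (trans (cong (ℤ._- + remainder i) (ℤ.a≡a%ℕn+[a/ℕn]*n a p)) (lemma (+ remainder i) (a ℤ./ℕ p ℤ.* P)))
        where
        a = residue (Unit.value (element i)) 1
        lemma : ∀ r x → r ℤ.+ x ℤ.- r ≡ x
        lemma = solve-∀

      remainder≢0 : ∀ i → remainder i ≢ 0
      remainder≢0 i r≡0 = unit-residue (element i)
        (∣-≡ (remainder-spec i) (trans (cong (λ r → a ℤ.- + r) r≡0) (ℤ.+-identityʳ a)))
        where a = residue (Unit.value (element i)) 1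

      remainder-injective : ∀ {i j} → remainder i ≡ remainder j → i ≡ j
      remainder-injective {i} {j} eq = injective (∣⇒≈/p (Unit.value (element i)) (Unit.value (element j))
        (∣-≡ (remainder-spec i ∣- subst (λ r → P ∣ℤ b ℤ.- + r) (sym eq) (remainder-spec j))
          (lemma a b (+ remainder i))))
        where
        a = residue (Unit.value (element i)) 1
        b = residue (Unit.value (element j)) 1
        lemma : ∀ a b r → a ℤ.- r ℤ.- (b ℤ.- r) ≡ a ℤ.- b
        lemma = solve-∀

      -- The N elements of the subgroup have distinct nonzero residues modulo p. One extra point
      -- sent to 0 yields N + 1 ≤ p, hence p ∤ N.
      reduction : Fin (suc N) → Fin p
      reduction Fin.zero    = Fin.fromℕ< (ℕ.<-trans z<s (1<p p p-prime))
      reduction (Fin.suc i) = Fin.fromℕ< (ℤ.n%ℕd<d (residue (Unit.value (element i)) 1) p)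

      toℕ-reduction : ∀ i → Fin.toℕ (reduction (Fin.suc i)) ≡ remainder i
      toℕ-reduction i = Fin.toℕ-fromℕ< _

      toℕ-reduction-zero : Fin.toℕ (reduction Fin.zero) ≡ 0
      toℕ-reduction-zero = Fin.toℕ-fromℕ< _

      reduction-injective : Injective _≡_ _≡_ reduction
      reduction-injective {Fin.zero}  {Fin.zero}  _  = refl
      reduction-injective {Fin.zero}  {Fin.suc j} eq = contradiction
        (trans (sym (toℕ-reduction j)) (trans (cong Fin.toℕ (sym eq)) toℕ-reduction-zero)) (remainder≢0 j)
      reduction-injective {Fin.suc i} {Fin.zero}  eq = contradiction
        (trans (sym (toℕ-reduction i)) (trans (cong Fin.toℕ eq) toℕ-reduction-zero)) (remainder≢0 i)
      reduction-injective {Fin.suc i} {Fin.suc j} eq = cong Fin.suc (remainder-injective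
        (trans (sym (toℕ-reduction i)) (trans (cong Fin.toℕ eq) (toℕ-reduction j))))

    order<p : N ℕ.< p
    order<p = Fin.injective⇒≤ reduction-injective

    p∤order : ¬ P ∣ℤ + N
    p∤order d = ℕ.<⇒≱ order<p (ℕ.∣⇒≤ {{ℕ.≢-nonZero order≢0}} (∣⇒∣ᵤ d))

    vieta : (t : TribonacciRoots (ℤₚ p)) → let open TribonacciRoots t in
            ∀ n → Vieta (P ℤ.^ n) (residue α n) (residue β n) (residue γ n)
    vieta t n = record
      { ∣e₁-1 = residue-divides (α ℤₚ.+ β ℤₚ.+ γ) ℤₚ.1# n sum-1
      ; ∣e₂+1 = ∣-≡ (residue-divides (α ℤₚ.* β ℤₚ.+ β ℤₚ.* γ ℤₚ.+ γ ℤₚ.* α ℤₚ.+ ℤₚ.1#) ℤₚ.0# n pairs+1)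
                    (ℤ.+-identityʳ _)
      ; ∣e₃-1 = residue-divides (α ℤₚ.* β ℤₚ.* γ) ℤₚ.1# n product-1
      }
      where open TribonacciRoots t

    open Polynomial (ℤₚ p) using (IsRoot; tribonacciPolynomial)

    isRoot : (t : TribonacciRoots (ℤₚ p)) → IsRoot tribonacciPolynomial (TribonacciRoots.α t)
    isRoot t = padic-eq λ n → modulo (subst (_∣ℤ eval (residue α n) ℤ.- 0ℤ) (sym (pos-^ p n))
      (∣-≡ (root (vieta t n)) (lemma (residue α n))))
      where
      open TribonacciRoots t
      eval : ℤ → ℤ
      eval x = -1ℤ ℤ.+ x ℤ.* (-1ℤ ℤ.+ x ℤ.* (-1ℤ ℤ.+ x ℤ.* (1ℤ ℤ.+ x ℤ.* 0ℤ)))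
      lemma : ∀ x → x ℤ.* (x ℤ.* x) ℤ.- x ℤ.* x ℤ.- x ℤ.- 1ℤ ≡
        -1ℤ ℤ.+ x ℤ.* (-1ℤ ℤ.+ x ℤ.* (-1ℤ ℤ.+ x ℤ.* (1ℤ ℤ.+ x ℤ.* 0ℤ))) ℤ.- 0ℤ
      lemma = solve-∀

    root-order : (t : TribonacciRoots (ℤₚ p)) → ∀ k →
      P ∣ℤ residue (TribonacciRoots.α t) (suc k) ℤ.^ N ℤ.- 1ℤ
    root-order t k = subst (λ x → P ∣ℤ x ℤ.- 1ℤ) (residue-pow N α (suc k))
      (≈/p⇒∣ (pow (ℤₚ/p p) N α) ℤₚ.1# k
        (pow-order (ℤₚ/p p) (IsRootImage p) N order rootUnit (generator (α , isRoot t , ℤₚ/p.refl))))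
      where
      open TribonacciRoots t
      rootUnit : Unit (ℤₚ/p p)
      rootUnit = record
        { value     = α
        ; inverse   = β ℤₚ.* γ
        ; value*inv = ∣⇒≈/p (α ℤₚ.* (β ℤₚ.* γ)) ℤₚ.1# (subst (λ x → P ∣ℤ x ℤ.- 1ℤ)
            (ℤ.*-assoc (residue α 1) (residue β 1) (residue γ 1))
            (subst (_∣ℤ residue α 1 ℤ.* residue β 1 ℤ.* residue γ 1 ℤ.- 1ℤ) (ℤ.*-identityʳ P)
              (residue-divides (α ℤₚ.* β ℤₚ.* γ) ℤₚ.1# 1 product-1)))
        }

    rootsModulo : (p≢2 : p ≢ 2) (p≢11 : p ≢ 11) → TribonacciRoots (ℤₚ p) →
                  ∀ k → RootsModulo p p-prime p≢2 p≢11 N k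
    rootsModulo _ _ t k = record
      { α       = residue (TribonacciRoots.α t) (suc k)
      ; β       = residue (TribonacciRoots.β t) (suc k)
      ; γ       = residue (TribonacciRoots.γ t) (suc k)
      ; vieta   = vieta t (suc k)
      ; α-order = root-order t k
      ; β-order = root-order (rotate-roots (ℤₚ p) t) k
      ; γ-order = root-order (rotate-roots (ℤₚ p) (rotate-roots (ℤₚ p) t)) k
      }

-- Constant and linear classes modulo N

open import Data.Nat.Base using (_+_; _^_; _<_)
open import Data.Nat.Divisibility using (_∣_)

theorem24 : (p : ℕ) → Prime p → p ≢ 2 → p ≢ 11 →
    AllRootsInℚₚ p →
    (N : ℕ) → IsRootOrder p N → ¬ (3 ∣ N) →
    (∀ (ℓ : ℕ) → ℓ < N → (+ p) ∣ℤ T (+ ℓ) →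
    ¬ (T (+ (ℓ + N)) ≡ℤ T (+ ℓ) [mod p ^ 2 ]) ×
    (Σ ℚ λ a → a ∈ specialRationals × fromℤ (+ ℓ) ≡ℚ a [mod N ])) →
    MLR p
theorem24 p p-prime p≢2 p≢11 split N order 3∤N zeros =
  N , ℕ.n≢0⇒n>0 (order≢0 N order) , λ ℓ ℓ<N → behaviour ℓ ℓ<N (+ p ℤ.∣? T (+ ℓ))
  where
  open ReductionModuloP p p-prime
  open Zeros p p-prime p≢2 p≢11 N 3∤N (rootsModulo N order p≢2 p≢11 (padic-roots p p-prime split))

  behaviour : ∀ ℓ → ℓ < N → Dec (+ p ∣ℤ T (+ ℓ)) → ConstantOn p N ℓ ⊎ LinearOn p N ℓ
  behaviour ℓ _   (no p∤Tℓ)  = inj₁ (constantOn ℓ p∤Tℓ)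
  behaviour ℓ ℓ<N (yes p∣Tℓ) = inj₂ (linear (zeros ℓ ℓ<N p∣Tℓ))
    where
    linear : ¬ (T (+ (ℓ + N)) ≡ℤ T (+ ℓ) [mod p ^ 2 ]) ×
      (Σ ℚ λ a → a ∈ specialRationals × fromℤ (+ ℓ) ≡ℚ a [mod N ]) → LinearOn p N ℓ
    linear (p²∤ , a , a∈ , ℓ≡a) = linearOn (p∤order N order) ℓ p∣Tℓ
      (λ d → p²∤ (modulo (subst (_∣ℤ T (+ (ℓ + N)) ℤ.- T (+ ℓ)) (sym (pos-^ p 2)) d)))
      (special-zero a∈) ℓ≡a
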